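{- For every integer $n\ge 0$, $$\ell_n=(-1)^{n-1}\int_1^{+\infty}\frac{\{x\}}{x^2}L_n(\log x)\,\mathrm{d}x .$$
   Context: $\{x\}=x-\lfloor x\rfloor$ is the fractional part. $L_n(u)=\sum_{k=0}^n\binom{n}{k}\frac{(-1)^k}{k!}u^k$ are the Laguerre polynomials. The Stieltjes constants are $\gamma_n=\lim_{N\to\infty}\left(\sum_{k=1}^N\frac{\log^n k}{k}-\frac{\log^{n+1}N}{n+1}\right)$. The coefficients $\ell_n$ are defined by $\ell_0=\gamma_0-1$ and $\ell_n=\sum_{k=1}^n\binom{n-1}{k-1}\frac{(-1)^{n-k}}{k!}\gamma_k$ for $n\ge1$. -}

module Defs where

open import Data.Nat.Base as ℕ using (ℕ; zero; suc; _!)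
import Data.Nat.Properties as ℕP
import Data.Nat.Combinatorics as Comb
open import Data.Integer.Base as ℤ using (ℤ; +_)
import Data.Integer.Properties as ℤP
open import Data.Rational.Base as ℚ using (ℚ; 0ℚ; 1ℚ; ½; 1/_; mkℚ)
import Data.Rational.Unnormalised.Base as ℚᵘ
import Data.Rational.Unnormalised.Properties as ℚᵘP
import Data.Rational.Properties as ℚP
open import Data.Rational.Solver using (module +-*-Solver)
open import Data.Product.Base using (Σ; Σ-syntax; ∃; _×_; _,_; proj₁; proj₂)
open import Data.Sum.Base using (inj₁; inj₂)
open import Relation.Binary.PropositionalEquality

module ℚLemmas where
  open import Data.Rational.Base
  open import Data.Rational.Properties
  open ≤-Reasoning

  mulˡ : ∀ {r p q} → 0ℚ ≤ r → p ≤ q → r * p ≤ r * q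
  mulˡ {r} 0≤r = *-monoˡ-≤-nonNeg r {{nonNegative 0≤r}}

  mulʳ : ∀ {r p q} → 0ℚ ≤ r → p ≤ q → p * r ≤ q * r
  mulʳ {r} 0≤r = *-monoʳ-≤-nonNeg r {{nonNegative 0≤r}}

  mul-mono : ∀ {a b c d} → 0ℚ ≤ c → 0ℚ ≤ b → a ≤ b → c ≤ d → a * c ≤ b * d
  mul-mono 0≤c 0≤b a≤b c≤d = ≤-trans (mulʳ 0≤c a≤b) (mulˡ 0≤b c≤d)

  mul-nonNeg : ∀ {p q} → 0ℚ ≤ p → 0ℚ ≤ q → 0ℚ ≤ p * q
  mul-nonNeg {p} {q} 0≤p 0≤q = subst (_≤ p * q) (*-zeroʳ p) (mulˡ 0≤p 0≤q)

  add-nonNeg : ∀ {p q} → 0ℚ ≤ p → 0ℚ ≤ q → 0ℚ ≤ p + q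
  add-nonNeg = +-mono-≤

  0≤1 : 0ℚ ≤ 1ℚ
  0≤1 = nonNegative⁻¹ 1ℚ

  p≤∣p∣ : ∀ p → p ≤ ∣ p ∣
  p≤∣p∣ p with ≤-total 0ℚ p
  ... | inj₁ 0≤p = ≤-reflexive (sym (0≤p⇒∣p∣≡p 0≤p))
  ... | inj₂ p≤0 = ≤-trans p≤0 (0≤∣p∣ p)

  abs-swap : ∀ p q → ∣ p - q ∣ ≡ ∣ q - p ∣
  abs-swap p q = trans (sym (∣-p∣≡∣p∣ (p - q)))
    (cong ∣_∣ (solve 2 (λ p q → :- (p :- q) := q :- p) refl p q))
    where open +-*-Solver

  abs-≤ : ∀ {p c} → p ≤ c → - p ≤ c → ∣ p ∣ ≤ c
  abs-≤ {p} p≤c -p≤c with ∣p∣≡p∨∣p∣≡-p p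
  ... | inj₁ e = subst (_≤ _) (sym e) p≤c
  ... | inj₂ e = subst (_≤ _) (sym e) -p≤c

  shift : ∀ {p q c} → p ≤ q + c → p - q ≤ c
  shift {p} {q} {c} h = begin
    p - q       ≤⟨ +-monoˡ-≤ (- q) h ⟩
    q + c - q   ≡⟨ solve 2 (λ q c → q :+ c :- q := c) refl q c ⟩
    c           ∎
    where open +-*-Solver

  unshift : ∀ {p q c} → p - q ≤ c → p ≤ q + c
  unshift {p} {q} {c} h = begin
    p             ≡⟨ solve 2 (λ p q → p := q :+ (p :- q)) refl p q ⟩
    q + (p - q)   ≤⟨ +-monoʳ-≤ q h ⟩
    q + c         ∎
    where open +-*-Solver

  dist-≤ : ∀ {p q c} → p ≤ q + c → q ≤ p + c → ∣ p - q ∣ ≤ c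
  dist-≤ {p} {q} {c} h k = abs-≤ (shift h)
    (subst (_≤ c) (solve 2 (λ p q → q :- p := :- (p :- q)) refl p q) (shift k))
    where open +-*-Solver

  near : ∀ p q → p ≤ q + ∣ p - q ∣
  near p q = unshift (p≤∣p∣ (p - q))

  triangle : ∀ p q r → ∣ p - r ∣ ≤ ∣ p - q ∣ + ∣ q - r ∣
  triangle p q r = subst (λ t → ∣ t ∣ ≤ ∣ p - q ∣ + ∣ q - r ∣)
    (solve 3 (λ p q r → (p :- q) :+ (q :- r) := p :- r) refl p q r)
    (∣p+q∣≤∣p∣+∣q∣ (p - q) (q - r))
    where open +-*-Solver

  ∣∣-dist : ∀ p q → ∣ ∣ p ∣ - ∣ q ∣ ∣ ≤ ∣ p - q ∣
  ∣∣-dist p q = dist-≤ (half p q)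
    (subst (λ t → ∣ q ∣ ≤ ∣ p ∣ + t) (abs-swap q p) (half q p))
    where
    half : ∀ a b → ∣ a ∣ ≤ ∣ b ∣ + ∣ a - b ∣
    half a b = subst (λ t → ∣ t ∣ ≤ ∣ b ∣ + ∣ a - b ∣)
      (solve 2 (λ a b → b :+ (a :- b) := a) refl a b)
      (∣p+q∣≤∣p∣+∣q∣ b (a - b))
      where open +-*-Solver

  ⊔1-dist : ∀ p q → ∣ (p ⊔ 1ℚ) - (q ⊔ 1ℚ) ∣ ≤ ∣ p - q ∣
  ⊔1-dist p q = dist-≤ (half p q)
    (subst (λ t → q ⊔ 1ℚ ≤ (p ⊔ 1ℚ) + t) (abs-swap q p) (half q p))
    where
    half : ∀ a b → a ⊔ 1ℚ ≤ (b ⊔ 1ℚ) + ∣ a - b ∣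
    half a b = ⊔-lub
      (≤-trans (near a b) (+-monoˡ-≤ ∣ a - b ∣ (p≤p⊔q b 1ℚ)))
      (≤-trans (p≤q⊔p b 1ℚ)
        (subst (_≤ (b ⊔ 1ℚ) + ∣ a - b ∣) (+-identityʳ _)
          (+-monoʳ-≤ (b ⊔ 1ℚ) (0≤∣p∣ (a - b)))))

  ⊔1-pos : ∀ p → Positive (p ⊔ 1ℚ)
  ⊔1-pos p = positive (<-≤-trans (positive⁻¹ 1ℚ) (p≤q⊔p p 1ℚ))

  -- 1/max(p,1)
  inv : ℚ → ℚ
  inv p = (1/ (p ⊔ 1ℚ)) {{pos⇒nonZero (p ⊔ 1ℚ) {{⊔1-pos p}}}}

  inv-inverse : ∀ p → (p ⊔ 1ℚ) * inv p ≡ 1ℚ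
  inv-inverse p = *-inverseʳ (p ⊔ 1ℚ) {{pos⇒nonZero (p ⊔ 1ℚ) {{⊔1-pos p}}}}

  inv-nonNeg : ∀ p → 0ℚ ≤ inv p
  inv-nonNeg p = <⇒≤ (positive⁻¹ (inv p) {{1/pos⇒pos (p ⊔ 1ℚ) {{⊔1-pos p}}}})

  inv-≤1 : ∀ p → inv p ≤ 1ℚ
  inv-≤1 p = begin
    inv p               ≡⟨ *-identityˡ (inv p) ⟨
    1ℚ * inv p          ≤⟨ mulʳ (inv-nonNeg p) (p≤q⊔p p 1ℚ) ⟩
    (p ⊔ 1ℚ) * inv p    ≡⟨ inv-inverse p ⟩
    1ℚ                  ∎

  inv-dist : ∀ p q → ∣ inv p - inv q ∣ ≤ ∣ p - q ∣
  inv-dist p q = begin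
    ∣ inv p - inv q ∣                   ≡⟨ cong ∣_∣ factor ⟩
    ∣ (inv p * inv q) * (b - a) ∣       ≡⟨ ∣p*q∣≡∣p∣*∣q∣ (inv p * inv q) (b - a) ⟩
    ∣ inv p * inv q ∣ * ∣ b - a ∣       ≡⟨ cong (_* ∣ b - a ∣) (0≤p⇒∣p∣≡p (mul-nonNeg (inv-nonNeg p) (inv-nonNeg q))) ⟩
    (inv p * inv q) * ∣ b - a ∣         ≤⟨ mulʳ (0≤∣p∣ (b - a)) (mul-mono (inv-nonNeg q) 0≤1 (inv-≤1 p) (inv-≤1 q)) ⟩
    (1ℚ * 1ℚ) * ∣ b - a ∣               ≡⟨ *-identityˡ ∣ b - a ∣ ⟩
    ∣ b - a ∣                           ≡⟨ abs-swap b a ⟩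
    ∣ a - b ∣                           ≤⟨ ⊔1-dist p q ⟩
    ∣ p - q ∣                           ∎
    where
    a = p ⊔ 1ℚ
    b = q ⊔ 1ℚ
    factor : inv p - inv q ≡ (inv p * inv q) * (b - a)
    factor = ≡R.begin
      inv p - inv q
        ≡R.≡⟨ cong₂ _-_ (sym (*-identityʳ (inv p))) (sym (*-identityʳ (inv q))) ⟩
      inv p * 1ℚ - inv q * 1ℚ
        ≡R.≡⟨ cong₂ (λ s t → inv p * s - inv q * t) (sym (inv-inverse q)) (sym (inv-inverse p)) ⟩
      inv p * (b * inv q) - inv q * (a * inv p)
        ≡R.≡⟨ solve 4 (λ u v a b → u :* (b :* v) :- v :* (a :* u) := (u :* v) :* (b :- a)) refl (inv p) (inv q) a b ⟩
      (inv p * inv q) * (b - a) ≡R.∎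
      where
      module ≡R = ≡-Reasoning
      open +-*-Solver

  /1-suc : ∀ n → + suc n / 1 ≡ + n / 1 + 1ℚ
  /1-suc n = toℚᵘ-injective
    (ℚᵘP.≃-trans (toℚᵘ-fromℚᵘ (ℚᵘ.mkℚᵘ (+ suc n) 0))
    (ℚᵘP.≃-trans (ℚᵘ.*≡* eq)
    (ℚᵘP.≃-sym (ℚᵘP.≃-trans (toℚᵘ-homo-+ (+ n / 1) 1ℚ)
      (ℚᵘP.+-congˡ (ℚᵘ.mkℚᵘ (+ 1) 0) (toℚᵘ-fromℚᵘ (ℚᵘ.mkℚᵘ (+ n) 0)))))))
    where
    eq : + suc n ℤ.* + 1 ≡ (+ n ℤ.* + 1 ℤ.+ + 1 ℤ.* + 1) ℤ.* + 1
    eq = cong (ℤ._* + 1) (trans (cong +_ (ℕP.+-comm 1 n))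
           (cong (ℤ._+ + 1) (sym (ℤP.*-identityʳ (+ n)))))

  /1-inverse : ∀ n → (+ suc n / 1) * (+ 1 / suc n) ≡ 1ℚ
  /1-inverse n = toℚᵘ-injective
    (ℚᵘP.≃-trans (toℚᵘ-homo-* (+ suc n / 1) (+ 1 / suc n))
    (ℚᵘP.≃-trans (ℚᵘP.*-cong (toℚᵘ-fromℚᵘ (ℚᵘ.mkℚᵘ (+ suc n) 0)) (toℚᵘ-fromℚᵘ (ℚᵘ.mkℚᵘ (+ 1) n)))
      (ℚᵘ.*≡* eq)))
    where
    eq : (+ suc n ℤ.* + 1) ℤ.* + 1 ≡ + 1 ℤ.* + suc (n ℕ.+ 0)
    eq = trans (ℤP.*-identityʳ _) (trans (ℤP.*-identityʳ _)
           (trans (cong (λ t → + suc t) (sym (ℕP.+-identityʳ n))) (sym (ℤP.*-identityˡ _))))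

  1/-nonNeg : ∀ n → 0ℚ ≤ + 1 / suc n
  1/-nonNeg n = nonNegative⁻¹ (+ 1 / suc n) {{normalize-nonNeg 1 (suc n)}}

  archimedean : ∀ p → Σ ℕ λ n → p ≤ + n / 1
  archimedean p@(mkℚ a d c) = ℤ.∣ a ∣ , ≤-trans (p≤∣p∣ p)
    (toℚᵘ-cancel-≤ (ℚᵘP.≤-trans {j = ℚᵘ.mkℚᵘ (+ ℤ.∣ a ∣) 0}
      (ℚᵘ.*≤* (subst₂ ℤ._≤_ (ℤP.pos-* ℤ.∣ a ∣ 1) (ℤP.pos-* ℤ.∣ a ∣ (suc d))
        (ℤ.+≤+ (ℕP.*-monoʳ-≤ ℤ.∣ a ∣ (ℕ.s≤s ℕ.z≤n)))))
      (ℚᵘP.≤-reflexive (ℚᵘP.≃-sym (toℚᵘ-fromℚᵘ (ℚᵘ.mkℚᵘ (+ ℤ.∣ a ∣) 0))))))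

  infixr 8 _^_
  _^_ : ℚ → ℕ → ℚ
  p ^ zero  = 1ℚ
  p ^ suc n = p * p ^ n

  ^-nonNeg : ∀ {p} n → 0ℚ ≤ p → 0ℚ ≤ p ^ n
  ^-nonNeg zero    0≤p = 0≤1
  ^-nonNeg (suc n) 0≤p = mul-nonNeg 0≤p (^-nonNeg n 0≤p)

  ^-mono : ∀ {p q} n → 0ℚ ≤ p → p ≤ q → p ^ n ≤ q ^ n
  ^-mono zero    0≤p p≤q = ≤-refl
  ^-mono (suc n) 0≤p p≤q =
    mul-mono (^-nonNeg n 0≤p) (≤-trans 0≤p p≤q) p≤q (^-mono n 0≤p p≤q)

  ^-drop : ∀ {p} m n → 0ℚ ≤ p → p ≤ 1ℚ → p ^ (m ℕ.+ n) ≤ p ^ n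
  ^-drop zero    n 0≤p p≤1 = ≤-refl
  ^-drop {p} (suc m) n 0≤p p≤1 = begin
    p * p ^ (m ℕ.+ n)    ≤⟨ mulʳ (^-nonNeg (m ℕ.+ n) 0≤p) p≤1 ⟩
    1ℚ * p ^ (m ℕ.+ n)   ≡⟨ *-identityˡ _ ⟩
    p ^ (m ℕ.+ n)        ≤⟨ ^-drop m n 0≤p p≤1 ⟩
    p ^ n                ∎

  ^-dist : ∀ {z w r} n → 0ℚ ≤ z → z ≤ r → 0ℚ ≤ w → w ≤ r →
           ∣ z ^ suc n - w ^ suc n ∣ ≤ (+ suc n / 1) * r ^ n * ∣ z - w ∣
  ^-dist {z} {w} {r} zero _ _ _ _ = ≤-reflexive
    (trans (cong ∣_∣ (cong₂ _-_ (*-identityʳ z) (*-identityʳ w)))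
      (solve 1 (λ d → d := con 1ℚ :* con 1ℚ :* d) refl ∣ z - w ∣))
    where open +-*-Solver
  ^-dist {z} {w} {r} (suc n) 0≤z z≤r 0≤w w≤r = begin
    ∣ z * z ^ suc n - w * w ^ suc n ∣
      ≡⟨ cong ∣_∣ (solve 4 (λ z w a b → z :* a :- w :* b := z :* (a :- b) :+ (z :- w) :* b) refl z w (z ^ suc n) (w ^ suc n)) ⟩
    ∣ z * e + d * w ^ suc n ∣
      ≤⟨ ∣p+q∣≤∣p∣+∣q∣ (z * e) (d * w ^ suc n) ⟩
    ∣ z * e ∣ + ∣ d * w ^ suc n ∣
      ≡⟨ cong₂ _+_ (∣p*q∣≡∣p∣*∣q∣ z e) (∣p*q∣≡∣p∣*∣q∣ d (w ^ suc n)) ⟩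
    ∣ z ∣ * ∣ e ∣ + ∣ d ∣ * ∣ w ^ suc n ∣
      ≡⟨ cong₂ (λ s t → s * ∣ e ∣ + ∣ d ∣ * t) (0≤p⇒∣p∣≡p 0≤z) (0≤p⇒∣p∣≡p (^-nonNeg (suc n) 0≤w)) ⟩
    z * ∣ e ∣ + ∣ d ∣ * w ^ suc n
      ≤⟨ +-mono-≤ (mul-mono (0≤∣p∣ e) (≤-trans 0≤z z≤r) z≤r (^-dist n 0≤z z≤r 0≤w w≤r))
                  (mulˡ (0≤∣p∣ d) (^-mono (suc n) 0≤w w≤r)) ⟩
    r * (k * r ^ n * ∣ d ∣) + ∣ d ∣ * (r * r ^ n)
      ≡⟨ solve 4 (λ r k a d → r :* (k :* a :* d) :+ d :* (r :* a) := (k :+ con 1ℚ) :* (r :* a) :* d) refl r k (r ^ n) ∣ d ∣ ⟩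
    (k + 1ℚ) * r ^ suc n * ∣ d ∣
      ≡⟨ cong (λ t → t * r ^ suc n * ∣ d ∣) (sym (/1-suc (suc n))) ⟩
    (+ suc (suc n) / 1) * r ^ suc n * ∣ d ∣ ∎
    where
    open +-*-Solver
    k = + suc n / 1
    d = z - w
    e = z ^ suc n - w ^ suc n

  ∑ : ℕ → (ℕ → ℚ) → ℚ
  ∑ zero    t = 0ℚ
  ∑ (suc n) t = ∑ n t + t n

  ∑-diff : ∀ n s t → ∑ n s - ∑ n t ≡ ∑ n (λ i → s i - t i)
  ∑-diff zero    s t = refl
  ∑-diff (suc n) s t = trans
    (solve 4 (λ a b c d → (a :+ b) :- (c :+ d) := (a :- c) :+ (b :- d)) refl (∑ n s) (s n) (∑ n t) (t n))
    (cong (_+ (s n - t n)) (∑-diff n s t))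
    where open +-*-Solver

  telescope : ∀ {D r} (t : ℕ → ℚ) → (∀ i → ∣ t i ∣ ≤ D * (r ^ i - r ^ suc i)) →
              ∀ k n → ∣ ∑ (k ℕ.+ n) t - ∑ n t ∣ ≤ D * (r ^ n - r ^ (k ℕ.+ n))
  telescope {D} {r} t h zero n = ≤-reflexive (trans (cong ∣_∣ (+-inverseʳ (∑ n t)))
    (solve 2 (λ D a → con 0ℚ := D :* (a :- a)) refl D (r ^ n)))
    where open +-*-Solver
  telescope {D} {r} t h (suc k) n = begin
    ∣ ∑ (k ℕ.+ n) t + t (k ℕ.+ n) - ∑ n t ∣
      ≡⟨ cong ∣_∣ (solve 3 (λ a b c → a :+ b :- c := (a :- c) :+ b) refl (∑ (k ℕ.+ n) t) (t (k ℕ.+ n)) (∑ n t)) ⟩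
    ∣ (∑ (k ℕ.+ n) t - ∑ n t) + t (k ℕ.+ n) ∣
      ≤⟨ ∣p+q∣≤∣p∣+∣q∣ (∑ (k ℕ.+ n) t - ∑ n t) (t (k ℕ.+ n)) ⟩
    ∣ ∑ (k ℕ.+ n) t - ∑ n t ∣ + ∣ t (k ℕ.+ n) ∣
      ≤⟨ +-mono-≤ (telescope {D} {r} t h k n) (h (k ℕ.+ n)) ⟩
    D * (r ^ n - r ^ (k ℕ.+ n)) + D * (r ^ (k ℕ.+ n) - r ^ suc (k ℕ.+ n))
      ≡⟨ solve 4 (λ D a b c → D :* (a :- b) :+ D :* (b :- c) := D :* (a :- c)) refl D (r ^ n) (r ^ (k ℕ.+ n)) (r ^ suc (k ℕ.+ n)) ⟩
    D * (r ^ n - r ^ suc (k ℕ.+ n)) ∎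
    where open +-*-Solver

  -- (q - 1)/(q + 1) for q = max(p,1)
  möbius : ℚ → ℚ
  möbius p = ((p ⊔ 1ℚ) - 1ℚ) * inv ((p ⊔ 1ℚ) + 1ℚ)

  -- Partial sums of artanh z = Σ z^(2i+1)/(2i+1).
  artanhTerm : ℚ → ℕ → ℚ
  artanhTerm z i = (+ 1 / suc (i ℕ.+ i)) * z ^ suc (i ℕ.+ i)

  artanhSum : ℕ → ℚ → ℚ
  artanhSum n z = ∑ n (artanhTerm z)

  module ArtanhBounds {r C} (0≤r : 0ℚ ≤ r) (r≤1 : r ≤ 1ℚ) (0<C : 0ℚ < C)
                      (eq : C * (1ℚ - r) ≡ 1ℚ) where

    gap : ∀ D i → D * r ^ i ≡ D * C * (r ^ i - r ^ suc i)
    gap D i = trans (cong (D *_) (trans (sym (*-identityʳ (r ^ i))) (cong (r ^ i *_) (sym eq))))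
      (solve 4 (λ D C r a → D :* (a :* (C :* (con 1ℚ :- r))) := D :* C :* (a :- r :* a)) refl D C r (r ^ i))
      where open +-*-Solver

    1/≤1 : ∀ n → + 1 / suc n ≤ 1ℚ
    1/≤1 n = begin
      + 1 / suc n                       ≡⟨ *-identityˡ _ ⟨
      1ℚ * (+ 1 / suc n)                ≤⟨ mulʳ (1/-nonNeg n) 1≤ ⟩
      (+ suc n / 1) * (+ 1 / suc n)     ≡⟨ /1-inverse n ⟩
      1ℚ                                ∎
      where
      1≤ : 1ℚ ≤ + suc n / 1
      1≤ = begin
        1ℚ              ≡⟨ +-identityˡ 1ℚ ⟨
        0ℚ + 1ℚ         ≤⟨ +-monoˡ-≤ 1ℚ (nonNegative⁻¹ (+ n / 1) {{normalize-nonNeg n 1}}) ⟩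
        + n / 1 + 1ℚ    ≡⟨ /1-suc n ⟨
        + suc n / 1     ∎

    tail : ∀ {z} → 0ℚ ≤ z → z ≤ r → ∀ k n →
           ∣ artanhSum (k ℕ.+ n) z - artanhSum n z ∣ ≤ C * (r ^ n - r ^ (k ℕ.+ n))
    tail {z} 0≤z z≤r = telescope {C} {r} (artanhTerm z) λ i → begin
      ∣ artanhTerm z i ∣
        ≡⟨ 0≤p⇒∣p∣≡p (mul-nonNeg (1/-nonNeg (i ℕ.+ i)) (^-nonNeg (suc (i ℕ.+ i)) 0≤z)) ⟩
      artanhTerm z i
        ≤⟨ mul-mono (^-nonNeg (suc (i ℕ.+ i)) 0≤z) 0≤1 (1/≤1 (i ℕ.+ i)) (^-mono (suc (i ℕ.+ i)) 0≤z z≤r) ⟩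
      1ℚ * r ^ suc (i ℕ.+ i)
        ≤⟨ mulˡ 0≤1 (^-drop (suc i) i 0≤r r≤1) ⟩
      1ℚ * r ^ i
        ≡⟨ gap 1ℚ i ⟩
      1ℚ * C * (r ^ i - r ^ suc i)
        ≡⟨ cong (_* (r ^ i - r ^ suc i)) (*-identityˡ C) ⟩
      C * (r ^ i - r ^ suc i) ∎

    lipschitz : ∀ {z w} → 0ℚ ≤ z → z ≤ r → 0ℚ ≤ w → w ≤ r → ∀ n →
                ∣ artanhSum n z - artanhSum n w ∣ ≤ C * ∣ z - w ∣
    lipschitz {z} {w} 0≤z z≤r 0≤w w≤r n = begin
      ∣ artanhSum n z - artanhSum n w ∣
        ≡⟨ cong ∣_∣ (∑-diff n (artanhTerm z) (artanhTerm w)) ⟩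
      ∣ ∑ n t ∣
        ≡⟨ cong ∣_∣ (sym (+-identityʳ (∑ n t))) ⟩
      ∣ ∑ n t - 0ℚ ∣
        ≡⟨ cong (λ m → ∣ ∑ m t - 0ℚ ∣) (sym (ℕP.+-identityʳ n)) ⟩
      ∣ ∑ (n ℕ.+ 0) t - ∑ 0 t ∣
        ≤⟨ telescope {d * C} {r} t bound n 0 ⟩
      d * C * (1ℚ - r ^ (n ℕ.+ 0))
        ≤⟨ mulˡ (mul-nonNeg (0≤∣p∣ (z - w)) (<⇒≤ 0<C))
             (shift {1ℚ} {r ^ (n ℕ.+ 0)} (subst (_≤ r ^ (n ℕ.+ 0) + 1ℚ) (+-identityˡ 1ℚ)
               (+-monoˡ-≤ 1ℚ {0ℚ} {r ^ (n ℕ.+ 0)} (^-nonNeg (n ℕ.+ 0) 0≤r)))) ⟩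
      d * C * 1ℚ
        ≡⟨ trans (*-identityʳ (d * C)) (*-comm d C) ⟩
      C * d ∎
      where
      d = ∣ z - w ∣
      t : ℕ → ℚ
      t i = artanhTerm z i - artanhTerm w i
      bound : ∀ i → ∣ t i ∣ ≤ d * C * (r ^ i - r ^ suc i)
      bound i = begin
        ∣ t i ∣
          ≡⟨ cong ∣_∣ (solve 3 (λ c a b → c :* a :- c :* b := c :* (a :- b)) refl c (z ^ suc m) (w ^ suc m)) ⟩
        ∣ c * (z ^ suc m - w ^ suc m) ∣
          ≡⟨ ∣p*q∣≡∣p∣*∣q∣ c (z ^ suc m - w ^ suc m) ⟩
        ∣ c ∣ * ∣ z ^ suc m - w ^ suc m ∣
          ≡⟨ cong (_* ∣ z ^ suc m - w ^ suc m ∣) (0≤p⇒∣p∣≡p (1/-nonNeg m)) ⟩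
        c * ∣ z ^ suc m - w ^ suc m ∣
          ≤⟨ mulˡ (1/-nonNeg m) (^-dist m 0≤z z≤r 0≤w w≤r) ⟩
        c * (k * r ^ m * d)
          ≡⟨ solve 4 (λ c k a d → c :* (k :* a :* d) := k :* c :* (a :* d)) refl c k (r ^ m) d ⟩
        k * c * (r ^ m * d)
          ≡⟨ trans (cong (_* (r ^ m * d)) (/1-inverse m)) (*-identityˡ (r ^ m * d)) ⟩
        r ^ m * d
          ≤⟨ mulʳ (0≤∣p∣ (z - w)) (^-drop i i 0≤r r≤1) ⟩
        r ^ i * d
          ≡⟨ *-comm (r ^ i) d ⟩
        d * r ^ i
          ≡⟨ gap d i ⟩
        d * C * (r ^ i - r ^ suc i) ∎
        where
        open +-*-Solver
        m = i ℕ.+ i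
        c = + 1 / suc m
        k = + suc m / 1

    ^-decay : ∀ n → r ^ n * (C + + n / 1) ≤ C
    ^-decay zero = ≤-reflexive (trans (*-identityˡ (C + + 0 / 1)) (+-identityʳ C))
    ^-decay (suc n) = begin
      r * r ^ n * (C + + suc n / 1)
        ≡⟨ cong (λ t → r * r ^ n * (C + t)) (/1-suc n) ⟩
      r * r ^ n * (C + (k + 1ℚ))
        ≡⟨ solve 4 (λ r a C k → r :* a :* (C :+ (k :+ con 1ℚ)) := a :* ((C :+ r :* k) :- (C :* (con 1ℚ :- r) :- r))) refl r (r ^ n) C k ⟩
      r ^ n * (C + r * k - (C * (1ℚ - r) - r))
        ≡⟨ cong (λ t → r ^ n * (C + r * k - (t - r))) eq ⟩
      r ^ n * (C + r * k - (1ℚ - r))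
        ≤⟨ mulˡ (^-nonNeg n 0≤r) le ⟩
      r ^ n * (C + k)
        ≤⟨ ^-decay n ⟩
      C ∎
      where
      open +-*-Solver
      k = + n / 1
      le : C + r * k - (1ℚ - r) ≤ C + k
      le = shift (begin
        C + r * k
          ≤⟨ +-monoʳ-≤ C (mulʳ (nonNegative⁻¹ k {{normalize-nonNeg n 1}}) r≤1) ⟩
        C + 1ℚ * k
          ≡⟨ cong (λ t → C + t) (*-identityˡ k) ⟩
        C + k
          ≡⟨ +-identityʳ (C + k) ⟨
        C + k + 0ℚ
          ≤⟨ +-monoʳ-≤ (C + k) (subst (_≤ 1ℚ - r) (+-inverseʳ r) (+-monoˡ-≤ (- r) r≤1)) ⟩
        C + k + (1ℚ - r)
          ≡⟨ +-comm (C + k) (1ℚ - r) ⟩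
        1ℚ - r + (C + k) ∎)

    ^-vanish : ∀ ε → 0ℚ < ε → Σ ℕ λ n → r ^ n ≤ ε
    ^-vanish ε 0<ε = n , *-cancelʳ-≤-pos (C + + n / 1) {{positive 0<C+n}} (begin
      r ^ n * (C + + n / 1)    ≤⟨ ^-decay n ⟩
      C                        ≡⟨ *-identityʳ C ⟨
      C * 1ℚ                   ≡⟨ cong (C *_) (sym (*-inverseˡ ε {{nz}})) ⟩
      C * (1/ε * ε)            ≡⟨ sym (*-assoc C 1/ε ε) ⟩
      C * 1/ε * ε              ≤⟨ mulʳ (<⇒≤ 0<ε) (proj₂ (archimedean (C * 1/ε))) ⟩
      + n / 1 * ε              ≡⟨ cong (_* ε) (sym (+-identityˡ (+ n / 1))) ⟩
      (0ℚ + + n / 1) * ε       ≤⟨ mulʳ (<⇒≤ 0<ε) (+-monoˡ-≤ (+ n / 1) (<⇒≤ 0<C)) ⟩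
      (C + + n / 1) * ε        ≡⟨ *-comm (C + + n / 1) ε ⟩
      ε * (C + + n / 1)        ∎)
      where
      instance nz = pos⇒nonZero ε {{positive 0<ε}}
      1/ε = 1/ ε
      n = proj₁ (archimedean (C * 1/ε))
      0<C+n : 0ℚ < C + + n / 1
      0<C+n = +-mono-<-≤ 0<C (nonNegative⁻¹ (+ n / 1) {{normalize-nonNeg n 1}})

    ^-cauchy : ∀ ε → 0ℚ < ε → Σ ℕ λ N → ∀ m n → N ℕ.≤ m → N ℕ.≤ n →
               ∣ r ^ m - r ^ n ∣ ≤ ε
    ^-cauchy ε 0<ε = N , λ m n N≤m N≤n → dist-≤ (half m n N≤m) (half n m N≤n)
      where
      N = proj₁ (^-vanish ε 0<ε)
      half : ∀ m n → N ℕ.≤ m → r ^ m ≤ r ^ n + ε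
      half m n N≤m = begin
        r ^ m                     ≡⟨ cong (r ^_) (sym (ℕP.m∸n+n≡m N≤m)) ⟩
        r ^ (m ℕ.∸ N ℕ.+ N)       ≤⟨ ^-drop (m ℕ.∸ N) N 0≤r r≤1 ⟩
        r ^ N                     ≤⟨ proj₂ (^-vanish ε 0<ε) ⟩
        ε                         ≡⟨ +-identityˡ ε ⟨
        0ℚ + ε                    ≤⟨ +-monoˡ-≤ ε (^-nonNeg n 0≤r) ⟩
        r ^ n + ε                 ∎

open ℚLemmas using (inv; möbius; artanhSum)

Cauchy : (ℕ → ℚ) → Set
Cauchy s = ∀ ε → 0ℚ ℚ.< ε → Σ[ N ∈ ℕ ] ∀ m n → N ℕ.≤ m → N ℕ.≤ n →
           ℚ.∣ s m ℚ.- s n ∣ ℚ.≤ ε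

record ℝ : Set where
  no-eta-equality
  constructor mkℝ
  field
    seq    : ℕ → ℚ
    cauchy : Cauchy seq
open ℝ public

module CauchyLemmas where
  open import Data.Rational.Base
  open import Data.Rational.Properties
  open ≤-Reasoning
  open ℚLemmas

  dominated : ∀ (x y : ℝ) (z : ℕ → ℚ) N K → 0ℚ < K →
    (∀ m n → N ℕ.≤ m → N ℕ.≤ n →
      ∣ z m - z n ∣ ≤ K * (∣ seq x m - seq x n ∣ + ∣ seq y m - seq y n ∣)) →
    Cauchy z
  dominated x y z N K 0<K h ε 0<ε = N ℕ.⊔ (X ℕ.⊔ Y) , λ m n m≥ n≥ → begin
    ∣ z m - z n ∣
      ≤⟨ h m n (ℕP.m⊔n≤o⇒m≤o N _ m≥) (ℕP.m⊔n≤o⇒m≤o N _ n≥) ⟩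
    K * (∣ seq x m - seq x n ∣ + ∣ seq y m - seq y n ∣)
      ≤⟨ mulˡ (<⇒≤ 0<K) (+-mono-≤
           (proj₂ cx m n (ℕP.m⊔n≤o⇒m≤o X Y (ℕP.m⊔n≤o⇒n≤o N _ m≥)) (ℕP.m⊔n≤o⇒m≤o X Y (ℕP.m⊔n≤o⇒n≤o N _ n≥)))
           (proj₂ cy m n (ℕP.m⊔n≤o⇒n≤o X Y (ℕP.m⊔n≤o⇒n≤o N _ m≥)) (ℕP.m⊔n≤o⇒n≤o X Y (ℕP.m⊔n≤o⇒n≤o N _ n≥)))) ⟩
    K * (δ + δ)
      ≡⟨ solve 3 (λ K e u → K :* (u :* e :* con ½ :+ u :* e :* con ½) := (K :* u) :* e) refl K ε 1/K ⟩
    K * 1/K * ε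
      ≡⟨ trans (cong (_* ε) (*-inverseʳ K)) (*-identityˡ ε) ⟩
    ε ∎
    where
    open +-*-Solver
    instance
      pK : Positive K
      pK = positive 0<K
      nz : NonZero K
      nz = pos⇒nonZero K
      pε : Positive ε
      pε = positive 0<ε
    1/K = 1/ K
    δ = 1/K * ε * ½
    0<δ : 0ℚ < δ
    0<δ = positive⁻¹ δ {{pos*pos⇒pos (1/K * ε) {{pos*pos⇒pos 1/K {{1/pos⇒pos K}} ε}} ½}}
    cx = cauchy x δ 0<δ
    cy = cauchy y δ 0<δ
    X = proj₁ cx
    Y = proj₁ cy

  lipschitz₁ : (x : ℝ) (z : ℕ → ℚ) →
    (∀ m n → ∣ z m - z n ∣ ≤ ∣ seq x m - seq x n ∣) → Cauchy z
  lipschitz₁ x z h ε 0<ε = proj₁ c , λ m n m≥ n≥ → ≤-trans (h m n) (proj₂ c m n m≥ n≥)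
    where c = cauchy x ε 0<ε

  record Bound (x : ℝ) : Set where
    field
      from   : ℕ
      size   : ℚ
      1≤size : 1ℚ ≤ size
      bound  : ∀ n → from ℕ.≤ n → ∣ seq x n ∣ ≤ size

  bounded : ∀ x → Bound x
  bounded x = record
    { from = N ; size = 1ℚ + ∣ seq x N ∣
    ; 1≤size = subst (_≤ 1ℚ + ∣ seq x N ∣) (+-identityʳ 1ℚ) (+-monoʳ-≤ 1ℚ (0≤∣p∣ (seq x N)))
    ; bound = λ n n≥ → begin
        ∣ seq x n ∣
          ≡⟨ cong ∣_∣ (solve 2 (λ a b → a := (a :- b) :+ b) refl (seq x n) (seq x N)) ⟩
        ∣ (seq x n - seq x N) + seq x N ∣
          ≤⟨ ∣p+q∣≤∣p∣+∣q∣ (seq x n - seq x N) (seq x N) ⟩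
        ∣ seq x n - seq x N ∣ + ∣ seq x N ∣
          ≤⟨ +-monoˡ-≤ ∣ seq x N ∣ (proj₂ c n N n≥ ℕP.≤-refl) ⟩
        1ℚ + ∣ seq x N ∣ ∎
    }
    where
    open +-*-Solver
    c = cauchy x 1ℚ (positive⁻¹ 1ℚ)
    N = proj₁ c

  const-cauchy : ∀ q → Cauchy (λ _ → q)
  const-cauchy q ε 0<ε = 0 , λ _ _ _ _ →
    subst (_≤ ε) (sym (cong ∣_∣ (+-inverseʳ q))) (<⇒≤ 0<ε)

  +-cauchy : ∀ x y → Cauchy (λ n → seq x n + seq y n)
  +-cauchy x y = dominated x y (λ n → seq x n + seq y n) 0 1ℚ (positive⁻¹ 1ℚ) λ m n _ _ → begin
    ∣ seq x m + seq y m - (seq x n + seq y n) ∣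
      ≡⟨ cong ∣_∣ (solve 4 (λ a b c d → a :+ b :- (c :+ d) := (a :- c) :+ (b :- d)) refl (seq x m) (seq y m) (seq x n) (seq y n)) ⟩
    ∣ (seq x m - seq x n) + (seq y m - seq y n) ∣
      ≤⟨ ∣p+q∣≤∣p∣+∣q∣ (seq x m - seq x n) (seq y m - seq y n) ⟩
    ∣ seq x m - seq x n ∣ + ∣ seq y m - seq y n ∣
      ≡⟨ *-identityˡ _ ⟨
    1ℚ * (∣ seq x m - seq x n ∣ + ∣ seq y m - seq y n ∣) ∎
    where open +-*-Solver

  neg-cauchy : ∀ x → Cauchy (λ n → - seq x n)
  neg-cauchy x = lipschitz₁ x (λ n → - seq x n) λ m n → ≤-reflexive (trans
    (cong ∣_∣ (solve 2 (λ a b → :- a :- :- b := :- (a :- b)) refl (seq x m) (seq x n)))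
    (∣-p∣≡∣p∣ (seq x m - seq x n)))
    where open +-*-Solver

  *-cauchy : ∀ x y → Cauchy (λ n → seq x n * seq y n)
  *-cauchy x y = dominated x y (λ n → seq x n * seq y n) (Bx.from ℕ.⊔ By.from) (Bx.size + By.size) 0<K
    λ m n m≥ n≥ → let a = seq x m; b = seq y m; c = seq x n; d = seq y n in begin
    ∣ a * b - c * d ∣
      ≡⟨ cong ∣_∣ (solve 4 (λ a b c d → a :* b :- c :* d := a :* (b :- d) :+ d :* (a :- c)) refl a b c d) ⟩
    ∣ a * (b - d) + d * (a - c) ∣
      ≤⟨ ∣p+q∣≤∣p∣+∣q∣ (a * (b - d)) (d * (a - c)) ⟩
    ∣ a * (b - d) ∣ + ∣ d * (a - c) ∣
      ≡⟨ cong₂ _+_ (∣p*q∣≡∣p∣*∣q∣ a (b - d)) (∣p*q∣≡∣p∣*∣q∣ d (a - c)) ⟩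
    ∣ a ∣ * ∣ b - d ∣ + ∣ d ∣ * ∣ a - c ∣
      ≤⟨ +-mono-≤
           (mulʳ (0≤∣p∣ (b - d)) (≤-trans (Bx.bound m (ℕP.m⊔n≤o⇒m≤o Bx.from _ m≥)) x≤K))
           (mulʳ (0≤∣p∣ (a - c)) (≤-trans (By.bound n (ℕP.m⊔n≤o⇒n≤o Bx.from _ n≥)) y≤K)) ⟩
    K * ∣ b - d ∣ + K * ∣ a - c ∣
      ≡⟨ solve 3 (λ K s t → K :* s :+ K :* t := K :* (t :+ s)) refl K ∣ b - d ∣ ∣ a - c ∣ ⟩
    K * (∣ a - c ∣ + ∣ b - d ∣) ∎
    where
    open +-*-Solver
    module Bx = Bound (bounded x)
    module By = Bound (bounded y)
    K = Bx.size + By.size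
    0≤x = ≤-trans 0≤1 Bx.1≤size
    0≤y = ≤-trans 0≤1 By.1≤size
    0<K : 0ℚ < K
    0<K = +-mono-<-≤ (<-≤-trans (positive⁻¹ 1ℚ) Bx.1≤size) 0≤y
    x≤K : Bx.size ≤ K
    x≤K = subst (_≤ K) (+-identityʳ Bx.size) (+-monoʳ-≤ Bx.size 0≤y)
    y≤K : By.size ≤ K
    y≤K = subst (_≤ K) (+-identityˡ By.size) (+-monoˡ-≤ By.size 0≤x)

module LogCauchy (x : ℝ) where
  open import Data.Rational.Base
  open import Data.Rational.Properties
  open ≤-Reasoning
  open ℚLemmas
  open CauchyLemmas
  open Bound (bounded x)

  C = (size + 1ℚ) * ½

  1≤C : 1ℚ ≤ C
  1≤C = mulʳ (nonNegative⁻¹ ½) (+-monoˡ-≤ 1ℚ 1≤size)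

  C*inv : C * inv C ≡ 1ℚ
  C*inv = trans (cong (_* inv C) (sym (p≥q⇒p⊔q≡p 1≤C))) (inv-inverse C)

  r = 1ℚ - inv C

  0≤r : 0ℚ ≤ r
  0≤r = subst (_≤ r) (+-inverseʳ (inv C)) (+-monoˡ-≤ (- inv C) (inv-≤1 C))

  r≤1 : r ≤ 1ℚ
  r≤1 = subst (r ≤_) (+-identityʳ 1ℚ) (+-monoʳ-≤ 1ℚ (neg-antimono-≤ (inv-nonNeg C)))

  0<C : 0ℚ < C
  0<C = <-≤-trans (positive⁻¹ 1ℚ) 1≤C

  C-eq : C * (1ℚ - r) ≡ 1ℚ
  C-eq = trans (solve 2 (λ C i → C :* (con 1ℚ :- (con 1ℚ :- i)) := C :* i) refl C (inv C)) C*inv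
    where open +-*-Solver

  open ArtanhBounds 0≤r r≤1 0<C C-eq

  z : ℕ → ℚ
  z n = möbius (seq x n)

  max1-cauchy : Cauchy (λ n → seq x n ⊔ 1ℚ)
  max1-cauchy = lipschitz₁ x (λ n → seq x n ⊔ 1ℚ) (λ m n → ⊔1-dist (seq x m) (seq x n))

  z-cauchy : Cauchy z
  z-cauchy = *-cauchy (plus (- 1ℚ)) (mkℝ (λ n → inv (seq (plus 1ℚ) n))
    (lipschitz₁ (plus 1ℚ) (λ n → inv (seq (plus 1ℚ) n)) (λ m n → inv-dist (seq (plus 1ℚ) m) (seq (plus 1ℚ) n))))
    where
    max1 = mkℝ (λ n → seq x n ⊔ 1ℚ) max1-cauchy
    plus : ℚ → ℝ
    plus c = mkℝ (λ n → (seq x n ⊔ 1ℚ) + c) (+-cauchy max1 (mkℝ (λ _ → c) (const-cauchy c)))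

  0≤z : ∀ n → 0ℚ ≤ z n
  0≤z n = mul-nonNeg
    (subst (_≤ (seq x n ⊔ 1ℚ) - 1ℚ) (+-inverseʳ 1ℚ) (+-monoˡ-≤ (- 1ℚ) (p≤q⊔p (seq x n) 1ℚ)))
    (inv-nonNeg ((seq x n ⊔ 1ℚ) + 1ℚ))

  z≤r : ∀ n → from ℕ.≤ n → z n ≤ r
  z≤r n n≥ = *-cancelʳ-≤-pos s {{positive 0<s}} (begin
    (q - 1ℚ) * inv s * s
      ≡⟨ trans (solve 3 (λ a i s → a :* i :* s := a :* (s :* i)) refl (q - 1ℚ) (inv s) s)
               (trans (cong ((q - 1ℚ) *_) s*inv) (*-identityʳ (q - 1ℚ))) ⟩
    q - 1ℚ
      ≡⟨ solve 1 (λ q → q :- con 1ℚ := (q :+ con 1ℚ) :- (con 1ℚ :+ con 1ℚ) :* con 1ℚ) refl q ⟩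
    s - (1ℚ + 1ℚ) * 1ℚ
      ≡⟨ cong (λ t → s - (1ℚ + 1ℚ) * t) (sym C*inv) ⟩
    s - (1ℚ + 1ℚ) * ((size + 1ℚ) * ½ * inv C)
      ≡⟨ solve 3 (λ s B i → s :- (con 1ℚ :+ con 1ℚ) :* ((B :+ con 1ℚ) :* con ½ :* i) := s :- (B :+ con 1ℚ) :* i) refl s size (inv C) ⟩
    s - (size + 1ℚ) * inv C
      ≤⟨ +-monoʳ-≤ s (neg-antimono-≤ (mulʳ (inv-nonNeg C) (+-monoˡ-≤ 1ℚ q≤B))) ⟩
    s - s * inv C
      ≡⟨ solve 2 (λ s i → s :- s :* i := (con 1ℚ :- i) :* s) refl s (inv C) ⟩
    r * s ∎)
    where
    open +-*-Solver
    q = seq x n ⊔ 1ℚ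
    s = q + 1ℚ
    1≤q : 1ℚ ≤ q
    1≤q = p≤q⊔p (seq x n) 1ℚ
    1≤s : 1ℚ ≤ s
    1≤s = ≤-trans 1≤q (subst (_≤ s) (+-identityʳ q) (+-monoʳ-≤ q 0≤1))
    0<s : 0ℚ < s
    0<s = <-≤-trans (positive⁻¹ 1ℚ) 1≤s
    s*inv : s * inv s ≡ 1ℚ
    s*inv = trans (cong (_* inv s) (sym (p≥q⇒p⊔q≡p 1≤s))) (inv-inverse s)
    q≤B : q ≤ size
    q≤B = ⊔-lub (≤-trans (p≤∣p∣ (seq x n)) (bound n n≥)) 1≤size

  tail′ : ∀ {y} → 0ℚ ≤ y → y ≤ r → ∀ m n → n ℕ.≤ m →
          ∣ artanhSum m y - artanhSum n y ∣ ≤ C * ∣ r ^ m - r ^ n ∣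
  tail′ {y} 0≤y y≤r m n n≤m = begin
    ∣ artanhSum m y - artanhSum n y ∣
      ≡⟨ cong (λ k → ∣ artanhSum k y - artanhSum n y ∣) (sym e) ⟩
    ∣ artanhSum (m ℕ.∸ n ℕ.+ n) y - artanhSum n y ∣
      ≤⟨ tail 0≤y y≤r (m ℕ.∸ n) n ⟩
    C * (r ^ n - r ^ (m ℕ.∸ n ℕ.+ n))
      ≡⟨ cong (λ k → C * (r ^ n - r ^ k)) e ⟩
    C * (r ^ n - r ^ m)
      ≤⟨ mulˡ (<⇒≤ 0<C) (p≤∣p∣ (r ^ n - r ^ m)) ⟩
    C * ∣ r ^ n - r ^ m ∣
      ≡⟨ cong (C *_) (abs-swap (r ^ n) (r ^ m)) ⟩
    C * ∣ r ^ m - r ^ n ∣ ∎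
    where e = ℕP.m∸n+n≡m n≤m

  tail″ : ∀ {y} → 0ℚ ≤ y → y ≤ r → ∀ m n →
          ∣ artanhSum m y - artanhSum n y ∣ ≤ C * ∣ r ^ m - r ^ n ∣
  tail″ {y} 0≤y y≤r m n with ℕP.≤-total n m
  ... | inj₁ n≤m = tail′ 0≤y y≤r m n n≤m
  ... | inj₂ m≤n = subst₂ _≤_ (abs-swap (artanhSum n y) (artanhSum m y))
                     (cong (C *_) (abs-swap (r ^ n) (r ^ m))) (tail′ 0≤y y≤r n m m≤n)

  artanh-cauchy : Cauchy (λ n → artanhSum n (z n))
  artanh-cauchy = dominated (mkℝ z z-cauchy) (mkℝ (r ^_) ^-cauchy) (λ n → artanhSum n (z n)) from C 0<C λ m n m≥ n≥ → begin
    ∣ artanhSum m (z m) - artanhSum n (z n) ∣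
      ≤⟨ triangle (artanhSum m (z m)) (artanhSum n (z m)) (artanhSum n (z n)) ⟩
    ∣ artanhSum m (z m) - artanhSum n (z m) ∣ + ∣ artanhSum n (z m) - artanhSum n (z n) ∣
      ≤⟨ +-mono-≤ (tail″ (0≤z m) (z≤r m m≥) m n) (lipschitz (0≤z m) (z≤r m m≥) (0≤z n) (z≤r n n≥) n) ⟩
    C * ∣ r ^ m - r ^ n ∣ + C * ∣ z m - z n ∣
      ≡⟨ solve 3 (λ C a b → C :* a :+ C :* b := C :* (b :+ a)) refl C ∣ r ^ m - r ^ n ∣ ∣ z m - z n ∣ ⟩
    C * (∣ z m - z n ∣ + ∣ r ^ m - r ^ n ∣) ∎
    where open +-*-Solver

infix  4 _≈_ _≤_ _<_
infixl 6 _+_ _-_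
infixl 7 _*_
infix  8 -_
infixr 8 _^_

record _≈_ (x y : ℝ) : Set where
  constructor mk≈
  field
    approx : ∀ ε → 0ℚ ℚ.< ε → Σ[ N ∈ ℕ ] ∀ n → N ℕ.≤ n →
             ℚ.∣ seq x n ℚ.- seq y n ∣ ℚ.≤ ε

record _≤_ (x y : ℝ) : Set where
  constructor mk≤
  field
    below : ∀ ε → 0ℚ ℚ.< ε → Σ[ N ∈ ℕ ] ∀ n → N ℕ.≤ n →
            seq x n ℚ.≤ seq y n ℚ.+ ε

record _<_ (x y : ℝ) : Set where
  constructor mk<
  field
    gap      : ℚ
    0<gap    : 0ℚ ℚ.< gap
    from     : ℕ
    separate : ∀ n → from ℕ.≤ n → seq x n ℚ.+ gap ℚ.≤ seq y n

fromℚ : ℚ → ℝ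
seq    (fromℚ q) _ = q
cauchy (fromℚ q)   = CauchyLemmas.const-cauchy q

fromℤ : ℤ → ℝ
fromℤ i = fromℚ (i ℚ./ 1)

0ℝ 1ℝ : ℝ
0ℝ = fromℚ 0ℚ
1ℝ = fromℚ 1ℚ

_+_ : ℝ → ℝ → ℝ
seq    (x + y) n = seq x n ℚ.+ seq y n
cauchy (x + y)   = CauchyLemmas.+-cauchy x y

-_ : ℝ → ℝ
seq    (- x) n = ℚ.- seq x n
cauchy (- x)   = CauchyLemmas.neg-cauchy x

_-_ : ℝ → ℝ → ℝ
x - y = x + (- y)

_*_ : ℝ → ℝ → ℝ
seq    (x * y) n = seq x n ℚ.* seq y n
cauchy (x * y)   = CauchyLemmas.*-cauchy x y

∣_∣ : ℝ → ℝ
seq    ∣ x ∣ n = ℚ.∣ seq x n ∣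
cauchy ∣ x ∣   = CauchyLemmas.lipschitz₁ x (λ n → ℚ.∣ seq x n ∣)
  (λ m n → ℚLemmas.∣∣-dist (seq x m) (seq x n))

_^_ : ℝ → ℕ → ℝ
x ^ zero  = 1ℝ
x ^ suc n = x * x ^ n

-- ∑ n f = f 0 + ⋯ + f (n - 1)
∑ : ℕ → (ℕ → ℝ) → ℝ
∑ zero    f = 0ℝ
∑ (suc n) f = ∑ n f + f n

-- The reciprocal and the logarithm are only needed on [1,∞).  Replacing the
-- approximations of x by their maximum with 1 gives an equal real when 1 ≤ x,
-- and keeps every term of the sequences well defined.
recip : (x : ℝ) → .(1ℝ ≤ x) → ℝ
seq    (recip x _) n = inv (seq x n)
cauchy (recip x _)   = CauchyLemmas.lipschitz₁ x (λ n → inv (seq x n))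
  (λ m n → ℚLemmas.inv-dist (seq x m) (seq x n))

-- log x = 2 artanh ((x - 1)/(x + 1)), with artanh z = Σ z^(2i+1)/(2i+1):
-- the n-th approximation applies the n-th partial sum to the n-th
-- approximation of (x - 1)/(x + 1).
log : (x : ℝ) → .(1ℝ ≤ x) → ℝ
log x _ = fromℤ (+ 2) * artanh
  where
  artanh : ℝ
  seq    artanh n = artanhSum n (möbius (seq x n))
  cauchy artanh   = LogCauchy.artanh-cauchy x

1≤suc : ∀ i → 1ℝ ≤ fromℤ (+ suc i)
1≤suc i = mk≤ λ ε 0<ε → 0 , λ _ _ → begin
  1ℚ                        ≡⟨ +-identityˡ 1ℚ ⟨
  0ℚ ℚ.+ 1ℚ                 ≤⟨ +-monoˡ-≤ 1ℚ (nonNegative⁻¹ (+ i ℚ./ 1) {{normalize-nonNeg i 1}}) ⟩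
  + i ℚ./ 1 ℚ.+ 1ℚ          ≡⟨ ℚLemmas./1-suc i ⟨
  + suc i ℚ./ 1             ≡⟨ +-identityʳ (+ suc i ℚ./ 1) ⟨
  + suc i ℚ./ 1 ℚ.+ 0ℚ      ≤⟨ +-monoʳ-≤ (+ suc i ℚ./ 1) (<⇒≤ 0<ε) ⟩
  + suc i ℚ./ 1 ℚ.+ ε       ∎
  where
  open ℚP
  open ℚP.≤-Reasoning

-- log (i + 1)
logSuc : ℕ → ℝ
logSuc i = log (fromℤ (+ suc i)) (1≤suc i)

_⟶_ : (ℕ → ℝ) → ℝ → Set
s ⟶ x = ∀ ε → 0ℚ ℚ.< ε → Σ[ M ∈ ℕ ] ∀ N → M ℕ.≤ N → ∣ s N - x ∣ ≤ fromℚ ε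

-- The floor function is not computable on all of ℝ, so functions involving it
-- are partial functions whose domain records the integer part.  Classically
-- every real has one.
record Floor (x : ℝ) : Set where
  field
    ⌊_⌋   : ℤ
    lower : fromℤ ⌊_⌋ ≤ x
    upper : x < fromℤ (⌊_⌋ ℤ.+ + 1)
open Floor public using (⌊_⌋)

frac : (x : ℝ) → Floor x → ℝ
frac x f = x - fromℤ ⌊ f ⌋

record PartialFn : Set₁ where
  field
    Dom   : ℝ → Set
    apply : (x : ℝ) → Dom x → ℝ
open PartialFn public

-- Partitions of [a,b] of mesh at most δ, tagged by points of the domain of f.
-- A step from a adds the subinterval [a,c] with tag t.
data TaggedPartition (f : PartialFn) (δ : ℚ) (b : ℝ) : ℝ → Set where
  done : ∀ {a} → a ≈ b → TaggedPartition f δ b a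
  step : ∀ {a} (t c : ℝ) → a ≤ t → t ≤ c → c - a ≤ fromℚ δ → Dom f t →
         TaggedPartition f δ b c → TaggedPartition f δ b a

riemannSum : ∀ {f δ b a} → TaggedPartition f δ b a → ℝ
riemannSum (done _) = 0ℝ
riemannSum {f} {a = a} (step t c _ _ _ t∈f P) = apply f t t∈f * (c - a) + riemannSum P

-- Riemann integral over [a,b], for a ≤ b.
HasIntegral : PartialFn → ℝ → ℝ → ℝ → Set
HasIntegral f a b I = ∀ ε → 0ℚ ℚ.< ε → Σ[ δ ∈ ℚ ] 0ℚ ℚ.< δ ×
  ((P : TaggedPartition f δ b a) → ∣ riemannSum P - I ∣ ≤ fromℚ ε)

-- I is the limit of the integrals over [a,b] as b → ∞.
record HasImproperIntegral (f : PartialFn) (a I : ℝ) : Set where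
  field
    upTo      : (b : ℝ) → a ≤ b → ℝ
    integrals : ∀ b (a≤b : a ≤ b) → HasIntegral f a b (upTo b a≤b)
    limit     : ∀ ε → 0ℚ ℚ.< ε → Σ[ B ∈ ℝ ] ∀ b (a≤b : a ≤ b) → B ≤ b →
                ∣ upTo b a≤b - I ∣ ≤ fromℚ ε

-- Depends only on the parity of i, so negative exponents are covered.
-1^_ : ℤ → ℤ
-1^ i = ℤ.-1ℤ ℤ.^ ℤ.∣ i ∣

_/!_ : ℤ → ℕ → ℚ
i /! k = (i ℚ./ (k !)) {{k ℕP.!≢0}}

laguerre : ℕ → ℝ → ℝ
laguerre n u = ∑ (suc n) λ k →
  fromℚ ((+ (n Comb.C k) ℤ.* -1^ (+ k)) /! k) * u ^ k

-- The N-th term is taken at N + 1, so that log is defined.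
stieltjesTerm : ℕ → ℕ → ℝ
stieltjesTerm n N =
  ∑ (suc N) (λ i → logSuc i ^ n * fromℚ (+ 1 ℚ./ suc i))
  - logSuc N ^ suc n * fromℚ (+ 1 ℚ./ suc n)

AreStieltjesConstants : (ℕ → ℝ) → Set
AreStieltjesConstants γ = ∀ n → stieltjesTerm n ⟶ γ n

-- For positive index n = suc m the summation variable is k = suc j.
ℓ : (γ : ℕ → ℝ) → ℕ → ℝ
ℓ γ zero    = γ 0 - 1ℝ
ℓ γ (suc m) = ∑ (suc m) λ j →
  fromℚ ((+ (m Comb.C j) ℤ.* -1^ (+ suc m ℤ.- + suc j)) /! suc j) * γ (suc j)

-- x ↦ {x} / x² · L_n (log x) on [1,∞)
integrand : ℕ → PartialFn
Dom   (integrand n) x = 1ℝ ≤ x × Floor x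
apply (integrand n) x (1≤x , f) =
  frac x f * recip x 1≤x ^ 2 * laguerre n (log x 1≤x)

{-# OPTIONS --safe #-}
-- Let f_k(x) = log^k x / x. On [1,∞) the function {x} f_k′(x) has the primitive
-- U_k(x) - Σ_j (f_k(max(x,j)) - f_k(j)), where U_k = log^k - log^(k+1)/(k+1) satisfies U_k′ = x f_k′
-- and ⌊x⌋ counts the j ≤ x. At integers it is the k-th Stieltjes sum minus U_k(1), and between
-- integers it moves by at most 2 log^k(x)/x → 0, so ∫ {x} f_k′ = γ_k - U_k(1). Pascal's rule makes
-- L_(m+1)(log x)/x², up to the sign (-1)^m, the combination of the f_(j+1)′, j ≤ m, whose coefficients
-- define ℓ_(m+1). Apart from log 1 = 0, the only fact used about the series defining the logarithm is the
-- tangent inequality log y - log x ≤ (y - x)/x. Case distinctions between reals are confined to proofs of ≤, which is ¬¬-stable.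
module Submission where

import Defs
open Defs using (module ℚLemmas)
open import Data.Nat.Base as ℕ using (ℕ; zero; suc; _!)
import Data.Nat.Properties as ℕP
open import Data.Integer.Base as ℤ using (ℤ; +_) renaming (_-_ to _-ℤ_)
import Data.Integer.Properties as ℤP
open import Data.Rational.Base as ℚ using (ℚ; 0ℚ; 1ℚ; ½)
import Data.Rational.Properties as ℚP
import Data.Rational.Unnormalised.Base as ℚᵘ
import Data.Rational.Unnormalised.Properties as ℚᵘP
import Data.Rational.Solver as ℚSolver
open import Data.Product.Base using (Σ-syntax; _×_; _,_; proj₁; proj₂)
open import Data.Sum.Base using (_⊎_; inj₁; inj₂; [_,_]′)
open import Data.Maybe.Base using (Maybe; just; nothing)
open import Data.Empty using (⊥; ⊥-elim)
open import Relation.Nullary using (¬_; Dec; yes; no)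
open import Relation.Binary.PropositionalEquality using (_≡_; refl; sym; trans; cong; cong₂; subst; subst₂)
open import Relation.Binary.Bundles using (Poset)
open import Algebra.Bundles using (CommutativeRing)
import Algebra.Solver.Ring
import Algebra.Solver.Ring.AlmostCommutativeRing as ACR
import Relation.Binary.Reasoning.PartialOrder

-- Integer parts are not computable, but every tag of a partition carries one, so whether j + 1 ≤
-- ⌊t⌋ is decided between integers. Summing these indicators over j gives ⌊t⌋ and reduces {t} g(t)
-- to one smooth function and finitely many functions with a single jump p. The integral of such a
-- jump function over [1,b] is the increment of G from max(1,p) to max(b,p); the maximum spares the
-- question whether b has passed p. Differentiability is uniform: the deviation from the tangent is
-- at most a constant times the squared distance. For the logarithm this needs the tangent
-- inequality only, applied at x and at y, because 1/x - 1/y is itself at most |y - x| on [1,∞). The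
-- tangent inequality comes from the partial sums. With z = (a - 1)/(a + 1), the n-th partial sum of
-- artanh has the derivative (1 - z^(2n))/(1 - z²), while 2 dz/(1 - z²) = da/a. So each
-- approximation of the logarithm satisfies the inequality up to z^(2n), and this error vanishes
-- because the approximations of one real eventually keep z below a fixed r < 1.

module ℚS = ℚSolver.+-*-Solver

-- Rational estimates and the tangent inequality for partial sums of the logarithm series.

0≤d⇒≤ : ∀ {p q d} → 0ℚ ℚ.≤ d → p ℚ.+ d ≡ q → p ℚ.≤ q
0≤d⇒≤ {p} {q} {d} 0≤d e = begin
  p             ≡⟨ ℚP.+-identityʳ p ⟨
  p ℚ.+ 0ℚ      ≤⟨ ℚP.+-monoʳ-≤ p 0≤d ⟩
  p ℚ.+ d       ≡⟨ e ⟩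
  q             ∎
  where open ℚP.≤-Reasoning

0≤q-p : ∀ {p q} → p ℚ.≤ q → 0ℚ ℚ.≤ q ℚ.- p
0≤q-p {p} {q} p≤q = subst (ℚ._≤ q ℚ.- p) (ℚP.+-inverseʳ p) (ℚP.+-monoˡ-≤ (ℚ.- p) p≤q)

half-pos : ∀ {ε} → 0ℚ ℚ.< ε → 0ℚ ℚ.< ε ℚ.* ½
half-pos {ε} 0<ε = ℚP.positive⁻¹ (ε ℚ.* ½) {{ℚP.pos*pos⇒pos ε {{ℚ.positive 0<ε}} ½}}

*-pos : ∀ {p q} → 0ℚ ℚ.< p → 0ℚ ℚ.< q → 0ℚ ℚ.< p ℚ.* q
*-pos {p} {q} 0<p 0<q =
  ℚP.positive⁻¹ (p ℚ.* q) {{ℚP.pos*pos⇒pos p {{ℚ.positive 0<p}} q {{ℚ.positive 0<q}}}}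

square-nonNegℚ : ∀ p → 0ℚ ℚ.≤ p ℚ.* p
square-nonNegℚ p with ℚP.≤-total 0ℚ p
... | inj₁ 0≤p = ℚLemmas.mul-nonNeg 0≤p 0≤p
... | inj₂ p≤0 = subst (0ℚ ℚ.≤_) (ℚS.solve 1 (λ p → ℚS.:- p ℚS.:* ℚS.:- p ℚS.:= p ℚS.:* p) refl p)
  (ℚLemmas.mul-nonNeg (ℚP.neg-antimono-≤ p≤0) (ℚP.neg-antimono-≤ p≤0))

inv-pos : ∀ p → 0ℚ ℚ.< ℚLemmas.inv p
inv-pos p = ℚP.positive⁻¹ (ℚLemmas.inv p) {{ℚP.1/pos⇒pos (p ℚ.⊔ 1ℚ) {{ℚLemmas.⊔1-pos p}}}}

*inv≤1 : ∀ p → p ℚ.* ℚLemmas.inv p ℚ.≤ 1ℚ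
*inv≤1 p = ℚP.≤-trans (ℚLemmas.mulʳ (ℚLemmas.inv-nonNeg p) (ℚP.p≤p⊔q p 1ℚ))
                      (ℚP.≤-reflexive (ℚLemmas.inv-inverse p))

-- Since `inv c` is 1/max(c,1), the product of c and `inv c` is at most 1 for c of any sign. This
-- turns every error bound that is linear in the mesh into a choice of mesh.
scale : ∀ c ε → 0ℚ ℚ.< ε → Σ[ δ ∈ ℚ ] 0ℚ ℚ.< δ × c ℚ.* δ ℚ.≤ ε
scale c ε 0<ε = ℚLemmas.inv c ℚ.* ε , *-pos (inv-pos c) 0<ε , (begin
  c ℚ.* (ℚLemmas.inv c ℚ.* ε)   ≡⟨ ℚP.*-assoc c _ ε ⟨
  c ℚ.* ℚLemmas.inv c ℚ.* ε     ≤⟨ ℚLemmas.mulʳ (ℚP.<⇒≤ 0<ε) (*inv≤1 c) ⟩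
  1ℚ ℚ.* ε                      ≡⟨ ℚP.*-identityˡ ε ⟩
  ε                             ∎)
  where open ℚP.≤-Reasoning

-- With j = 1/(a + 1): since z = 1 - 2j, both 1 - z² and differences of z are read off from j.
module Möbius where
  open import Data.Rational.Base
  open import Data.Rational.Properties
  open ℚLemmas hiding (archimedean)
  open ≤-Reasoning
  open ℚS using () renaming (solve to solveℚ; _:=_ to _:=ℚ_; _:+_ to _:+ℚ_; _:*_ to _:*ℚ_; _:-_ to _:-ℚ_; con to conℚ)

  2ℚ 4ℚ : ℚ
  2ℚ = + 2 / 1
  4ℚ = + 4 / 1

  -- The derivative of `artanhSum n` at z: the denominators 2i + 1 cancel against the exponents.
  evenPowers : ℕ → ℚ → ℚ
  evenPowers n z = ℚLemmas.∑ n (λ i → z ^ (i ℕ.+ i))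

  evenPowers-geometric : ∀ n z → evenPowers n z * (1ℚ - z * z) ≡ 1ℚ - z ^ (n ℕ.+ n)
  evenPowers-geometric zero z = solveℚ 1 (λ z → conℚ 0ℚ :*ℚ (conℚ 1ℚ :-ℚ z :*ℚ z) :=ℚ conℚ 1ℚ :-ℚ conℚ 1ℚ) refl z
  evenPowers-geometric (suc n) z = begin-equality
    (evenPowers n z + u) * (1ℚ - z * z)
      ≡⟨ *-distribʳ-+ (1ℚ - z * z) (evenPowers n z) u ⟩
    evenPowers n z * (1ℚ - z * z) + u * (1ℚ - z * z)
      ≡⟨ cong (_+ u * (1ℚ - z * z)) (evenPowers-geometric n z) ⟩
    1ℚ - u + u * (1ℚ - z * z)
      ≡⟨ solveℚ 2 (λ z u → conℚ 1ℚ :-ℚ u :+ℚ u :*ℚ (conℚ 1ℚ :-ℚ z :*ℚ z) :=ℚ conℚ 1ℚ :-ℚ z :*ℚ (z :*ℚ u)) refl z u ⟩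
    1ℚ - z * (z * u)
      ≡⟨ cong (λ k → 1ℚ - z * z ^ k) (sym (ℕP.+-suc n n)) ⟩
    1ℚ - z ^ (suc n ℕ.+ suc n) ∎
    where u = z ^ (n ℕ.+ n)

  ∑-mono : ∀ n {s t} → (∀ i → s i ≤ t i) → ℚLemmas.∑ n s ≤ ℚLemmas.∑ n t
  ∑-mono zero    h = ≤-refl
  ∑-mono (suc n) h = +-mono-≤ (∑-mono n h) (h n)

  ∑-distribˡ : ∀ n c t → ℚLemmas.∑ n (λ i → c * t i) ≡ c * ℚLemmas.∑ n t
  ∑-distribˡ zero    c t = sym (*-zeroʳ c)
  ∑-distribˡ (suc n) c t = trans (cong (_+ c * t n) (∑-distribˡ n c t)) (sym (*-distribˡ-+ c _ (t n)))

  -- A mean value bound with the derivative at the larger point; its companion `^-diff-≥` takes it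
  -- at the smaller one. Together they express the convexity of powers on nonnegative arguments.
  ^-diff-≤ : ∀ {z w} m → 0ℚ ≤ z → z ≤ w → w ^ suc m - z ^ suc m ≤ (+ suc m / 1) * (w ^ m * (w - z))
  ^-diff-≤ {z} {w} m 0≤z z≤w = begin
    w ^ suc m - z ^ suc m                     ≤⟨ p≤∣p∣ _ ⟩
    ∣ w ^ suc m - z ^ suc m ∣                 ≤⟨ ^-dist m (≤-trans 0≤z z≤w) ≤-refl 0≤z z≤w ⟩
    (+ suc m / 1) * w ^ m * ∣ w - z ∣         ≡⟨ cong ((+ suc m / 1) * w ^ m *_) (0≤p⇒∣p∣≡p (0≤q-p z≤w)) ⟩
    (+ suc m / 1) * w ^ m * (w - z)           ≡⟨ *-assoc (+ suc m / 1) (w ^ m) (w - z) ⟩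
    (+ suc m / 1) * (w ^ m * (w - z))         ∎

  ^-diff-≥ : ∀ {z w} m → 0ℚ ≤ z → z ≤ w → (+ suc m / 1) * (z ^ m * (w - z)) ≤ w ^ suc m - z ^ suc m
  ^-diff-≥ {z} {w} zero 0≤z z≤w = ≤-reflexive
    (solveℚ 2 (λ z w → conℚ 1ℚ :*ℚ (conℚ 1ℚ :*ℚ (w :-ℚ z)) :=ℚ w :*ℚ conℚ 1ℚ :-ℚ z :*ℚ conℚ 1ℚ) refl z w)
  ^-diff-≥ {z} {w} (suc m) 0≤z z≤w = begin
    (+ suc (suc m) / 1) * (z * z ^ m * (w - z))
      ≡⟨ cong (_* (z * z ^ m * (w - z))) (/1-suc (suc m)) ⟩
    (k + 1ℚ) * (z * z ^ m * (w - z))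
      ≡⟨ solveℚ 4 (λ k z u w → (k :+ℚ conℚ 1ℚ) :*ℚ (z :*ℚ u :*ℚ (w :-ℚ z)) :=ℚ z :*ℚ (k :*ℚ (u :*ℚ (w :-ℚ z))) :+ℚ (w :-ℚ z) :*ℚ (z :*ℚ u)) refl k z (z ^ m) w ⟩
    z * (k * (z ^ m * (w - z))) + (w - z) * z ^ suc m
      ≤⟨ +-monoˡ-≤ _ (mul-mono 0≤kzd (≤-trans 0≤z z≤w) z≤w (^-diff-≥ m 0≤z z≤w)) ⟩
    w * (w ^ suc m - z ^ suc m) + (w - z) * z ^ suc m
      ≡⟨ solveℚ 4 (λ w z u v → w :*ℚ (u :-ℚ v) :+ℚ (w :-ℚ z) :*ℚ v :=ℚ w :*ℚ u :-ℚ z :*ℚ v) refl w z (w ^ suc m) (z ^ suc m) ⟩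
    w * w ^ suc m - z * z ^ suc m ∎
    where
    k = + suc m / 1
    0≤kzd : 0ℚ ≤ k * (z ^ m * (w - z))
    0≤kzd = mul-nonNeg (nonNegative⁻¹ k {{normalize-nonNeg (suc m) 1}})
      (mul-nonNeg (^-nonNeg m 0≤z) (0≤q-p z≤w))

  1/suc*suc* : ∀ m d → (+ 1 / suc m) * ((+ suc m / 1) * d) ≡ d
  1/suc*suc* m d = trans (sym (*-assoc (+ 1 / suc m) (+ suc m / 1) d))
    (trans (cong (_* d) (trans (*-comm (+ 1 / suc m) (+ suc m / 1)) (/1-inverse m))) (*-identityˡ d))

  artanhTerm-diff : ∀ z w i → artanhTerm w i - artanhTerm z i ≡ (+ 1 / suc (i ℕ.+ i)) * (w ^ suc (i ℕ.+ i) - z ^ suc (i ℕ.+ i))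
  artanhTerm-diff z w i = solveℚ 3 (λ c a b → c :*ℚ a :-ℚ c :*ℚ b :=ℚ c :*ℚ (a :-ℚ b)) refl
    (+ 1 / suc (i ℕ.+ i)) (w ^ suc (i ℕ.+ i)) (z ^ suc (i ℕ.+ i))

  artanhSum-diff-≤ : ∀ {z w} n → 0ℚ ≤ z → z ≤ w → artanhSum n w - artanhSum n z ≤ (w - z) * evenPowers n w
  artanhSum-diff-≤ {z} {w} n 0≤z z≤w = begin
    artanhSum n w - artanhSum n z
      ≡⟨ ∑-diff n (artanhTerm w) (artanhTerm z) ⟩
    ℚLemmas.∑ n (λ i → artanhTerm w i - artanhTerm z i)
      ≤⟨ ∑-mono n (λ i → begin
           artanhTerm w i - artanhTerm z i
             ≡⟨ artanhTerm-diff z w i ⟩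
           (+ 1 / suc (i ℕ.+ i)) * (w ^ suc (i ℕ.+ i) - z ^ suc (i ℕ.+ i))
             ≤⟨ mulˡ (1/-nonNeg (i ℕ.+ i)) (^-diff-≤ (i ℕ.+ i) 0≤z z≤w) ⟩
           (+ 1 / suc (i ℕ.+ i)) * ((+ suc (i ℕ.+ i) / 1) * (w ^ (i ℕ.+ i) * (w - z)))
             ≡⟨ trans (1/suc*suc* (i ℕ.+ i) _) (*-comm (w ^ (i ℕ.+ i)) (w - z)) ⟩
           (w - z) * w ^ (i ℕ.+ i) ∎) ⟩
    ℚLemmas.∑ n (λ i → (w - z) * w ^ (i ℕ.+ i))
      ≡⟨ ∑-distribˡ n (w - z) _ ⟩
    (w - z) * evenPowers n w ∎

  artanhSum-diff-≥ : ∀ {z w} n → 0ℚ ≤ z → z ≤ w → (w - z) * evenPowers n z ≤ artanhSum n w - artanhSum n z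
  artanhSum-diff-≥ {z} {w} n 0≤z z≤w = begin
    (w - z) * evenPowers n z
      ≡⟨ ∑-distribˡ n (w - z) _ ⟨
    ℚLemmas.∑ n (λ i → (w - z) * z ^ (i ℕ.+ i))
      ≤⟨ ∑-mono n (λ i → begin
           (w - z) * z ^ (i ℕ.+ i)
             ≡⟨ trans (*-comm (w - z) (z ^ (i ℕ.+ i))) (sym (1/suc*suc* (i ℕ.+ i) _)) ⟩
           (+ 1 / suc (i ℕ.+ i)) * ((+ suc (i ℕ.+ i) / 1) * (z ^ (i ℕ.+ i) * (w - z)))
             ≤⟨ mulˡ (1/-nonNeg (i ℕ.+ i)) (^-diff-≥ (i ℕ.+ i) 0≤z z≤w) ⟩
           (+ 1 / suc (i ℕ.+ i)) * (w ^ suc (i ℕ.+ i) - z ^ suc (i ℕ.+ i))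
             ≡⟨ artanhTerm-diff z w i ⟨
           artanhTerm w i - artanhTerm z i ∎) ⟩
    ℚLemmas.∑ n (λ i → artanhTerm w i - artanhTerm z i)
      ≡⟨ ∑-diff n (artanhTerm w) (artanhTerm z) ⟨
    artanhSum n w - artanhSum n z ∎

  möbius-nonNeg : ∀ p → 0ℚ ≤ möbius p
  möbius-nonNeg p = mul-nonNeg (0≤q-p (p≤q⊔p p 1ℚ)) (inv-nonNeg ((p ⊔ 1ℚ) + 1ℚ))

  module Point (p : ℚ) where
    a = p ⊔ 1ℚ
    i = inv p
    j = inv (a + 1ℚ)
    z = möbius p

    1≤a : 1ℚ ≤ a
    1≤a = p≤q⊔p p 1ℚ

    0≤i : 0ℚ ≤ i
    0≤i = inv-nonNeg p

    0≤j : 0ℚ ≤ j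
    0≤j = inv-nonNeg (a + 1ℚ)

    ai≡1 : a * i ≡ 1ℚ
    ai≡1 = inv-inverse p

    [a+1]j≡1 : (a + 1ℚ) * j ≡ 1ℚ
    [a+1]j≡1 = trans (cong (_* j) (sym (p≥q⇒p⊔q≡p (≤-trans 1≤a (0≤d⇒≤ 0≤1 refl))))) (inv-inverse (a + 1ℚ))

    z≡1-2j : z ≡ 1ℚ - 2ℚ * j
    z≡1-2j = trans (solveℚ 2 (λ a j → (a :-ℚ conℚ 1ℚ) :*ℚ j :=ℚ (a :+ℚ conℚ 1ℚ) :*ℚ j :-ℚ conℚ 2ℚ :*ℚ j) refl a j)
      (cong (_- 2ℚ * j) [a+1]j≡1)

    S : ℕ → ℚ
    S n = evenPowers n z

    -- Here 1 - z² = 4a/(a + 1)², so the geometric sum (1 - z^(2n))/(1 - z²) becomes a rational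
    -- expression in a alone. The factor inserted below is 1 written as a i ((a + 1) j)²; it
    -- replaces all divisions.
    4S≡ : ∀ n → 4ℚ * S n ≡ (1ℚ - z ^ (n ℕ.+ n)) * ((a + 1ℚ) * (a + 1ℚ) * i)
    4S≡ n = begin-equality
      4ℚ * S n
        ≡⟨ *-identityʳ _ ⟨
      4ℚ * S n * 1ℚ
        ≡⟨ cong (4ℚ * S n *_) (sym cancel) ⟩
      4ℚ * S n * (a * i * (((a + 1ℚ) * j) * ((a + 1ℚ) * j)))
        ≡⟨ solveℚ 4 (λ a i j S → conℚ 4ℚ :*ℚ S :*ℚ (a :*ℚ i :*ℚ (((a :+ℚ conℚ 1ℚ) :*ℚ j) :*ℚ ((a :+ℚ conℚ 1ℚ) :*ℚ j)))
             :=ℚ S :*ℚ (conℚ 4ℚ :*ℚ j :*ℚ ((a :+ℚ conℚ 1ℚ) :*ℚ j :-ℚ j)) :*ℚ ((a :+ℚ conℚ 1ℚ) :*ℚ (a :+ℚ conℚ 1ℚ) :*ℚ i)) refl a i j (S n) ⟩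
      S n * (4ℚ * j * ((a + 1ℚ) * j - j)) * ((a + 1ℚ) * (a + 1ℚ) * i)
        ≡⟨ cong (λ t → S n * (4ℚ * j * (t - j)) * ((a + 1ℚ) * (a + 1ℚ) * i)) [a+1]j≡1 ⟩
      S n * (4ℚ * j * (1ℚ - j)) * ((a + 1ℚ) * (a + 1ℚ) * i)
        ≡⟨ cong (λ t → S n * t * ((a + 1ℚ) * (a + 1ℚ) * i)) (sym 1-z²) ⟩
      S n * (1ℚ - z * z) * ((a + 1ℚ) * (a + 1ℚ) * i)
        ≡⟨ cong (_* ((a + 1ℚ) * (a + 1ℚ) * i)) (evenPowers-geometric n z) ⟩
      (1ℚ - z ^ (n ℕ.+ n)) * ((a + 1ℚ) * (a + 1ℚ) * i) ∎
      where
      cancel : a * i * (((a + 1ℚ) * j) * ((a + 1ℚ) * j)) ≡ 1ℚ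
      cancel = cong₂ (λ s t → s * (t * t)) ai≡1 [a+1]j≡1
      1-z² : 1ℚ - z * z ≡ 4ℚ * j * (1ℚ - j)
      1-z² = trans (cong (λ t → 1ℚ - t * t) z≡1-2j)
        (solveℚ 1 (λ j → conℚ 1ℚ :-ℚ (conℚ 1ℚ :-ℚ conℚ 2ℚ :*ℚ j) :*ℚ (conℚ 1ℚ :-ℚ conℚ 2ℚ :*ℚ j) :=ℚ conℚ 4ℚ :*ℚ j :*ℚ (conℚ 1ℚ :-ℚ j)) refl j)

  module Pair (p q : ℚ) where
    module P = Point p
    module Q = Point q

    j-diff : P.j - Q.j ≡ (Q.a - P.a) * (P.j * Q.j)
    j-diff = trans (cong₂ _-_
        (trans (sym (*-identityʳ P.j)) (cong (P.j *_) (sym Q.[a+1]j≡1)))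
        (trans (sym (*-identityʳ Q.j)) (cong (Q.j *_) (sym P.[a+1]j≡1))))
      (solveℚ 4 (λ a b i j → i :*ℚ ((b :+ℚ conℚ 1ℚ) :*ℚ j) :-ℚ j :*ℚ ((a :+ℚ conℚ 1ℚ) :*ℚ i) :=ℚ (b :-ℚ a) :*ℚ (i :*ℚ j)) refl P.a Q.a P.j Q.j)

    z-diff : Q.z - P.z ≡ 2ℚ * ((Q.a - P.a) * (P.j * Q.j))
    z-diff = trans (cong₂ _-_ Q.z≡1-2j P.z≡1-2j)
      (trans (solveℚ 2 (λ i j → (conℚ 1ℚ :-ℚ conℚ 2ℚ :*ℚ j) :-ℚ (conℚ 1ℚ :-ℚ conℚ 2ℚ :*ℚ i) :=ℚ conℚ 2ℚ :*ℚ (i :-ℚ j)) refl P.j Q.j)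
        (cong (2ℚ *_) j-diff))

    step-Q : ∀ n → 2ℚ * ((Q.z - P.z) * Q.S n) ≡ (1ℚ - Q.z ^ (n ℕ.+ n)) * ((Q.a - P.a) * (P.j * (Q.a + 1ℚ) * Q.i))
    step-Q n = begin-equality
      2ℚ * ((Q.z - P.z) * Q.S n)
        ≡⟨ cong (λ t → 2ℚ * (t * Q.S n)) z-diff ⟩
      2ℚ * (2ℚ * ((Q.a - P.a) * (P.j * Q.j)) * Q.S n)
        ≡⟨ solveℚ 3 (λ d j s → conℚ 2ℚ :*ℚ (conℚ 2ℚ :*ℚ (d :*ℚ j) :*ℚ s) :=ℚ conℚ 4ℚ :*ℚ s :*ℚ (d :*ℚ j)) refl (Q.a - P.a) (P.j * Q.j) (Q.S n) ⟩
      4ℚ * Q.S n * ((Q.a - P.a) * (P.j * Q.j))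
        ≡⟨ cong (_* ((Q.a - P.a) * (P.j * Q.j))) (Q.4S≡ n) ⟩
      (1ℚ - Q.z ^ (n ℕ.+ n)) * ((Q.a + 1ℚ) * (Q.a + 1ℚ) * Q.i) * ((Q.a - P.a) * (P.j * Q.j))
        ≡⟨ solveℚ 6 (λ e b d i k j → e :*ℚ (b :*ℚ b :*ℚ k) :*ℚ (d :*ℚ (i :*ℚ j)) :=ℚ e :*ℚ (d :*ℚ (i :*ℚ (b :*ℚ (b :*ℚ j)) :*ℚ k))) refl
             (1ℚ - Q.z ^ (n ℕ.+ n)) (Q.a + 1ℚ) (Q.a - P.a) P.j Q.i Q.j ⟩
      (1ℚ - Q.z ^ (n ℕ.+ n)) * ((Q.a - P.a) * (P.j * ((Q.a + 1ℚ) * ((Q.a + 1ℚ) * Q.j)) * Q.i))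
        ≡⟨ cong (λ t → (1ℚ - Q.z ^ (n ℕ.+ n)) * ((Q.a - P.a) * (P.j * t * Q.i)))
             (trans (cong ((Q.a + 1ℚ) *_) Q.[a+1]j≡1) (*-identityʳ (Q.a + 1ℚ))) ⟩
      (1ℚ - Q.z ^ (n ℕ.+ n)) * ((Q.a - P.a) * (P.j * (Q.a + 1ℚ) * Q.i)) ∎

    i-diff : P.i - P.j * (Q.a + 1ℚ) * Q.i ≡ (Q.a - P.a) * (P.i * P.j * Q.i)
    i-diff = begin-equality
      P.i - P.j * (Q.a + 1ℚ) * Q.i
        ≡⟨ solveℚ 4 (λ i j k b → i :-ℚ j :*ℚ (b :+ℚ conℚ 1ℚ) :*ℚ k :=ℚ i :*ℚ conℚ 1ℚ :*ℚ conℚ 1ℚ :-ℚ j :*ℚ (b :+ℚ conℚ 1ℚ) :*ℚ k :*ℚ conℚ 1ℚ) refl P.i P.j Q.i Q.a ⟩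
      P.i * 1ℚ * 1ℚ - P.j * (Q.a + 1ℚ) * Q.i * 1ℚ
        ≡⟨ cong₂ _-_ (cong₂ (λ s t → P.i * s * t) (sym P.[a+1]j≡1) (sym Q.ai≡1)) (cong (P.j * (Q.a + 1ℚ) * Q.i *_) (sym P.ai≡1)) ⟩
      P.i * ((P.a + 1ℚ) * P.j) * (Q.a * Q.i) - P.j * (Q.a + 1ℚ) * Q.i * (P.a * P.i)
        ≡⟨ solveℚ 5 (λ i j k a b → i :*ℚ ((a :+ℚ conℚ 1ℚ) :*ℚ j) :*ℚ (b :*ℚ k) :-ℚ j :*ℚ (b :+ℚ conℚ 1ℚ) :*ℚ k :*ℚ (a :*ℚ i) :=ℚ (b :-ℚ a) :*ℚ (i :*ℚ j :*ℚ k)) refl P.i P.j Q.i P.a Q.a ⟩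
      (Q.a - P.a) * (P.i * P.j * Q.i) ∎

    -- Write a and b for `P.a` and `Q.a`. The slope (b + 1)/((a + 1) b) produced by `step-Q` falls
    -- short of 1/a by (b - a)/(a (a + 1) b). Multiplied by b - a this defect contains a square, so
    -- its sign does not depend on the order of a and b.
    i-diff-square : P.i * (Q.a - P.a) ≡ (Q.a - P.a) * (P.j * (Q.a + 1ℚ) * Q.i) + (Q.a - P.a) * (Q.a - P.a) * (P.i * P.j * Q.i)
    i-diff-square = begin-equality
      P.i * (Q.a - P.a)
        ≡⟨ solveℚ 3 (λ i d y → i :*ℚ d :=ℚ d :*ℚ y :+ℚ d :*ℚ (i :-ℚ y)) refl P.i (Q.a - P.a) (P.j * (Q.a + 1ℚ) * Q.i) ⟩
      (Q.a - P.a) * (P.j * (Q.a + 1ℚ) * Q.i) + (Q.a - P.a) * (P.i - P.j * (Q.a + 1ℚ) * Q.i)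
        ≡⟨ cong (λ t → (Q.a - P.a) * (P.j * (Q.a + 1ℚ) * Q.i) + (Q.a - P.a) * t) i-diff ⟩
      (Q.a - P.a) * (P.j * (Q.a + 1ℚ) * Q.i) + (Q.a - P.a) * ((Q.a - P.a) * (P.i * P.j * Q.i))
        ≡⟨ cong (λ t → (Q.a - P.a) * (P.j * (Q.a + 1ℚ) * Q.i) + t) (sym (*-assoc (Q.a - P.a) (Q.a - P.a) _)) ⟩
      (Q.a - P.a) * (P.j * (Q.a + 1ℚ) * Q.i) + (Q.a - P.a) * (Q.a - P.a) * (P.i * P.j * Q.i) ∎

    -- `artanhSum n` is convex on nonnegative arguments, so its tangent at `Q.z` lies below the
    -- graph, on whichever side of it `P.z` lies.
    artanhSum-tangent : ∀ n → artanhSum n Q.z - artanhSum n P.z ≤ (Q.z - P.z) * Q.S n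
    artanhSum-tangent n = [ artanhSum-diff-≤ n (möbius-nonNeg p) , (λ w≤z →
      0≤d⇒≤ (0≤q-p (artanhSum-diff-≥ n (möbius-nonNeg q) w≤z))
        (solveℚ 5 (λ A B z w S → B :-ℚ A :+ℚ ((A :-ℚ B) :-ℚ (z :-ℚ w) :*ℚ S) :=ℚ (w :-ℚ z) :*ℚ S) refl
          (artanhSum n P.z) (artanhSum n Q.z) P.z Q.z (Q.S n))) ]′ (≤-total P.z Q.z)

    z^≤1 : ∀ m → Q.z ^ m ≤ 1ℚ
    z^≤1 m = subst (λ k → Q.z ^ k ≤ 1ℚ) (ℕP.+-identityʳ m) (^-drop m 0 (möbius-nonNeg q)
      (0≤d⇒≤ (mul-nonNeg (nonNegative⁻¹ 2ℚ) Q.0≤j)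
        (trans (cong (_+ 2ℚ * Q.j) Q.z≡1-2j) (solveℚ 1 (λ j → conℚ 1ℚ :-ℚ conℚ 2ℚ :*ℚ j :+ℚ conℚ 2ℚ :*ℚ j :=ℚ conℚ 1ℚ) refl Q.j))))

    2artanhSum-≤ : ∀ n → 2ℚ * artanhSum n Q.z - 2ℚ * artanhSum n P.z ≤ (Q.a - P.a) * P.i + Q.z ^ (n ℕ.+ n)
    2artanhSum-≤ n = begin
      2ℚ * artanhSum n Q.z - 2ℚ * artanhSum n P.z
        ≡⟨ solveℚ 2 (λ A B → conℚ 2ℚ :*ℚ B :-ℚ conℚ 2ℚ :*ℚ A :=ℚ conℚ 2ℚ :*ℚ (B :-ℚ A)) refl (artanhSum n P.z) (artanhSum n Q.z) ⟩
      2ℚ * (artanhSum n Q.z - artanhSum n P.z)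
        ≤⟨ mulˡ (nonNegative⁻¹ 2ℚ) (artanhSum-tangent n) ⟩
      2ℚ * ((Q.z - P.z) * Q.S n)
        ≡⟨ step-Q n ⟩
      (1ℚ - e) * ((Q.a - P.a) * (P.j * (Q.a + 1ℚ) * Q.i))
        ≤⟨ mulˡ (0≤q-p (z^≤1 (n ℕ.+ n))) (0≤d⇒≤ 0≤D² (sym i-diff-square)) ⟩
      (1ℚ - e) * (P.i * (Q.a - P.a))
        ≡⟨ solveℚ 4 (λ e i a b → (conℚ 1ℚ :-ℚ e) :*ℚ (i :*ℚ (b :-ℚ a)) :=ℚ (b :-ℚ a) :*ℚ i :+ℚ e :*ℚ (a :*ℚ i :-ℚ b :*ℚ i)) refl e P.i P.a Q.a ⟩
      -- Dropping the factor 1 - e costs e (a - b)/a, which is at most e because a/a = 1 and b/a is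
      -- nonnegative.
      (Q.a - P.a) * P.i + e * (P.a * P.i - Q.a * P.i)
        ≤⟨ +-monoʳ-≤ ((Q.a - P.a) * P.i) (mulˡ (^-nonNeg (n ℕ.+ n) (möbius-nonNeg q)) ≤1) ⟩
      (Q.a - P.a) * P.i + e * 1ℚ
        ≡⟨ cong (λ t → (Q.a - P.a) * P.i + t) (*-identityʳ e) ⟩
      (Q.a - P.a) * P.i + e ∎
      where
      e = Q.z ^ (n ℕ.+ n)
      ≤1 : P.a * P.i - Q.a * P.i ≤ 1ℚ
      ≤1 = 0≤d⇒≤ (mul-nonNeg (≤-trans 0≤1 Q.1≤a) P.0≤i)
        (trans (solveℚ 3 (λ a b i → a :*ℚ i :-ℚ b :*ℚ i :+ℚ b :*ℚ i :=ℚ a :*ℚ i) refl P.a Q.a P.i) P.ai≡1)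
      0≤D² : 0ℚ ≤ (Q.a - P.a) * (Q.a - P.a) * (P.i * P.j * Q.i)
      0≤D² = mul-nonNeg (square-nonNegℚ (Q.a - P.a)) (mul-nonNeg (mul-nonNeg P.0≤i P.0≤j) Q.0≤i)

open import Defs

-- Order, ring structure and absolute value of the Cauchy reals.

Eventually : (ℕ → Set) → Set
Eventually P = Σ[ N ∈ ℕ ] ∀ n → N ℕ.≤ n → P n

both : ∀ {P Q R : ℕ → Set} → (∀ n → P n → Q n → R n) →
       Eventually P → Eventually Q → Eventually R
both f (M , p) (N , q) = M ℕ.⊔ N , λ n n≥ →
  f n (p n (ℕP.m⊔n≤o⇒m≤o M N n≥)) (q n (ℕP.m⊔n≤o⇒n≤o M N n≥))

eventually-map : ∀ {P Q : ℕ → Set} → (∀ n → P n → Q n) → Eventually P → Eventually Q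
eventually-map f (N , p) = N , λ n n≥ → f n (p n n≥)

¬eventually-⊥ : Eventually (λ _ → ⊥) → ⊥
¬eventually-⊥ (N , p) = p N ℕP.≤-refl

pointwise-≈ : ∀ {x y} → (∀ n → seq x n ≡ seq y n) → x ≈ y
pointwise-≈ {x} {y} h = mk≈ λ ε 0<ε → 0 , λ n _ → ℚP.≤-trans
  (ℚP.≤-reflexive (cong ℚ.∣_∣ (trans (cong (ℚ._- seq y n) (h n)) (ℚP.+-inverseʳ (seq y n)))))
  (ℚP.<⇒≤ 0<ε)

pointwise-≤ : ∀ {x y} → (∀ n → seq x n ℚ.≤ seq y n) → x ≤ y
pointwise-≤ {x} {y} h = mk≤ λ ε 0<ε → 0 , λ n _ →
  ℚP.≤-trans (h n) (0≤d⇒≤ (ℚP.<⇒≤ 0<ε) refl)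

≈⇒≤ : ∀ {x y} → x ≈ y → x ≤ y
≈⇒≤ {x} {y} (mk≈ h) = mk≤ λ ε 0<ε → eventually-map
  (λ n k → ℚLemmas.unshift {seq x n} {seq y n} (ℚP.≤-trans (ℚLemmas.p≤∣p∣ _) k)) (h ε 0<ε)

≤-antisym : ∀ {x y} → x ≤ y → y ≤ x → x ≈ y
≤-antisym (mk≤ h) (mk≤ k) = mk≈ λ ε 0<ε → both (λ n p q → ℚLemmas.dist-≤ p q) (h ε 0<ε) (k ε 0<ε)

≤-trans : ∀ {x y z} → x ≤ y → y ≤ z → x ≤ z
≤-trans {x} {y} {z} (mk≤ h) (mk≤ k) = mk≤ λ ε 0<ε → both
  (λ n p q → ℚP.≤-trans p (ℚP.≤-trans (ℚP.+-monoˡ-≤ (ε ℚ.* ½) q) (ℚP.≤-reflexive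
    (ℚS.solve 2 (λ z e → z ℚS.:+ e ℚS.:* ℚS.con ½ ℚS.:+ e ℚS.:* ℚS.con ½ ℚS.:= z ℚS.:+ e)
      refl (seq z n) ε))))
  (h (ε ℚ.* ½) (half-pos 0<ε)) (k (ε ℚ.* ½) (half-pos 0<ε))

≤-refl : ∀ {x} → x ≤ x
≤-refl = pointwise-≤ λ n → ℚP.≤-refl

≈-refl : ∀ {x} → x ≈ x
≈-refl = pointwise-≈ λ n → refl

≈-sym : ∀ {x y} → x ≈ y → y ≈ x
≈-sym {x} {y} (mk≈ h) = mk≈ λ ε 0<ε → eventually-map
  (λ n → subst (ℚ._≤ ε) (ℚLemmas.abs-swap (seq x n) (seq y n))) (h ε 0<ε)

≈⇒≥ : ∀ {x y} → x ≈ y → y ≤ x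
≈⇒≥ e = ≈⇒≤ (≈-sym e)

≈-trans : ∀ {x y z} → x ≈ y → y ≈ z → x ≈ z
≈-trans h k = ≤-antisym (≤-trans (≈⇒≤ h) (≈⇒≤ k)) (≤-trans (≈⇒≥ k) (≈⇒≥ h))

ℝ-poset : Poset _ _ _
ℝ-poset = record
  { Carrier = ℝ ; _≈_ = _≈_ ; _≤_ = _≤_
  ; isPartialOrder = record
    { isPreorder = record
      { isEquivalence = record { refl = ≈-refl ; sym = ≈-sym ; trans = ≈-trans }
      ; reflexive = ≈⇒≤
      ; trans = ≤-trans }
    ; antisym = ≤-antisym } }

module ℝR = Relation.Binary.Reasoning.PartialOrder ℝ-poset

+-mono-≤ : ∀ {x x′ y y′} → x ≤ x′ → y ≤ y′ → x + y ≤ x′ + y′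
+-mono-≤ {x} {x′} {y} {y′} (mk≤ h) (mk≤ k) = mk≤ λ ε 0<ε → both
  (λ n p q → ℚP.≤-trans (ℚP.+-mono-≤ p q) (ℚP.≤-reflexive
    (ℚS.solve 3 (λ x y e → x ℚS.:+ e ℚS.:* ℚS.con ½ ℚS.:+ (y ℚS.:+ e ℚS.:* ℚS.con ½) ℚS.:= x ℚS.:+ y ℚS.:+ e)
      refl (seq x′ n) (seq y′ n) ε)))
  (h (ε ℚ.* ½) (half-pos 0<ε)) (k (ε ℚ.* ½) (half-pos 0<ε))

neg-antimono-≤ : ∀ {x y} → x ≤ y → - y ≤ - x
neg-antimono-≤ {x} {y} (mk≤ h) = mk≤ λ ε 0<ε → eventually-map
  (λ n p → 0≤d⇒≤ (0≤q-p p)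
    (ℚS.solve 3 (λ x y e → ℚS.:- y ℚS.:+ (y ℚS.:+ e ℚS.:- x) ℚS.:= ℚS.:- x ℚS.:+ e)
      refl (seq x n) (seq y n) ε)) (h ε 0<ε)

+-cong : ∀ {x x′ y y′} → x ≈ x′ → y ≈ y′ → x + y ≈ x′ + y′
+-cong h k = ≤-antisym (+-mono-≤ (≈⇒≤ h) (≈⇒≤ k)) (+-mono-≤ (≈⇒≥ h) (≈⇒≥ k))

neg-cong : ∀ {x y} → x ≈ y → - x ≈ - y
neg-cong h = ≤-antisym (neg-antimono-≤ (≈⇒≥ h)) (neg-antimono-≤ (≈⇒≤ h))

*-comm : ∀ x y → x * y ≈ y * x
*-comm x y = pointwise-≈ λ n → ℚP.*-comm (seq x n) (seq y n)

*-congˡ : ∀ x {y y′} → y ≈ y′ → x * y ≈ x * y′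
*-congˡ x {y} {y′} (mk≈ h) = mk≈ λ ε 0<ε →
  let δ , 0<δ , Bδ≤ε = scale B.size ε 0<ε in
  both (λ n p q → begin
      ℚ.∣ seq x n ℚ.* seq y n ℚ.- seq x n ℚ.* seq y′ n ∣
        ≡⟨ cong ℚ.∣_∣ (ℚS.solve 3 (λ a b c → a ℚS.:* b ℚS.:- a ℚS.:* c ℚS.:= a ℚS.:* (b ℚS.:- c)) refl (seq x n) (seq y n) (seq y′ n)) ⟩
      ℚ.∣ seq x n ℚ.* (seq y n ℚ.- seq y′ n) ∣
        ≡⟨ ℚP.∣p*q∣≡∣p∣*∣q∣ (seq x n) _ ⟩
      ℚ.∣ seq x n ∣ ℚ.* ℚ.∣ seq y n ℚ.- seq y′ n ∣
        ≤⟨ ℚLemmas.mul-mono (ℚP.0≤∣p∣ (seq y n ℚ.- seq y′ n)) (ℚP.≤-trans ℚLemmas.0≤1 B.1≤size) p q ⟩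
      B.size ℚ.* δ ≤⟨ Bδ≤ε ⟩
      ε ∎)
    (B.from , B.bound) (h δ 0<δ)
  where
  open ℚP.≤-Reasoning
  module B = CauchyLemmas.Bound (CauchyLemmas.bounded x)

*-cong : ∀ {x x′ y y′} → x ≈ x′ → y ≈ y′ → x * y ≈ x′ * y′
*-cong {x} {x′} {y} {y′} h k = ≈-trans (*-congˡ x k)
  (≈-trans (*-comm x y′) (≈-trans (*-congˡ y′ h) (*-comm y′ x′)))

ℝ-commutativeRing : CommutativeRing _ _
ℝ-commutativeRing = record
  { Carrier = ℝ ; _≈_ = _≈_ ; _+_ = _+_ ; _*_ = _*_ ; -_ = -_ ; 0# = 0ℝ ; 1# = 1ℝ
  ; isCommutativeRing = record
    { isRing = record
      { +-isAbelianGroup = record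
        { isGroup = record
          { isMonoid = record
            { isSemigroup = record
              { isMagma = record
                { isEquivalence = record { refl = ≈-refl ; sym = ≈-sym ; trans = ≈-trans }
                ; ∙-cong = +-cong }
              ; assoc = λ x y z → pointwise-≈ λ n → ℚP.+-assoc (seq x n) (seq y n) (seq z n) }
            ; identity = (λ x → pointwise-≈ λ n → ℚP.+-identityˡ (seq x n))
                       , (λ x → pointwise-≈ λ n → ℚP.+-identityʳ (seq x n)) }
          ; inverse = (λ x → pointwise-≈ λ n → ℚP.+-inverseˡ (seq x n))
                    , (λ x → pointwise-≈ λ n → ℚP.+-inverseʳ (seq x n))
          ; ⁻¹-cong = neg-cong }
        ; comm = λ x y → pointwise-≈ λ n → ℚP.+-comm (seq x n) (seq y n) }
      ; *-cong = *-cong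
      ; *-assoc = λ x y z → pointwise-≈ λ n → ℚP.*-assoc (seq x n) (seq y n) (seq z n)
      ; *-identity = (λ x → pointwise-≈ λ n → ℚP.*-identityˡ (seq x n))
                   , (λ x → pointwise-≈ λ n → ℚP.*-identityʳ (seq x n))
      ; distrib = (λ x y z → pointwise-≈ λ n → ℚP.*-distribˡ-+ (seq x n) (seq y n) (seq z n))
                , (λ x y z → pointwise-≈ λ n → ℚP.*-distribʳ-+ (seq x n) (seq y n) (seq z n)) }
    ; *-comm = *-comm } }

-- Rational coefficients let the ring solver compute with constants instead of treating each
-- `fromℚ q` as an atom.
ℚ-coefficients : ℚP.+-*-rawRing ACR.-Raw-AlmostCommutative⟶ ACR.fromCommutativeRing ℝ-commutativeRing
ℚ-coefficients = record
  { ⟦_⟧ = fromℚ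
  ; +-homo = λ p q → pointwise-≈ λ n → refl
  ; *-homo = λ p q → pointwise-≈ λ n → refl
  ; -‿homo = λ p → pointwise-≈ λ n → refl
  ; 0-homo = ≈-refl
  ; 1-homo = ≈-refl
  }

ℚ≟ : (p q : ℚ) → Maybe (fromℚ p ≈ fromℚ q)
ℚ≟ p q with p ℚP.≟ q
... | yes refl = just ≈-refl
... | no _     = nothing

module ℝSolver = Algebra.Solver.Ring ℚP.+-*-rawRing (ACR.fromCommutativeRing ℝ-commutativeRing) ℚ-coefficients ℚ≟
open ℝSolver using (solve; _:=_; _:+_; _:*_; _:-_; :-_; con)

≤-by : ∀ {d x y} → 0ℝ ≤ d → x + d ≈ y → x ≤ y
≤-by {d} {x} {y} 0≤d e = begin
  x         ≈⟨ solve 1 (λ x → x := x :+ con 0ℚ) ≈-refl x ⟩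
  x + 0ℝ    ≤⟨ +-mono-≤ ≤-refl 0≤d ⟩
  x + d     ≈⟨ e ⟩
  y         ∎
  where open ℝR

0≤y-x : ∀ {x y} → x ≤ y → 0ℝ ≤ y - x
0≤y-x {x} {y} x≤y = begin
  0ℝ        ≈⟨ solve 1 (λ x → con 0ℚ := x :- x) ≈-refl x ⟩
  x - x     ≤⟨ +-mono-≤ x≤y ≤-refl ⟩
  y - x     ∎
  where open ℝR

0≤y-x⇒x≤y : ∀ {x y} → 0ℝ ≤ y - x → x ≤ y
0≤y-x⇒x≤y {x} {y} h = ≤-by h (solve 2 (λ x y → x :+ (y :- x) := y) ≈-refl x y)

+-nonNeg : ∀ {x y} → 0ℝ ≤ x → 0ℝ ≤ y → 0ℝ ≤ x + y
+-nonNeg {x} {y} 0≤x 0≤y = ≤-trans (≈⇒≤ (pointwise-≈ λ _ → refl)) (+-mono-≤ 0≤x 0≤y)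

fromℚ-mono-≤ : ∀ {p q} → p ℚ.≤ q → fromℚ p ≤ fromℚ q
fromℚ-mono-≤ p≤q = pointwise-≤ λ _ → p≤q

fromℚ-cancel-≤ : ∀ {p q} → fromℚ p ≤ fromℚ q → p ℚ.≤ q
fromℚ-cancel-≤ {p} {q} (mk≤ h) with p ℚP.≤? q
... | yes p≤q = p≤q
... | no p≰q  = ⊥-elim (¬eventually-⊥ (eventually-map (λ n k → ℚP.<-irrefl refl (begin-strict
    p                       ≤⟨ k ⟩
    q ℚ.+ (p ℚ.- q) ℚ.* ½   <⟨ ℚP.+-monoʳ-< q (half< 0<d) ⟩
    q ℚ.+ (p ℚ.- q)         ≡⟨ ℚS.solve 2 (λ p q → q ℚS.:+ (p ℚS.:- q) ℚS.:= p) refl p q ⟩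
    p                       ∎)) (h ((p ℚ.- q) ℚ.* ½) (half-pos 0<d))))
  where
  open ℚP.≤-Reasoning
  0<d : 0ℚ ℚ.< p ℚ.- q
  0<d = subst (ℚ._< p ℚ.- q) (ℚP.+-inverseʳ q) (ℚP.+-monoˡ-< (ℚ.- q) (ℚP.≰⇒> p≰q))
  half< : ∀ {d} → 0ℚ ℚ.< d → d ℚ.* ½ ℚ.< d
  half< {d} 0<d = begin-strict
    d ℚ.* ½               ≡⟨ ℚP.+-identityʳ (d ℚ.* ½) ⟨
    d ℚ.* ½ ℚ.+ 0ℚ        <⟨ ℚP.+-monoʳ-< (d ℚ.* ½) (half-pos 0<d) ⟩
    d ℚ.* ½ ℚ.+ d ℚ.* ½   ≡⟨ ℚS.solve 1 (λ d → d ℚS.:* ℚS.con ½ ℚS.:+ d ℚS.:* ℚS.con ½ ℚS.:= d) refl d ⟩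
    d                     ∎

infixl 6 _⊔_

-- Being formed term by term, the maximum exists without any decision about the order. It later
-- replaces the case distinction whether a point lies beyond a jump.
_⊔_ : ℝ → ℝ → ℝ
seq    (x ⊔ y) n = seq x n ℚ.⊔ seq y n
cauchy (x ⊔ y)   = CauchyLemmas.dominated x y (λ n → seq x n ℚ.⊔ seq y n) 0 1ℚ (ℚP.positive⁻¹ 1ℚ) λ m n _ _ →
  ℚP.≤-trans (⊔-dist (seq x m) (seq y m) (seq x n) (seq y n)) (ℚP.≤-reflexive (sym (ℚP.*-identityˡ _)))
  where
  open ℚP.≤-Reasoning
  half : ∀ a b c d → a ℚ.⊔ b ℚ.≤ (c ℚ.⊔ d) ℚ.+ (ℚ.∣ a ℚ.- c ∣ ℚ.+ ℚ.∣ b ℚ.- d ∣)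
  half a b c d = ℚP.⊔-lub
    (ℚP.≤-trans (ℚLemmas.near a c) (ℚP.+-mono-≤ (ℚP.p≤p⊔q c d)
      (0≤d⇒≤ (ℚP.0≤∣p∣ (b ℚ.- d)) refl)))
    (ℚP.≤-trans (ℚLemmas.near b d) (ℚP.+-mono-≤ (ℚP.p≤q⊔p c d)
      (0≤d⇒≤ (ℚP.0≤∣p∣ (a ℚ.- c)) (ℚP.+-comm (ℚ.∣ b ℚ.- d ∣) _))))
  ⊔-dist : ∀ a b c d → ℚ.∣ (a ℚ.⊔ b) ℚ.- (c ℚ.⊔ d) ∣ ℚ.≤ ℚ.∣ a ℚ.- c ∣ ℚ.+ ℚ.∣ b ℚ.- d ∣
  ⊔-dist a b c d = ℚLemmas.dist-≤ (half a b c d)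
    (subst₂ (λ s t → c ℚ.⊔ d ℚ.≤ (a ℚ.⊔ b) ℚ.+ (s ℚ.+ t))
      (ℚLemmas.abs-swap c a) (ℚLemmas.abs-swap d b) (half c d a b))

x≤x⊔y : ∀ x y → x ≤ x ⊔ y
x≤x⊔y x y = pointwise-≤ λ n → ℚP.p≤p⊔q (seq x n) (seq y n)

y≤x⊔y : ∀ x y → y ≤ x ⊔ y
y≤x⊔y x y = pointwise-≤ λ n → ℚP.p≤q⊔p (seq x n) (seq y n)

⊔-lub : ∀ {x y z} → x ≤ z → y ≤ z → x ⊔ y ≤ z
⊔-lub (mk≤ h) (mk≤ k) = mk≤ λ ε 0<ε → both (λ n → ℚP.⊔-lub) (h ε 0<ε) (k ε 0<ε)

y≤x⇒x⊔y≈x : ∀ {x y} → y ≤ x → x ⊔ y ≈ x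
y≤x⇒x⊔y≈x {x} {y} y≤x = ≤-antisym (⊔-lub ≤-refl y≤x) (x≤x⊔y x y)

x≤y⇒x⊔y≈y : ∀ {x y} → x ≤ y → x ⊔ y ≈ y
x≤y⇒x⊔y≈y {x} {y} x≤y = ≤-antisym (⊔-lub x≤y ≤-refl) (y≤x⊔y x y)

⊔-cong : ∀ {x x′ y y′} → x ≈ x′ → y ≈ y′ → x ⊔ y ≈ x′ ⊔ y′
⊔-cong {x} {x′} {y} {y′} h k = ≤-antisym
  (⊔-lub (≤-trans (≈⇒≤ h) (x≤x⊔y x′ y′)) (≤-trans (≈⇒≤ k) (y≤x⊔y x′ y′)))
  (⊔-lub (≤-trans (≈⇒≥ h) (x≤x⊔y x y)) (≤-trans (≈⇒≥ k) (y≤x⊔y x y)))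

-- The terms of a nonnegative real may be slightly negative. Passing to the maximum with 0 changes
-- neither factor as a real and makes the products nonnegative term by term.
*-nonNeg : ∀ {x y} → 0ℝ ≤ x → 0ℝ ≤ y → 0ℝ ≤ x * y
*-nonNeg {x} {y} 0≤x 0≤y = begin
  0ℝ                    ≤⟨ pointwise-≤ (λ n → ℚLemmas.mul-nonNeg (ℚP.p≤q⊔p (seq x n) 0ℚ) (ℚP.p≤q⊔p (seq y n) 0ℚ)) ⟩
  (x ⊔ 0ℝ) * (y ⊔ 0ℝ)   ≈⟨ *-cong (y≤x⇒x⊔y≈x 0≤x) (y≤x⇒x⊔y≈x 0≤y) ⟩
  x * y                 ∎
  where open ℝR

*-monoˡ-≤ : ∀ {r x y} → 0ℝ ≤ r → x ≤ y → r * x ≤ r * y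
*-monoˡ-≤ {r} {x} {y} 0≤r x≤y = ≤-by (*-nonNeg 0≤r (0≤y-x x≤y))
  (solve 3 (λ r x y → r :* x :+ r :* (y :- x) := r :* y) ≈-refl r x y)

*-monoʳ-≤ : ∀ {r x y} → 0ℝ ≤ r → x ≤ y → x * r ≤ y * r
*-monoʳ-≤ {r} {x} {y} 0≤r x≤y = ≤-by (*-nonNeg 0≤r (0≤y-x x≤y))
  (solve 3 (λ r x y → x :* r :+ r :* (y :- x) := y :* r) ≈-refl r x y)

*-mono-≤ : ∀ {x x′ y y′} → 0ℝ ≤ y → 0ℝ ≤ x′ → x ≤ x′ → y ≤ y′ → x * y ≤ x′ * y′
*-mono-≤ 0≤y 0≤x′ x≤x′ y≤y′ = ≤-trans (*-monoʳ-≤ 0≤y x≤x′) (*-monoˡ-≤ 0≤x′ y≤y′)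

square-nonNeg : ∀ x → 0ℝ ≤ x * x
square-nonNeg x = pointwise-≤ λ n → square-nonNegℚ (seq x n)

0≤1ℝ : 0ℝ ≤ 1ℝ
0≤1ℝ = fromℚ-mono-≤ ℚLemmas.0≤1

^-nonNeg : ∀ {x} k → 0ℝ ≤ x → 0ℝ ≤ x ^ k
^-nonNeg zero    0≤x = 0≤1ℝ
^-nonNeg (suc k) 0≤x = *-nonNeg 0≤x (^-nonNeg k 0≤x)

^-cong : ∀ {x y} k → x ≈ y → x ^ k ≈ y ^ k
^-cong zero    e = ≈-refl
^-cong (suc k) e = *-cong e (^-cong k e)

^-mono-≤ : ∀ {x y} k → 0ℝ ≤ x → x ≤ y → x ^ k ≤ y ^ k
^-mono-≤ zero    0≤x x≤y = ≤-refl
^-mono-≤ (suc k) 0≤x x≤y = *-mono-≤ (^-nonNeg k 0≤x) (≤-trans 0≤x x≤y) x≤y (^-mono-≤ k 0≤x x≤y)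

∣∣-lub : ∀ {x c} → x ≤ c → - x ≤ c → ∣ x ∣ ≤ c
∣∣-lub (mk≤ h) (mk≤ k) = mk≤ λ ε 0<ε → both (λ n → ℚLemmas.abs-≤) (h ε 0<ε) (k ε 0<ε)

0≤∣x∣ : ∀ x → 0ℝ ≤ ∣ x ∣
0≤∣x∣ x = pointwise-≤ λ n → ℚP.0≤∣p∣ (seq x n)

x≤∣x∣ : ∀ x → x ≤ ∣ x ∣
x≤∣x∣ x = pointwise-≤ λ n → ℚLemmas.p≤∣p∣ (seq x n)

∣-x∣≈∣x∣ : ∀ x → ∣ - x ∣ ≈ ∣ x ∣
∣-x∣≈∣x∣ x = pointwise-≈ λ n → ℚP.∣-p∣≡∣p∣ (seq x n)

-x≤∣x∣ : ∀ x → - x ≤ ∣ x ∣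
-x≤∣x∣ x = ≤-trans (x≤∣x∣ (- x)) (≈⇒≤ (∣-x∣≈∣x∣ x))

∣∣-cong : ∀ {x y} → x ≈ y → ∣ x ∣ ≈ ∣ y ∣
∣∣-cong {x} {y} (mk≈ h) = mk≈ λ ε 0<ε → eventually-map
  (λ n → ℚP.≤-trans (ℚLemmas.∣∣-dist (seq x n) (seq y n))) (h ε 0<ε)

∣x*y∣≈∣x∣*∣y∣ : ∀ x y → ∣ x * y ∣ ≈ ∣ x ∣ * ∣ y ∣
∣x*y∣≈∣x∣*∣y∣ x y = pointwise-≈ λ n → ℚP.∣p*q∣≡∣p∣*∣q∣ (seq x n) (seq y n)

∣x+y∣≤∣x∣+∣y∣ : ∀ x y → ∣ x + y ∣ ≤ ∣ x ∣ + ∣ y ∣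
∣x+y∣≤∣x∣+∣y∣ x y = pointwise-≤ λ n → ℚP.∣p+q∣≤∣p∣+∣q∣ (seq x n) (seq y n)

0≤x⇒∣x∣≈x : ∀ {x} → 0ℝ ≤ x → ∣ x ∣ ≈ x
0≤x⇒∣x∣≈x {x} 0≤x = ≤-antisym (∣∣-lub ≤-refl (≤-by (+-nonNeg 0≤x 0≤x)
  (solve 1 (λ x → :- x :+ (x :+ x) := x) ≈-refl x))) (x≤∣x∣ x)

∣x-y∣≈∣y-x∣ : ∀ x y → ∣ x - y ∣ ≈ ∣ y - x ∣
∣x-y∣≈∣y-x∣ x y = pointwise-≈ λ n → ℚLemmas.abs-swap (seq x n) (seq y n)

∣∣-+-≤ : ∀ {x y z a b} → x + y ≈ z → ∣ x ∣ ≤ a → ∣ y ∣ ≤ b → ∣ z ∣ ≤ a + b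
∣∣-+-≤ {x} {y} e x≤a y≤b = ≤-trans (≈⇒≤ (∣∣-cong (≈-sym e)))
  (≤-trans (∣x+y∣≤∣x∣+∣y∣ x y) (+-mono-≤ x≤a y≤b))

∣∣-*-≤ : ∀ {x y a b} → ∣ x ∣ ≤ a → ∣ y ∣ ≤ b → ∣ x * y ∣ ≤ a * b
∣∣-*-≤ {x} {y} x≤a y≤b = ≤-trans (≈⇒≤ (∣x*y∣≈∣x∣*∣y∣ x y))
  (*-mono-≤ (0≤∣x∣ y) (≤-trans (0≤∣x∣ x) x≤a) x≤a y≤b)

∣x∣≤0⇒x≈0 : ∀ {x} → ∣ x ∣ ≤ 0ℝ → x ≈ 0ℝ
∣x∣≤0⇒x≈0 {x} h = ≤-antisym (≤-trans (x≤∣x∣ x) h)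
  (0≤y-x⇒x≤y (≤-trans (≈⇒≤ (pointwise-≈ λ _ → refl)) (≤-trans (neg-antimono-≤ (≤-trans (-x≤∣x∣ x) h))
    (≈⇒≤ (solve 1 (λ x → :- (:- x) := x :- con 0ℚ) ≈-refl x)))))

-- One far enough term decides on which side the sequence of x ends up.
compare : ∀ x y η → 0ℚ ℚ.< η →
  Eventually (λ n → seq x n ℚ.≤ seq y n ℚ.+ (η ℚ.+ η ℚ.+ η ℚ.+ η ℚ.+ η)) ⊎
  Eventually (λ n → seq y n ℚ.+ η ℚ.≤ seq x n)
-- Beyond N both sequences stay within η of their N-th terms. The threshold 3η at N therefore grows
-- to 5η in the first case and leaves a gap of η in the second.
compare x y η 0<η = decide (seq x N ℚP.≤? seq y N ℚ.+ (η ℚ.+ η ℚ.+ η))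
  where
  open ℚP.≤-Reasoning
  cx = cauchy x η 0<η
  cy = cauchy y η 0<η
  N = proj₁ cx ℕ.⊔ proj₁ cy
  nearx : ∀ {m n} → N ℕ.≤ m → N ℕ.≤ n → seq x m ℚ.≤ seq x n ℚ.+ η
  nearx {m} {n} m≥ n≥ = ℚP.≤-trans (ℚLemmas.near (seq x m) (seq x n)) (ℚP.+-monoʳ-≤ (seq x n)
    (proj₂ cx m n (ℕP.m⊔n≤o⇒m≤o (proj₁ cx) _ m≥) (ℕP.m⊔n≤o⇒m≤o (proj₁ cx) _ n≥)))
  neary : ∀ {m n} → N ℕ.≤ m → N ℕ.≤ n → seq y m ℚ.≤ seq y n ℚ.+ η
  neary {m} {n} m≥ n≥ = ℚP.≤-trans (ℚLemmas.near (seq y m) (seq y n)) (ℚP.+-monoʳ-≤ (seq y n)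
    (proj₂ cy m n (ℕP.m⊔n≤o⇒n≤o (proj₁ cx) _ m≥) (ℕP.m⊔n≤o⇒n≤o (proj₁ cx) _ n≥)))
  decide : _ → _
  decide (yes h) = inj₁ (N , λ n n≥ → begin
    seq x n                                   ≤⟨ nearx n≥ ℕP.≤-refl ⟩
    seq x N ℚ.+ η                             ≤⟨ ℚP.+-monoˡ-≤ η h ⟩
    seq y N ℚ.+ (η ℚ.+ η ℚ.+ η) ℚ.+ η         ≤⟨ ℚP.+-monoˡ-≤ η (ℚP.+-monoˡ-≤ (η ℚ.+ η ℚ.+ η) (neary ℕP.≤-refl n≥)) ⟩
    seq y n ℚ.+ η ℚ.+ (η ℚ.+ η ℚ.+ η) ℚ.+ η   ≡⟨ ℚS.solve 2 (λ y e →
      y ℚS.:+ e ℚS.:+ (e ℚS.:+ e ℚS.:+ e) ℚS.:+ e ℚS.:= y ℚS.:+ (e ℚS.:+ e ℚS.:+ e ℚS.:+ e ℚS.:+ e)) refl (seq y n) η ⟩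
    seq y n ℚ.+ (η ℚ.+ η ℚ.+ η ℚ.+ η ℚ.+ η)   ∎)
  decide (no h) = inj₂ (N , λ n n≥ → begin
    seq y n ℚ.+ η                             ≤⟨ ℚP.+-monoˡ-≤ η (neary n≥ ℕP.≤-refl) ⟩
    seq y N ℚ.+ η ℚ.+ η                       ≡⟨ ℚS.solve 2 (λ y e →
      y ℚS.:+ e ℚS.:+ e ℚS.:= y ℚS.:+ (e ℚS.:+ e ℚS.:+ e) ℚS.:- e) refl (seq y N) η ⟩
    seq y N ℚ.+ (η ℚ.+ η ℚ.+ η) ℚ.- η         ≤⟨ ℚP.+-monoˡ-≤ (ℚ.- η) (ℚP.<⇒≤ (ℚP.≰⇒> h)) ⟩
    seq x N ℚ.- η                             ≤⟨ ℚP.+-monoˡ-≤ (ℚ.- η) (nearx ℕP.≤-refl n≥) ⟩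
    seq x n ℚ.+ η ℚ.- η                       ≡⟨ ℚS.solve 2 (λ x e → x ℚS.:+ e ℚS.:- e ℚS.:= x) refl (seq x n) η ⟩
    seq x n                                   ∎)

-- With η = ε/5, `compare` yields either the bound by ε or a lasting gap, and the hypothesis refutes
-- the latter. Thus ≤ is equivalent to a negative statement, which is the source of its stability.
unless-above : ∀ x y → (∀ η → 0ℚ ℚ.< η → ¬ Eventually (λ n → seq y n ℚ.+ η ℚ.≤ seq x n)) → x ≤ y
unless-above x y h = mk≤ λ ε 0<ε → decide ε (*-pos 0<ε 0<⅕) (compare x y (ε ℚ.* ⅕) (*-pos 0<ε 0<⅕))
  where
  ⅕ = + 1 ℚ./ 5
  0<⅕ = ℚP.positive⁻¹ ⅕
  decide : ∀ ε → 0ℚ ℚ.< ε ℚ.* ⅕ → _ → Eventually (λ n → seq x n ℚ.≤ seq y n ℚ.+ ε)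
  decide ε 0<η (inj₁ e) = eventually-map (λ n → subst (λ t → seq x n ℚ.≤ seq y n ℚ.+ t)
    (ℚS.solve 1 (λ e → e ℚS.:* ℚS.con ⅕ ℚS.:+ e ℚS.:* ℚS.con ⅕ ℚS.:+ e ℚS.:* ℚS.con ⅕ ℚS.:+ e ℚS.:* ℚS.con ⅕ ℚS.:+ e ℚS.:* ℚS.con ⅕ ℚS.:= e) refl ε)) e
  decide ε 0<η (inj₂ e) = ⊥-elim (h (ε ℚ.* ⅕) 0<η e)

≤⇒¬above : ∀ {x y} → x ≤ y → ∀ η → 0ℚ ℚ.< η → ¬ Eventually (λ n → seq y n ℚ.+ η ℚ.≤ seq x n)
≤⇒¬above {x} {y} (mk≤ k) η 0<η e = ¬eventually-⊥ (both (λ n p q →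
  ℚP.<-irrefl refl (ℚP.≤-<-trans (ℚP.≤-trans p q) (ℚP.+-monoʳ-< (seq y n) half<))) e (k (η ℚ.* ½) (half-pos 0<η)))
  where
  half< : η ℚ.* ½ ℚ.< η
  half< = subst₂ ℚ._<_ (ℚP.+-identityʳ _)
    (ℚS.solve 1 (λ d → d ℚS.:* ℚS.con ½ ℚS.:+ d ℚS.:* ℚS.con ½ ℚS.:= d) refl η)
    (ℚP.+-monoʳ-< (η ℚ.* ½) (half-pos 0<η))

≤-stable : ∀ {x y} → ¬ ¬ (x ≤ y) → x ≤ y
≤-stable {x} {y} h = unless-above x y λ η 0<η e → h λ x≤y → ≤⇒¬above x≤y η 0<η e

-- A lasting gap of y below x already gives y ≤ x, so refuting both alternatives rules out every gap
-- and proves x ≤ y.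
≤-total-¬¬ : ∀ x y → ¬ ¬ (x ≤ y ⊎ y ≤ x)
≤-total-¬¬ x y k = k (inj₁ (unless-above x y λ η 0<η (N , e) → k (inj₂ (mk≤ λ ε 0<ε → N , λ n n≥ →
  ℚP.≤-trans (0≤d⇒≤ (ℚP.<⇒≤ 0<η) refl) (ℚP.≤-trans (e n n≥) (0≤d⇒≤ (ℚP.<⇒≤ 0<ε) refl))))))

-- The order is not decidable, but ≤ is stable, so inequalities may be proved by cases.
≤-by-cases : ∀ x y {u v} → (x ≤ y → u ≤ v) → (y ≤ x → u ≤ v) → u ≤ v
≤-by-cases x y f g = ≤-stable λ ¬p → ≤-total-¬¬ x y λ { (inj₁ h) → ¬p (f h) ; (inj₂ h) → ¬p (g h) }

upper : ∀ x → Σ[ q ∈ ℚ ] x ≤ fromℚ q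
upper x = B.size , mk≤ λ ε 0<ε → B.from , λ n n≥ →
  ℚP.≤-trans (ℚP.≤-trans (ℚLemmas.p≤∣p∣ (seq x n)) (B.bound n n≥)) (0≤d⇒≤ (ℚP.<⇒≤ 0<ε) refl)
  where module B = CauchyLemmas.Bound (CauchyLemmas.bounded x)

archimedean : ∀ x → Σ[ n ∈ ℕ ] x ≤ fromℤ (+ n)
archimedean x = let q , x≤q = upper x ; n , q≤n = ℚLemmas.archimedean q in
  n , ≤-trans x≤q (fromℚ-mono-≤ q≤n)

fromℤ-suc : ∀ n → fromℤ (+ suc n) ≈ fromℤ (+ n) + 1ℝ
fromℤ-suc n = pointwise-≈ λ _ → ℚLemmas./1-suc n

∑-cong : ∀ n {s t : ℕ → ℝ} → (∀ i → s i ≈ t i) → ∑ n s ≈ ∑ n t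
∑-cong zero    e = ≈-refl
∑-cong (suc n) e = +-cong (∑-cong n e) (e n)

∑-+ : ∀ n (s t : ℕ → ℝ) → ∑ n (λ i → s i + t i) ≈ ∑ n s + ∑ n t
∑-+ zero    s t = solve 0 (con 0ℚ := con 0ℚ :+ con 0ℚ) ≈-refl
∑-+ (suc n) s t = ≈-trans (+-cong (∑-+ n s t) ≈-refl)
  (solve 4 (λ a b c d → a :+ b :+ (c :+ d) := a :+ c :+ (b :+ d)) ≈-refl (∑ n s) (∑ n t) (s n) (t n))

∑-* : ∀ n c (t : ℕ → ℝ) → ∑ n (λ i → c * t i) ≈ c * ∑ n t
∑-* zero    c t = solve 1 (λ c → con 0ℚ := c :* con 0ℚ) ≈-refl c
∑-* (suc n) c t = ≈-trans (+-cong (∑-* n c t) ≈-refl)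
  (solve 3 (λ c a b → c :* a :+ c :* b := c :* (a :+ b)) ≈-refl c (∑ n t) (t n))

∑-shift : ∀ n (t : ℕ → ℝ) → ∑ (suc n) t ≈ t 0 + ∑ n (λ i → t (suc i))
∑-shift zero    t = solve 1 (λ a → con 0ℚ :+ a := a :+ con 0ℚ) ≈-refl (t 0)
∑-shift (suc n) t = ≈-trans (+-cong (∑-shift n t) ≈-refl)
  (solve 3 (λ a b c → a :+ b :+ c := a :+ (b :+ c)) ≈-refl (t 0) (∑ n (λ i → t (suc i))) (t (suc n)))

-- Reciprocal and logarithm as total functions, with their inequalities on [1,∞).

rec : ℝ → ℝ
seq    (rec x) n = ℚLemmas.inv (seq x n)
cauchy (rec x)   = CauchyLemmas.lipschitz₁ x (λ n → ℚLemmas.inv (seq x n))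
  (λ m n → ℚLemmas.inv-dist (seq x m) (seq x n))

recip≈rec : ∀ x .(1≤x : 1ℝ ≤ x) → recip x 1≤x ≈ rec x
recip≈rec x 1≤x = pointwise-≈ λ n → refl

rec-nonNeg : ∀ x → 0ℝ ≤ rec x
rec-nonNeg x = pointwise-≤ λ n → ℚLemmas.inv-nonNeg (seq x n)

rec≤1 : ∀ x → rec x ≤ 1ℝ
rec≤1 x = pointwise-≤ λ n → ℚLemmas.inv-≤1 (seq x n)

*-rec : ∀ {x} → 1ℝ ≤ x → x * rec x ≈ 1ℝ
*-rec {x} 1≤x = ≈-trans (*-cong (≈-sym (y≤x⇒x⊔y≈x 1≤x)) ≈-refl)
  (pointwise-≈ λ n → ℚLemmas.inv-inverse (seq x n))

-- Total, so that no proofs of 1 ≤ x have to be carried along; it is 0 below 1.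
ln : ℝ → ℝ
ln x = log (x ⊔ 1ℝ) (y≤x⊔y x 1ℝ)

log≈ln : ∀ x .(1≤x : 1ℝ ≤ x) → log x 1≤x ≈ ln x
log≈ln x 1≤x = pointwise-≈ λ n → cong (λ p → + 2 ℚ./ 1 ℚ.* ℚLemmas.artanhSum n p)
  (cong (λ a → (a ℚ.- 1ℚ) ℚ.* ℚLemmas.inv (a ℚ.+ 1ℚ))
    (sym (trans (ℚP.⊔-assoc (seq x n) 1ℚ 1ℚ) (cong (seq x n ℚ.⊔_) (ℚP.⊔-idem 1ℚ)))))

-- The n-th terms satisfy `2artanhSum-≤` with the error z^(2n). From some index on z lies in [0,r]
-- for the r of `LogCauchy`, so the error is at most r^N. The maxima appear because the irrelevant
-- proofs cannot be turned into an equation between `x ⊔ 1ℝ` and x.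
log-diff-⊔ : ∀ x y .(1≤x : 1ℝ ≤ x) .(1≤y : 1ℝ ≤ y) →
  log y 1≤y - log x 1≤x ≤ ((y ⊔ 1ℝ) - (x ⊔ 1ℝ)) * rec x
log-diff-⊔ x y 1≤x 1≤y = mk≤ λ ε 0<ε → let N , r^N≤ε = ^-vanish ε 0<ε in
  B.from ℕ.⊔ N , λ n n≥ → ℚP.≤-trans (Möbius.Pair.2artanhSum-≤ (seq x n) (seq y n) n)
    (ℚP.+-monoʳ-≤ (seq (((y ⊔ 1ℝ) - (x ⊔ 1ℝ)) * rec x) n) (begin
      möb n ^ℚ (n ℕ.+ n)
        ≤⟨ ℚLemmas.^-mono (n ℕ.+ n) (L.0≤z n) (L.z≤r n (ℕP.m⊔n≤o⇒m≤o B.from N n≥)) ⟩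
      L.r ^ℚ (n ℕ.+ n)
        ≤⟨ ℚLemmas.^-drop n n L.0≤r L.r≤1 ⟩
      L.r ^ℚ n
        ≡⟨ cong (L.r ^ℚ_) (sym (ℕP.m∸n+n≡m (ℕP.m⊔n≤o⇒n≤o B.from N n≥))) ⟩
      L.r ^ℚ (n ℕ.∸ N ℕ.+ N)
        ≤⟨ ℚLemmas.^-drop (n ℕ.∸ N) N L.0≤r L.r≤1 ⟩
      L.r ^ℚ N
        ≤⟨ r^N≤ε ⟩
      ε ∎))
  where
  open ℚP.≤-Reasoning
  module L = LogCauchy y
  module B = CauchyLemmas.Bound (CauchyLemmas.bounded y)
  open ℚLemmas using () renaming (_^_ to _^ℚ_)
  open ℚLemmas.ArtanhBounds {L.r} {L.C} L.0≤r L.r≤1 L.0<C L.C-eq using (^-vanish)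
  möb : ℕ → ℚ
  möb n = ℚLemmas.möbius (seq y n)

-- Concavity of the logarithm: no order between x and y is assumed.
ln-diff : ∀ {x y} → 1ℝ ≤ x → 1ℝ ≤ y → ln y - ln x ≤ (y - x) * rec x
ln-diff {x} {y} 1≤x 1≤y = begin
  ln y - ln x                       ≈⟨ +-cong (log≈ln y 1≤y) (neg-cong (log≈ln x 1≤x)) ⟨
  log y 1≤y - log x 1≤x             ≤⟨ log-diff-⊔ x y 1≤x 1≤y ⟩
  ((y ⊔ 1ℝ) - (x ⊔ 1ℝ)) * rec x     ≈⟨ *-cong (+-cong (y≤x⇒x⊔y≈x 1≤y) (neg-cong (y≤x⇒x⊔y≈x 1≤x))) ≈-refl ⟩
  (y - x) * rec x                   ∎
  where open ℝR

-- For equal arguments the right side of the tangent inequality vanishes; used in both directions it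
-- bounds the difference of the logarithms by 0.
log-cong : ∀ {x y} .(1≤x : 1ℝ ≤ x) .(1≤y : 1ℝ ≤ y) → x ≈ y → log x 1≤x ≈ log y 1≤y
log-cong {x} {y} 1≤x 1≤y x≈y = ≤-antisym (half y x 1≤y 1≤x (≈-sym x≈y)) (half x y 1≤x 1≤y x≈y)
  where
  open ℝR
  half : ∀ x y .(1≤x : 1ℝ ≤ x) .(1≤y : 1ℝ ≤ y) → x ≈ y → log y 1≤y ≤ log x 1≤x
  half x y 1≤x 1≤y x≈y = 0≤y-x⇒x≤y (begin
    0ℝ                                          ≈⟨ solve 2 (λ a r → con 0ℚ := :- ((a :- a) :* r)) ≈-refl (y ⊔ 1ℝ) (rec x) ⟩
    - (((y ⊔ 1ℝ) - (y ⊔ 1ℝ)) * rec x)           ≈⟨ neg-cong (*-cong (+-cong ≈-refl (neg-cong (⊔-cong (≈-sym x≈y) ≈-refl))) ≈-refl) ⟩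
    - (((y ⊔ 1ℝ) - (x ⊔ 1ℝ)) * rec x)           ≤⟨ neg-antimono-≤ (log-diff-⊔ x y 1≤x 1≤y) ⟩
    - (log y 1≤y - log x 1≤x)                   ≈⟨ solve 2 (λ a b → :- (b :- a) := a :- b) ≈-refl (log x 1≤x) (log y 1≤y) ⟩
    log x 1≤x - log y 1≤y                       ∎)

ln-cong : ∀ {x y} → x ≈ y → ln x ≈ ln y
ln-cong {x} {y} x≈y = log-cong (y≤x⊔y x 1ℝ) (y≤x⊔y y 1ℝ) (⊔-cong x≈y ≈-refl)

rec-cong : ∀ {x y} → x ≈ y → rec x ≈ rec y
rec-cong {x} {y} (mk≈ h) = mk≈ λ ε 0<ε → eventually-map
  (λ n → ℚP.≤-trans (ℚLemmas.inv-dist (seq x n) (seq y n))) (h ε 0<ε)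

ln1≈0 : ln 1ℝ ≈ 0ℝ
ln1≈0 = pointwise-≈ λ n → trans (cong (+ 2 ℚ./ 1 ℚ.*_) (artanhSum0 n)) (ℚP.*-zeroʳ (+ 2 ℚ./ 1))
  where
  artanhSum0 : ∀ n → ℚLemmas.artanhSum n 0ℚ ≡ 0ℚ
  artanhSum0 zero    = refl
  artanhSum0 (suc n) = trans (cong₂ ℚ._+_ (artanhSum0 n)
    (trans (cong (+ 1 ℚ./ suc (n ℕ.+ n) ℚ.*_) (ℚP.*-zeroˡ (0ℚ ℚLemmas.^ (n ℕ.+ n)))) (ℚP.*-zeroʳ (+ 1 ℚ./ suc (n ℕ.+ n))))) refl

-- The tangent at x, evaluated at 1. Likewise `ln-mono-≤` evaluates the tangent at the larger point,
-- and `ln≤x-1` uses the tangent at 1.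
ln-nonNeg : ∀ {x} → 1ℝ ≤ x → 0ℝ ≤ ln x
ln-nonNeg {x} 1≤x = 0≤y-x⇒x≤y (begin
  0ℝ                          ≤⟨ *-nonNeg (0≤y-x 1≤x) (rec-nonNeg x) ⟩
  (x - 1ℝ) * rec x            ≈⟨ solve 2 (λ x r → (x :- con 1ℚ) :* r := :- ((con 1ℚ :- x) :* r)) ≈-refl x (rec x) ⟩
  - ((1ℝ - x) * rec x)        ≤⟨ neg-antimono-≤ (ln-diff 1≤x ≤-refl) ⟩
  - (ln 1ℝ - ln x)            ≈⟨ neg-cong (+-cong ln1≈0 ≈-refl) ⟩
  - (0ℝ - ln x)               ≈⟨ solve 1 (λ l → :- (con 0ℚ :- l) := l :- con 0ℚ) ≈-refl (ln x) ⟩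
  ln x - 0ℝ                   ∎)
  where open ℝR

ln-mono-≤ : ∀ {x y} → 1ℝ ≤ x → x ≤ y → ln x ≤ ln y
ln-mono-≤ {x} {y} 1≤x x≤y = 0≤y-x⇒x≤y (begin
  0ℝ                          ≤⟨ *-nonNeg (0≤y-x x≤y) (rec-nonNeg y) ⟩
  (y - x) * rec y             ≈⟨ solve 3 (λ x y r → (y :- x) :* r := :- ((x :- y) :* r)) ≈-refl x y (rec y) ⟩
  - ((x - y) * rec y)         ≤⟨ neg-antimono-≤ (ln-diff (≤-trans 1≤x x≤y) 1≤x) ⟩
  - (ln x - ln y)             ≈⟨ solve 2 (λ a b → :- (a :- b) := b :- a) ≈-refl (ln x) (ln y) ⟩
  ln y - ln x                 ∎)
  where open ℝR

ln≤x-1 : ∀ {x} → 1ℝ ≤ x → ln x ≤ x - 1ℝ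
ln≤x-1 {x} 1≤x = begin
  ln x                        ≈⟨ solve 1 (λ l → l := l :- con 0ℚ) ≈-refl (ln x) ⟩
  ln x - 0ℝ                   ≈⟨ +-cong ≈-refl (neg-cong ln1≈0) ⟨
  ln x - ln 1ℝ                ≤⟨ ln-diff ≤-refl 1≤x ⟩
  (x - 1ℝ) * rec 1ℝ           ≤⟨ *-monoˡ-≤ (0≤y-x 1≤x) (rec≤1 1ℝ) ⟩
  (x - 1ℝ) * 1ℝ               ≈⟨ solve 1 (λ x → (x :- con 1ℚ) :* con 1ℚ := x :- con 1ℚ) ≈-refl x ⟩
  x - 1ℝ                      ∎
  where open ℝR

-- Derivatives with a uniform quadratic error.

_∈[1,_] : ℝ → ℝ → Set
x ∈[1, b ] = 1ℝ ≤ x × x ≤ b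

-- The quadratic error makes Riemann sums of g approximate increments of G at a rate linear in the mesh.
record Derivative (b : ℝ) (G g : ℝ → ℝ) : Set where
  field
    ∣G∣ ∣g∣ lip quad : ℝ
    G-bound   : ∀ {x} → x ∈[1, b ] → ∣ G x ∣ ≤ ∣G∣
    g-bound   : ∀ {x} → x ∈[1, b ] → ∣ g x ∣ ≤ ∣g∣
    lipschitz : ∀ {x y} → x ∈[1, b ] → y ∈[1, b ] → ∣ G y - G x ∣ ≤ lip * ∣ y - x ∣
    quadratic : ∀ {x y} → x ∈[1, b ] → y ∈[1, b ] →
                ∣ G y - G x - g x * (y - x) ∣ ≤ quad * (∣ y - x ∣ * ∣ y - x ∣)

rec-diff : ∀ {x y} → 1ℝ ≤ x → 1ℝ ≤ y → rec x - rec y ≈ (y - x) * (rec x * rec y)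
rec-diff {x} {y} 1≤x 1≤y = begin-equality
  rec x - rec y
    ≈⟨ solve 2 (λ r s → r :- s := r :* con 1ℚ :- s :* con 1ℚ) ≈-refl (rec x) (rec y) ⟩
  rec x * 1ℝ - rec y * 1ℝ
    ≈⟨ +-cong (*-cong ≈-refl (*-rec 1≤y)) (neg-cong (*-cong ≈-refl (*-rec 1≤x))) ⟨
  rec x * (y * rec y) - rec y * (x * rec x)
    ≈⟨ solve 4 (λ x y r s → r :* (y :* s) :- s :* (x :* r) := (y :- x) :* (r :* s)) ≈-refl x y (rec x) (rec y) ⟩
  (y - x) * (rec x * rec y) ∎
  where open ℝR

∣rec∣≤1 : ∀ x → ∣ rec x ∣ ≤ 1ℝ
∣rec∣≤1 x = ≤-trans (≈⇒≤ (0≤x⇒∣x∣≈x (rec-nonNeg x))) (rec≤1 x)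

rec-lipschitz : ∀ x y → ∣ rec x - rec y ∣ ≤ ∣ y - x ∣
rec-lipschitz x y = ≤-trans (pointwise-≤ λ n → ℚLemmas.inv-dist (seq x n) (seq y n)) (≈⇒≤ (∣x-y∣≈∣y-x∣ x y))

ln-diff-≤ : ∀ {x y} → 1ℝ ≤ x → 1ℝ ≤ y → ln y - ln x ≤ ∣ y - x ∣
ln-diff-≤ {x} {y} 1≤x 1≤y = begin
  ln y - ln x               ≤⟨ ln-diff 1≤x 1≤y ⟩
  (y - x) * rec x           ≤⟨ x≤∣x∣ _ ⟩
  ∣ (y - x) * rec x ∣       ≤⟨ ∣∣-*-≤ ≤-refl (∣rec∣≤1 x) ⟩
  ∣ y - x ∣ * 1ℝ            ≈⟨ solve 1 (λ d → d :* con 1ℚ := d) ≈-refl ∣ y - x ∣ ⟩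
  ∣ y - x ∣                 ∎
  where open ℝR

D-rec : ∀ b → Derivative b rec (λ x → - (rec x * rec x))
D-rec b = record
  { ∣G∣ = 1ℝ ; ∣g∣ = 1ℝ * 1ℝ ; lip = 1ℝ ; quad = 1ℝ
  ; G-bound = λ {x} _ → ∣rec∣≤1 x
  ; g-bound = λ {x} _ → ≤-trans (≈⇒≤ (∣-x∣≈∣x∣ _)) (∣∣-*-≤ (∣rec∣≤1 x) (∣rec∣≤1 x))
  ; lipschitz = λ {x} {y} _ _ → ≤-trans (rec-lipschitz y x)
      (≈⇒≤ (≈-trans (∣x-y∣≈∣y-x∣ x y) (solve 1 (λ d → d := con 1ℚ :* d) ≈-refl _)))
  ; quadratic = λ {x} {y} (1≤x , _) (1≤y , _) → begin
      ∣ rec y - rec x - - (rec x * rec x) * (y - x) ∣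
        ≈⟨ ∣∣-cong (solve 3 (λ d r s → s :- r :- :- (r :* r) :* d := :- (r :- s) :+ r :* r :* d) ≈-refl (y - x) (rec x) (rec y)) ⟩
      ∣ - (rec x - rec y) + rec x * rec x * (y - x) ∣
        ≈⟨ ∣∣-cong (+-cong (neg-cong (rec-diff 1≤x 1≤y)) ≈-refl) ⟩
      ∣ - ((y - x) * (rec x * rec y)) + rec x * rec x * (y - x) ∣
        ≈⟨ ∣∣-cong (solve 3 (λ d r s → :- (d :* (r :* s)) :+ r :* r :* d := r :* (d :* (r :- s))) ≈-refl (y - x) (rec x) (rec y)) ⟩
      ∣ rec x * ((y - x) * (rec x - rec y)) ∣
        ≤⟨ ∣∣-*-≤ (∣rec∣≤1 x) (∣∣-*-≤ ≤-refl (rec-lipschitz x y)) ⟩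
      1ℝ * (∣ y - x ∣ * ∣ y - x ∣) ∎ }
  where open ℝR

-- The tangent at x bounds the error above by 0. The tangent at y bounds it below by -(y - x)(1/x -
-- 1/y), which is quadratic because the reciprocal is 1-Lipschitz. The bound b for the logarithm
-- comes from ln x ≤ x - 1.
D-ln : ∀ b → Derivative b ln rec
D-ln b = record
  { ∣G∣ = b ; ∣g∣ = 1ℝ ; lip = 1ℝ ; quad = 1ℝ
  ; G-bound = λ {x} (1≤x , x≤b) → ≤-trans (≈⇒≤ (0≤x⇒∣x∣≈x (ln-nonNeg 1≤x)))
      (≤-trans (ln≤x-1 1≤x) (≤-trans (≤-by 0≤1ℝ (solve 1 (λ x → x :- con 1ℚ :+ con 1ℚ := x) ≈-refl x)) x≤b))
  ; g-bound = λ {x} _ → ∣rec∣≤1 x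
  ; lipschitz = λ {x} {y} (1≤x , _) (1≤y , _) → ≤-trans
      (∣∣-lub (ln-diff-≤ 1≤x 1≤y) (begin
        - (ln y - ln x)   ≈⟨ solve 2 (λ a b → :- (b :- a) := a :- b) ≈-refl (ln x) (ln y) ⟩
        ln x - ln y       ≤⟨ ln-diff-≤ 1≤y 1≤x ⟩
        ∣ x - y ∣         ≈⟨ ∣x-y∣≈∣y-x∣ x y ⟩
        ∣ y - x ∣         ∎))
      (≈⇒≤ (solve 1 (λ d → d := con 1ℚ :* d) ≈-refl _))
  ; quadratic = λ {x} {y} (1≤x , _) (1≤y , _) → ≤-trans (∣∣-lub (begin
        ln y - ln x - rec x * (y - x)
          ≤⟨ +-mono-≤ (ln-diff 1≤x 1≤y) ≤-refl ⟩
        (y - x) * rec x - rec x * (y - x)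
          ≈⟨ solve 2 (λ d r → d :* r :- r :* d := con 0ℚ) ≈-refl (y - x) (rec x) ⟩
        0ℝ
          ≤⟨ *-nonNeg (0≤∣x∣ _) (0≤∣x∣ _) ⟩
        ∣ y - x ∣ * ∣ y - x ∣ ∎)
      (begin
        - (ln y - ln x - rec x * (y - x))
          ≈⟨ solve 3 (λ a b t → :- (b :- a :- t) := (a :- b) :+ t) ≈-refl (ln x) (ln y) (rec x * (y - x)) ⟩
        (ln x - ln y) + rec x * (y - x)
          ≤⟨ +-mono-≤ (ln-diff 1≤y 1≤x) ≤-refl ⟩
        (x - y) * rec y + rec x * (y - x)
          ≈⟨ solve 4 (λ x y r s → (x :- y) :* s :+ r :* (y :- x) := (y :- x) :* (r :- s)) ≈-refl x y (rec x) (rec y) ⟩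
        (y - x) * (rec x - rec y)
          ≤⟨ x≤∣x∣ _ ⟩
        ∣ (y - x) * (rec x - rec y) ∣
          ≤⟨ ∣∣-*-≤ ≤-refl (rec-lipschitz x y) ⟩
        ∣ y - x ∣ * ∣ y - x ∣ ∎))
      (≈⇒≤ (solve 1 (λ d → d := con 1ℚ :* d) ≈-refl _)) }
  where open ℝR

D-const : ∀ b c → Derivative b (λ _ → c) (λ _ → 0ℝ)
D-const b c = record
  { ∣G∣ = ∣ c ∣ ; ∣g∣ = 0ℝ ; lip = 0ℝ ; quad = 0ℝ
  ; G-bound = λ _ → ≤-refl
  ; g-bound = λ _ → pointwise-≤ λ _ → ℚP.≤-refl
  ; lipschitz = λ {x} {y} _ _ → ≤-trans (≈⇒≤ (∣∣-cong (solve 1 (λ c → c :- c := con 0ℚ) ≈-refl c)))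
      (≤-trans (≈⇒≤ (0≤x⇒∣x∣≈x ≤-refl)) (≈⇒≤ (solve 1 (λ d → con 0ℚ := con 0ℚ :* d) ≈-refl ∣ y - x ∣)))
  ; quadratic = λ {x} {y} _ _ → ≤-trans (≈⇒≤ (∣∣-cong (solve 2 (λ c d → c :- c :- con 0ℚ :* d := con 0ℚ) ≈-refl c (y - x))))
      (≤-trans (≈⇒≤ (0≤x⇒∣x∣≈x ≤-refl)) (≈⇒≤ (solve 1 (λ d → con 0ℚ := con 0ℚ :* (d :* d)) ≈-refl ∣ y - x ∣))) }

D-+ : ∀ {b G g H h} → Derivative b G g → Derivative b H h →
      Derivative b (λ x → G x + H x) (λ x → g x + h x)
D-+ {b} {G} {g} {H} {h} 𝒢 ℋ = record
  { ∣G∣ = ∣G∣ 𝒢 + ∣G∣ ℋ ; ∣g∣ = ∣g∣ 𝒢 + ∣g∣ ℋ ; lip = lip 𝒢 + lip ℋ ; quad = quad 𝒢 + quad ℋ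
  ; G-bound = λ x∈ → ∣∣-+-≤ ≈-refl (G-bound 𝒢 x∈) (G-bound ℋ x∈)
  ; g-bound = λ x∈ → ∣∣-+-≤ ≈-refl (g-bound 𝒢 x∈) (g-bound ℋ x∈)
  ; lipschitz = λ {x} {y} x∈ y∈ → ≤-trans (∣∣-+-≤
      (solve 4 (λ a b c d → (a :- b) :+ (c :- d) := a :+ c :- (b :+ d)) ≈-refl (G y) (G x) (H y) (H x))
      (lipschitz 𝒢 x∈ y∈) (lipschitz ℋ x∈ y∈))
      (≈⇒≤ (solve 3 (λ a b d → a :* d :+ b :* d := (a :+ b) :* d) ≈-refl (lip 𝒢) (lip ℋ) ∣ y - x ∣))
  ; quadratic = λ {x} {y} x∈ y∈ → ≤-trans (∣∣-+-≤
      (solve 7 (λ a b c d g h e → (a :- b :- g :* e) :+ (c :- d :- h :* e) := a :+ c :- (b :+ d) :- (g :+ h) :* e) ≈-refl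
        (G y) (G x) (H y) (H x) (g x) (h x) (y - x))
      (quadratic 𝒢 x∈ y∈) (quadratic ℋ x∈ y∈))
      (≈⇒≤ (solve 3 (λ a b d → a :* d :+ b :* d := (a :+ b) :* d) ≈-refl (quad 𝒢) (quad ℋ) (∣ y - x ∣ * ∣ y - x ∣))) }
  where open Derivative

-- The error of a product splits into the error of G times H, G times the error of H, and the
-- product of both increments. The last part is quadratic by the Lipschitz bounds, which is why
-- `Derivative` records them.
D-* : ∀ {b G g H h} → Derivative b G g → Derivative b H h →
      Derivative b (λ x → G x * H x) (λ x → g x * H x + G x * h x)
D-* {b} {G} {g} {H} {h} 𝒢 ℋ = record
  { ∣G∣ = ∣G∣ 𝒢 * ∣G∣ ℋ
  ; ∣g∣ = ∣g∣ 𝒢 * ∣G∣ ℋ + ∣G∣ 𝒢 * ∣g∣ ℋ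
  ; lip = lip 𝒢 * ∣G∣ ℋ + ∣G∣ 𝒢 * lip ℋ
  ; quad = (quad 𝒢 * ∣G∣ ℋ + ∣G∣ 𝒢 * quad ℋ) + lip 𝒢 * lip ℋ
  ; G-bound = λ x∈ → ∣∣-*-≤ (G-bound 𝒢 x∈) (G-bound ℋ x∈)
  ; g-bound = λ x∈ → ∣∣-+-≤ ≈-refl (∣∣-*-≤ (g-bound 𝒢 x∈) (G-bound ℋ x∈)) (∣∣-*-≤ (G-bound 𝒢 x∈) (g-bound ℋ x∈))
  ; lipschitz = λ {x} {y} x∈ y∈ → ≤-trans (∣∣-+-≤
      (solve 4 (λ a b c d → (a :- b) :* c :+ b :* (c :- d) := a :* c :- b :* d) ≈-refl (G y) (G x) (H y) (H x))
      (∣∣-*-≤ (lipschitz 𝒢 x∈ y∈) (G-bound ℋ y∈)) (∣∣-*-≤ (G-bound 𝒢 x∈) (lipschitz ℋ x∈ y∈)))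
      (≈⇒≤ (solve 5 (λ L A M B d → L :* d :* B :+ A :* (M :* d) := (L :* B :+ A :* M) :* d) ≈-refl
        (lip 𝒢) (∣G∣ 𝒢) (lip ℋ) (∣G∣ ℋ) ∣ y - x ∣))
  ; quadratic = λ {x} {y} x∈ y∈ → ≤-trans (∣∣-+-≤
      (solve 7 (λ a b c d g h e → ((a :- b :- g :* e) :* d :+ b :* (c :- d :- h :* e)) :+ (a :- b) :* (c :- d)
          := a :* c :- b :* d :- (g :* d :+ b :* h) :* e) ≈-refl
        (G y) (G x) (H y) (H x) (g x) (h x) (y - x))
      (∣∣-+-≤ ≈-refl (∣∣-*-≤ (quadratic 𝒢 x∈ y∈) (G-bound ℋ x∈)) (∣∣-*-≤ (G-bound 𝒢 x∈) (quadratic ℋ x∈ y∈)))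
      (∣∣-*-≤ (lipschitz 𝒢 x∈ y∈) (lipschitz ℋ x∈ y∈)))
      (≈⇒≤ (solve 7 (λ Q A R B L M d → Q :* (d :* d) :* B :+ A :* (R :* (d :* d)) :+ L :* d :* (M :* d)
          := (Q :* B :+ A :* R :+ L :* M) :* (d :* d)) ≈-refl
        (quad 𝒢) (∣G∣ 𝒢) (quad ℋ) (∣G∣ ℋ) (lip 𝒢) (lip ℋ) ∣ y - x ∣)) }
  where open Derivative

D-cong : ∀ {b G g g′} → (∀ {x} → 1ℝ ≤ x → g x ≈ g′ x) → Derivative b G g → Derivative b G g′
D-cong {b} {G} {g} {g′} e 𝒢 = record
  { ∣G∣ = ∣G∣ 𝒢 ; ∣g∣ = ∣g∣ 𝒢 ; lip = lip 𝒢 ; quad = quad 𝒢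
  ; G-bound = G-bound 𝒢
  ; g-bound = λ x∈ → ≤-trans (≈⇒≤ (∣∣-cong (≈-sym (e (proj₁ x∈))))) (g-bound 𝒢 x∈)
  ; lipschitz = lipschitz 𝒢
  ; quadratic = λ {x} {y} x∈ y∈ → ≤-trans
      (≈⇒≤ (∣∣-cong (+-cong ≈-refl (neg-cong (*-cong (≈-sym (e (proj₁ x∈))) ≈-refl))))) (quadratic 𝒢 x∈ y∈) }
  where open Derivative

dpow : ℕ → ℝ → ℝ
dpow zero    u = 0ℝ
dpow (suc k) u = fromℤ (+ suc k) * u ^ k

dpow-suc : ∀ k u → u ^ k + u * dpow k u ≈ dpow (suc k) u
dpow-suc zero u = solve 1 (λ u → con 1ℚ :+ u :* con 0ℚ := con 1ℚ :* con 1ℚ) ≈-refl u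
dpow-suc (suc k) u = ≈-trans
  (solve 3 (λ u p m → u :* p :+ u :* (m :* p) := (m :+ con 1ℚ) :* (u :* p)) ≈-refl u (u ^ k) (fromℤ (+ suc k)))
  (*-cong (≈-sym (fromℤ-suc (suc k))) ≈-refl)

D-ln^ : ∀ b k → Derivative b (λ x → ln x ^ k) (λ x → rec x * dpow k (ln x))
D-ln^ b zero    = D-cong (λ {x} _ → solve 1 (λ r → con 0ℚ := r :* con 0ℚ) ≈-refl (rec x)) (D-const b 1ℝ)
D-ln^ b (suc k) = D-cong (λ {x} _ → ≈-trans
  (solve 4 (λ r l p d → r :* p :+ l :* (r :* d) := r :* (p :+ l :* d)) ≈-refl (rec x) (ln x) (ln x ^ k) (dpow k (ln x)))
  (*-cong ≈-refl (dpow-suc k (ln x)))) (D-* (D-ln b) (D-ln^ b k))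

-- For f = V k = log^k x / x and V k′ = v k, the function U k is an antiderivative of x v k.
V v U : ℕ → ℝ → ℝ
V k x = rec x * ln x ^ k
v k x = rec x ^ 2 * (dpow k (ln x) - ln x ^ k)
U k x = ln x ^ k + ln x ^ suc k * - fromℚ (+ 1 ℚ./ suc k)

D-V : ∀ b k → Derivative b (V k) (v k)
D-V b k = D-cong
  (λ {x} _ → solve 3 (λ r u d → :- (r :* r) :* u :+ r :* (r :* d) := r :* (r :* con 1ℚ) :* (d :- u)) ≈-refl (rec x) (ln x ^ k) (dpow k (ln x)))
  (D-* (D-rec b) (D-ln^ b k))

suc*1/suc : ∀ k → fromℤ (+ suc k) * fromℚ (+ 1 ℚ./ suc k) ≈ 1ℝ
suc*1/suc k = pointwise-≈ λ _ → ℚLemmas./1-inverse k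

-- Differentiating log^(k+1) cancels the factor 1/(k + 1) and leaves (d - u)/x, with u = log^k x and
-- d = `dpow k (ln x)`. Inserting x · (1/x) = 1 exhibits the factor x of x v(x).
D-U : ∀ b k → Derivative b (U k) (λ x → x * v k x)
D-U b k = D-cong (λ {x} → e x)
  (D-+ (D-ln^ b k) (D-* (D-ln^ b (suc k)) (D-const b (- fromℚ (+ 1 ℚ./ suc k)))))
  where
  open ℝR
  e : ∀ x → 1ℝ ≤ x → rec x * dpow k (ln x) + (rec x * dpow (suc k) (ln x) * - fromℚ (+ 1 ℚ./ suc k) + ln x ^ suc k * 0ℝ) ≈ x * v k x
  e x 1≤x = begin-equality
    r * d + (r * (fromℤ (+ suc k) * u) * - q + w * 0ℝ)
      ≈⟨ solve 6 (λ r d m u q w → r :* d :+ (r :* (m :* u) :* :- q :+ w :* con 0ℚ) := con 1ℚ :* r :* d :- r :* u :* (m :* q)) ≈-refl r d (fromℤ (+ suc k)) u q w ⟩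
    1ℝ * r * d - r * u * (fromℤ (+ suc k) * q)
      ≈⟨ +-cong (*-cong (*-cong (≈-sym (*-rec 1≤x)) ≈-refl) ≈-refl) (neg-cong (*-cong ≈-refl (≈-trans (suc*1/suc k) (≈-sym (*-rec 1≤x))))) ⟩
    x * r * r * d - r * u * (x * r)
      ≈⟨ solve 4 (λ x r d u → x :* r :* r :* d :- r :* u :* (x :* r) := x :* (r :* (r :* con 1ℚ) :* (d :- u))) ≈-refl x r d u ⟩
    x * v k x ∎
    where
    r = rec x
    d = dpow k (ln x)
    u = ln x ^ k
    w = ln x ^ suc k
    q = fromℚ (+ 1 ℚ./ suc k)

-- Riemann sums and their distance from increments of a primitive.

Weight : Set
Weight = (t : ℝ) → 1ℝ ≤ t × Floor t → ℝ

fn : Weight → PartialFn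
Dom   (fn w) t = 1ℝ ≤ t × Floor t
apply (fn w) = w

-- A partition tagged for f serves here for any other function on the domain of f, so an integrand
-- can be decomposed while the partition stays fixed.
sum : ∀ {f δ b a} → ((t : ℝ) → Dom f t → ℝ) → TaggedPartition f δ b a → ℝ
sum w (done _) = 0ℝ
sum {a = a} w (step t c _ _ _ d P) = w t d * (c - a) + sum w P

partition-≤ : ∀ {f δ b a} → TaggedPartition f δ b a → a ≤ b
partition-≤ (done a≈b) = ≈⇒≤ a≈b
partition-≤ (step t c a≤t t≤c _ _ P) = ≤-trans a≤t (≤-trans t≤c (partition-≤ P))

riemannSum≈sum : ∀ {f δ b a} (P : TaggedPartition f δ b a) → riemannSum P ≈ sum (apply f) P
riemannSum≈sum (done _) = ≈-refl
riemannSum≈sum (step t c _ _ _ d P) = +-cong ≈-refl (riemannSum≈sum P)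

sum-cong : ∀ {f δ b a} {w w′ : (t : ℝ) → Dom f t → ℝ} → (∀ t d → t ≤ b → w t d ≈ w′ t d) →
  (P : TaggedPartition f δ b a) → sum w P ≈ sum w′ P
sum-cong e (done _) = ≈-refl
sum-cong e (step t c _ t≤c _ d P) = +-cong (*-cong (e t d (≤-trans t≤c (partition-≤ P))) ≈-refl) (sum-cong e P)

sum-linear : ∀ {f δ b a} (p q : ℝ) (w w′ : (t : ℝ) → Dom f t → ℝ) (P : TaggedPartition f δ b a) →
  sum (λ t d → p * w t d + q * w′ t d) P ≈ p * sum w P + q * sum w′ P
sum-linear p q w w′ (done _) = solve 2 (λ p q → con 0ℚ := p :* con 0ℚ :+ q :* con 0ℚ) ≈-refl p q
sum-linear {a = a} p q w w′ (step t c _ _ _ d P) = ≈-trans (+-cong ≈-refl (sum-linear p q w w′ P))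
  (solve 7 (λ p q x y e s u → (p :* x :+ q :* y) :* e :+ (p :* s :+ q :* u) := p :* (x :* e :+ s) :+ q :* (y :* e :+ u))
    ≈-refl p q (w t d) (w′ t d) (c - a) (sum w P) (sum w′ P))

sum-∑ : ∀ {f δ b a} n (w : ℕ → (t : ℝ) → Dom f t → ℝ) (P : TaggedPartition f δ b a) →
  sum (λ t d → ∑ n (λ j → w j t d)) P ≈ ∑ n (λ j → sum (w j) P)
sum-∑ zero    w P = zeros P
  where
  zeros : ∀ {f δ b a} (P : TaggedPartition f δ b a) → sum (λ t d → 0ℝ) P ≈ 0ℝ
  zeros (done _) = ≈-refl
  zeros {a = a} (step t c _ _ _ d P) = ≈-trans (+-cong ≈-refl (zeros P))
    (solve 1 (λ e → con 0ℚ :* e :+ con 0ℚ := con 0ℚ) ≈-refl (c - a))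
sum-∑ (suc n) w P = begin-equality
  sum (λ t d → ∑ n (λ j → w j t d) + w n t d) P
    ≈⟨ sum-cong (λ t d _ → solve 2 (λ a b → a :+ b := con 1ℚ :* a :+ con 1ℚ :* b) ≈-refl (∑ n (λ j → w j t d)) (w n t d)) P ⟩
  sum (λ t d → 1ℝ * ∑ n (λ j → w j t d) + 1ℝ * w n t d) P
    ≈⟨ sum-linear 1ℝ 1ℝ _ _ P ⟩
  1ℝ * sum (λ t d → ∑ n (λ j → w j t d)) P + 1ℝ * sum (w n) P
    ≈⟨ solve 2 (λ a b → con 1ℚ :* a :+ con 1ℚ :* b := a :+ b) ≈-refl _ _ ⟩
  sum (λ t d → ∑ n (λ j → w j t d)) P + sum (w n) P
    ≈⟨ +-cong (sum-∑ n w P) ≈-refl ⟩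
  ∑ n (λ j → sum (w j) P) + sum (w n) P ∎
  where open ℝR

module RiemannError {B : ℝ} {G g : ℝ → ℝ} (𝒢 : Derivative B G g) where
  open Derivative 𝒢
  open ℝR

  -- Absolute values are taken because the constants of a `Derivative` are not assumed to be
  -- nonnegative.
  κ λ′ μ C : ℝ
  κ = ∣ quad ∣
  λ′ = ∣ lip ∣
  μ = ∣ ∣g∣ ∣
  C = μ + λ′

  -- G is any function on representatives; that it respects ≈ has to be extracted from its Lipschitz
  -- bound.
  G-cong : ∀ {x y} → x ∈[1, B ] → y ∈[1, B ] → x ≈ y → G y - G x ≈ 0ℝ
  G-cong {x} {y} x∈ y∈ x≈y = ∣x∣≤0⇒x≈0 (begin
    ∣ G y - G x ∣       ≤⟨ lipschitz x∈ y∈ ⟩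
    lip * ∣ y - x ∣     ≈⟨ *-cong ≈-refl (∣∣-cong (+-cong (≈-sym x≈y) ≈-refl)) ⟩
    lip * ∣ x - x ∣     ≈⟨ *-cong ≈-refl (≈-trans (∣∣-cong (solve 1 (λ x → x :- x := con 0ℚ) ≈-refl x)) (0≤x⇒∣x∣≈x ≤-refl)) ⟩
    lip * 0ℝ            ≈⟨ solve 1 (λ l → l :* con 0ℚ := con 0ℚ) ≈-refl lip ⟩
    0ℝ                  ∎)

  -- Both endpoints are expanded about the tag. The squares (c - t)² and (t - a)² add up to at most
  -- (c - a)², of which one factor is bounded by the mesh and the other is kept for telescoping.
  tag-error : ∀ {a t c δ} → 1ℝ ≤ a → a ≤ t → t ≤ c → c ≤ B → c - a ≤ δ →
    ∣ g t * (c - a) - (G c - G a) ∣ ≤ κ * δ * (c - a)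
  tag-error {a} {t} {c} {δ} 1≤a a≤t t≤c c≤B mesh = begin
    ∣ g t * (c - a) - (G c - G a) ∣
      ≤⟨ ∣∣-+-≤ (solve 7 (λ g a t c A T K → :- (K :- T :- g :* (c :- t)) :+ (A :- T :- g :* (a :- t)) := g :* (c :- a) :- (K :- A)) ≈-refl
           (g t) a t c (G a) (G t) (G c))
         (≤-trans (≈⇒≤ (∣-x∣≈∣x∣ _)) (quadratic t∈ c∈)) (quadratic t∈ a∈) ⟩
    quad * (∣ c - t ∣ * ∣ c - t ∣) + quad * (∣ a - t ∣ * ∣ a - t ∣)
      ≈⟨ +-cong (*-cong ≈-refl (*-cong c-t c-t)) (*-cong ≈-refl (*-cong t-a t-a)) ⟩
    quad * ((c - t) * (c - t)) + quad * ((t - a) * (t - a))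
      ≈⟨ solve 4 (λ q a t c → q :* ((c :- t) :* (c :- t)) :+ q :* ((t :- a) :* (t :- a)) := q :* ((c :- t) :* (c :- t) :+ (t :- a) :* (t :- a))) ≈-refl quad a t c ⟩
    quad * ((c - t) * (c - t) + (t - a) * (t - a))
      ≤⟨ *-monoʳ-≤ (+-nonNeg (square-nonNeg (c - t)) (square-nonNeg (t - a))) (x≤∣x∣ quad) ⟩
    κ * ((c - t) * (c - t) + (t - a) * (t - a))
      ≤⟨ *-monoˡ-≤ (0≤∣x∣ quad) (≤-by (+-nonNeg 0≤p 0≤p)
           (solve 3 (λ a t c → (c :- t) :* (c :- t) :+ (t :- a) :* (t :- a) :+ ((c :- t) :* (t :- a) :+ (c :- t) :* (t :- a)) := (c :- a) :* (c :- a)) ≈-refl a t c)) ⟩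
    κ * ((c - a) * (c - a))
      ≤⟨ *-monoˡ-≤ (0≤∣x∣ quad) (*-monoʳ-≤ (0≤y-x (≤-trans a≤t t≤c)) mesh) ⟩
    κ * (δ * (c - a))
      ≈⟨ solve 3 (λ k d e → k :* (d :* e) := k :* d :* e) ≈-refl κ δ (c - a) ⟩
    κ * δ * (c - a) ∎
    where
    1≤t = ≤-trans 1≤a a≤t
    1≤c = ≤-trans 1≤t t≤c
    t∈ : t ∈[1, B ]
    t∈ = 1≤t , ≤-trans t≤c c≤B
    c∈ : c ∈[1, B ]
    c∈ = 1≤c , c≤B
    a∈ : a ∈[1, B ]
    a∈ = 1≤a , ≤-trans a≤t (proj₂ t∈)
    0≤p : 0ℝ ≤ (c - t) * (t - a)
    0≤p = *-nonNeg (0≤y-x t≤c) (0≤y-x a≤t)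
    c-t : ∣ c - t ∣ ≈ c - t
    c-t = 0≤x⇒∣x∣≈x (0≤y-x t≤c)
    t-a : ∣ a - t ∣ ≈ t - a
    t-a = ≈-trans (∣x-y∣≈∣y-x∣ a t) (0≤x⇒∣x∣≈x (0≤y-x a≤t))

  -- The errors of the steps add up along the lengths c - a. Agreement of w with g is asked only for
  -- tags beyond a, so that the bound applies to the rest of a partition after a jump.
  smooth-error : ∀ {f δ b a} {w : (t : ℝ) → Dom f t → ℝ} → 1ℝ ≤ a → b ≤ B →
    (∀ t d → a ≤ t → w t d ≈ g t) → (P : TaggedPartition f δ b a) →
    ∣ sum w P - (G b - G a) ∣ ≤ κ * fromℚ δ * (b - a)
  smooth-error {δ = δ} {b} {a} 1≤a b≤B e (done a≈b) = ≈⇒≤ (begin-equality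
    ∣ 0ℝ - (G b - G a) ∣
      ≈⟨ ∣∣-cong (+-cong ≈-refl (neg-cong (G-cong (1≤a , ≤-trans (≈⇒≤ a≈b) b≤B) (≤-trans 1≤a (≈⇒≤ a≈b) , b≤B) a≈b))) ⟩
    ∣ 0ℝ - 0ℝ ∣                  ≈⟨ ∣∣-cong (solve 0 (con 0ℚ :- con 0ℚ := con 0ℚ) ≈-refl) ⟩
    ∣ 0ℝ ∣                       ≈⟨ 0≤x⇒∣x∣≈x ≤-refl ⟩
    0ℝ                           ≈⟨ solve 2 (λ k b → con 0ℚ := k :* (b :- b)) ≈-refl (κ * fromℚ δ) b ⟩
    κ * fromℚ δ * (b - b)        ≈⟨ *-cong ≈-refl (+-cong ≈-refl (neg-cong (≈-sym a≈b))) ⟩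
    κ * fromℚ δ * (b - a)        ∎)
  smooth-error {δ = δ} {b} {a} {w} 1≤a b≤B e (step t c a≤t t≤c mesh d P) = begin
    ∣ w t d * (c - a) + sum w P - (G b - G a) ∣
      ≈⟨ ∣∣-cong (+-cong (+-cong (*-cong (e t d a≤t) ≈-refl) ≈-refl) ≈-refl) ⟩
    ∣ g t * (c - a) + sum w P - (G b - G a) ∣
      ≤⟨ ∣∣-+-≤ (solve 5 (λ x s K A T → (x :- (K :- A)) :+ (s :- (T :- K)) := x :+ s :- (T :- A)) ≈-refl
           (g t * (c - a)) (sum w P) (G c) (G a) (G b))
         (tag-error 1≤a a≤t t≤c (≤-trans (partition-≤ P) b≤B) mesh)
         (smooth-error (≤-trans 1≤a a≤c) b≤B (λ t d c≤t → e t d (≤-trans a≤c c≤t)) P) ⟩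
    κ * fromℚ δ * (c - a) + κ * fromℚ δ * (b - c)
      ≈⟨ solve 4 (λ k a b c → k :* (c :- a) :+ k :* (b :- c) := k :* (b :- a)) ≈-refl (κ * fromℚ δ) a b c ⟩
    κ * fromℚ δ * (b - a) ∎
    where a≤c = ≤-trans a≤t t≤c

  ⊔-∈ : ∀ {x p} → 1ℝ ≤ x → x ≤ B → p ≤ B → (x ⊔ p) ∈[1, B ]
  ⊔-∈ {x} {p} 1≤x x≤B p≤B = ≤-trans 1≤x (x≤x⊔y x p) , ⊔-lub x≤B p≤B

  ⊔-increment : ∀ {a c} p → a ≤ c → ∣ (c ⊔ p) - (a ⊔ p) ∣ ≤ c - a
  ⊔-increment {a} {c} p a≤c = ∣∣-lub (≤-by (0≤y-x le) (solve 4 (λ x y a c → x :- y :+ (y :+ (c :- a) :- x) := c :- a) ≈-refl (c ⊔ p) (a ⊔ p) a c))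
    (≤-by (+-nonNeg (0≤y-x ge) (0≤y-x a≤c)) (solve 3 (λ x y d → :- (x :- y) :+ (x :- y :+ d) := d) ≈-refl (c ⊔ p) (a ⊔ p) (c - a)))
    where
    ge : a ⊔ p ≤ c ⊔ p
    ge = ⊔-lub (≤-trans a≤c (x≤x⊔y c p)) (y≤x⊔y c p)
    le : c ⊔ p ≤ (a ⊔ p) + (c - a)
    le = ⊔-lub (≤-by (0≤y-x (x≤x⊔y a p)) (solve 3 (λ a c m → c :+ (m :- a) := m :+ (c :- a)) ≈-refl a c (a ⊔ p)))
      (≤-by (+-nonNeg (0≤y-x (y≤x⊔y a p)) (0≤y-x a≤c)) (solve 3 (λ p d m → p :+ (m :- p :+ d) := m :+ d) ≈-refl p (c - a) (a ⊔ p)))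

  -- At most one subinterval has the jump p in its interior; it contributes the term C δ.
  jump-error : ∀ {f δ b a p} {w : (t : ℝ) → Dom f t → ℝ} → 0ℚ ℚ.≤ δ → 1ℝ ≤ a → b ≤ B → p ≤ B →
    (∀ t d → (p ≤ t × w t d ≈ g t) ⊎ (¬ p ≤ t × w t d ≈ 0ℝ)) → (P : TaggedPartition f δ b a) →
    ∣ sum w P - (G (b ⊔ p) - G (a ⊔ p)) ∣ ≤ κ * fromℚ δ * (b - a) + C * fromℚ δ
  jump-error {δ = δ} {b} {a} {p} {w} 0≤δ 1≤a b≤B p≤B h = go 1≤a
    where
    0≤κδ : 0ℝ ≤ κ * fromℚ δ
    0≤κδ = *-nonNeg (0≤∣x∣ quad) (fromℚ-mono-≤ 0≤δ)
    0≤C : 0ℝ ≤ C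
    0≤C = +-nonNeg (0≤∣x∣ _) (0≤∣x∣ _)

    G⊔-cong : ∀ {x y} → 1ℝ ≤ x → x ≤ B → 1ℝ ≤ y → y ≤ B → x ⊔ p ≈ y ⊔ p → G (y ⊔ p) - G (x ⊔ p) ≈ 0ℝ
    G⊔-cong 1≤x x≤B 1≤y y≤B = G-cong (⊔-∈ 1≤x x≤B p≤B) (⊔-∈ 1≤y y≤B p≤B)

    past : ∀ {a} → 1ℝ ≤ a → p ≤ a → (P : TaggedPartition _ δ b a) →
      ∣ sum w P - (G (b ⊔ p) - G (a ⊔ p)) ∣ ≤ κ * fromℚ δ * (b - a)
    past {a} 1≤a p≤a P = ≤-trans (≈⇒≤ (∣∣-cong (≈-sym (begin-equality
        sum w P - (G b - G a)
          ≈⟨ solve 3 (λ s x y → s :- (x :- y) := s :- (x :- y) :- con 0ℚ :+ con 0ℚ) ≈-refl (sum w P) (G b) (G a) ⟩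
        sum w P - (G b - G a) - 0ℝ + 0ℝ
          ≈⟨ +-cong (+-cong ≈-refl (neg-cong (≈-sym (shift b 1≤b b≤B p≤b)))) (≈-sym (shift a 1≤a a≤B p≤a)) ⟩
        sum w P - (G b - G a) - (G (b ⊔ p) - G b) + (G (a ⊔ p) - G a)
          ≈⟨ solve 5 (λ s x y x′ y′ → s :- (x :- y) :- (x′ :- x) :+ (y′ :- y) := s :- (x′ :- y′)) ≈-refl (sum w P) (G b) (G a) (G (b ⊔ p)) (G (a ⊔ p)) ⟩
        sum w P - (G (b ⊔ p) - G (a ⊔ p)) ∎))))
      (smooth-error 1≤a b≤B beyond P)
      where
      a≤b = partition-≤ P
      1≤b = ≤-trans 1≤a a≤b
      a≤B = ≤-trans a≤b b≤B
      p≤b = ≤-trans p≤a a≤b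
      shift : ∀ x → 1ℝ ≤ x → x ≤ B → p ≤ x → G (x ⊔ p) - G x ≈ 0ℝ
      shift x 1≤x x≤B p≤x = G-cong (1≤x , x≤B) (⊔-∈ 1≤x x≤B p≤B) (≈-sym (y≤x⇒x⊔y≈x p≤x))
      beyond : ∀ t d → a ≤ t → w t d ≈ g t
      beyond t d a≤t = [ proj₂ , (λ (p≰t , _) → ⊥-elim (p≰t (≤-trans p≤a a≤t))) ]′ (h t d)

    w-bound : ∀ t d → 1ℝ ≤ t → t ≤ B → ∣ w t d ∣ ≤ μ
    w-bound t d 1≤t t≤B = [ (λ (_ , e) → ≤-trans (≈⇒≤ (∣∣-cong e)) (≤-trans (g-bound (1≤t , t≤B)) (x≤∣x∣ ∣g∣)))
                          , (λ (_ , e) → ≤-trans (≈⇒≤ (≈-trans (∣∣-cong e) (0≤x⇒∣x∣≈x ≤-refl))) (0≤∣x∣ ∣g∣)) ]′ (h t d)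

    go : ∀ {a} → 1ℝ ≤ a → (P : TaggedPartition _ δ b a) →
      ∣ sum w P - (G (b ⊔ p) - G (a ⊔ p)) ∣ ≤ κ * fromℚ δ * (b - a) + C * fromℚ δ
    go {a} 1≤a (done a≈b) = begin
      ∣ 0ℝ - (G (b ⊔ p) - G (a ⊔ p)) ∣
        ≈⟨ ∣∣-cong (+-cong ≈-refl (neg-cong (G⊔-cong 1≤a (≤-trans (≈⇒≤ a≈b) b≤B) (≤-trans 1≤a (≈⇒≤ a≈b)) b≤B
             (≤-antisym (⊔-lub (≤-trans (≈⇒≤ a≈b) (x≤x⊔y b p)) (y≤x⊔y b p)) (⊔-lub (≤-trans (≈⇒≥ a≈b) (x≤x⊔y a p)) (y≤x⊔y a p)))))) ⟩
      ∣ 0ℝ - 0ℝ ∣                  ≈⟨ ∣∣-cong (solve 0 (con 0ℚ :- con 0ℚ := con 0ℚ) ≈-refl) ⟩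
      ∣ 0ℝ ∣                       ≈⟨ 0≤x⇒∣x∣≈x ≤-refl ⟩
      0ℝ                           ≤⟨ +-nonNeg (*-nonNeg 0≤κδ (0≤y-x (≈⇒≤ a≈b))) (*-nonNeg 0≤C (fromℚ-mono-≤ 0≤δ)) ⟩
      κ * fromℚ δ * (b - a) + C * fromℚ δ ∎
    -- If c ≤ p, the tag settles the matter: p ≤ t forces p ≤ c as well, and otherwise the weight is
    -- 0 while both maxima with p equal p.
    go {a} 1≤a (step t c a≤t t≤c mesh d P) = ≤-by-cases p c across (λ c≤p →
        [ (λ (p≤t , _) → across (≤-trans p≤t t≤c)) , (λ (_ , w≈0) → before c≤p w≈0) ]′ (h t d))
      where
      a≤c = ≤-trans a≤t t≤c
      1≤c = ≤-trans 1≤a a≤c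
      c≤B = ≤-trans (partition-≤ P) b≤B
      a≤B = ≤-trans a≤c c≤B
      ∣c-a∣≤δ : ∣ c - a ∣ ≤ fromℚ δ
      ∣c-a∣≤δ = ≤-trans (≈⇒≤ (0≤x⇒∣x∣≈x (0≤y-x a≤c))) mesh
      -- The step that reaches p is bounded crudely, by μδ for the weighted term and by λ′δ for the
      -- increment of G. Everything after it is smooth.
      across : p ≤ c → _
      across p≤c = begin
        ∣ w t d * (c - a) + sum w P - (G (b ⊔ p) - G (a ⊔ p)) ∣
          ≤⟨ ∣∣-+-≤ (solve 5 (λ x s K A T → (x :+ :- (K :- A)) :+ (s :- (T :- K)) := x :+ s :- (T :- A)) ≈-refl
               (w t d * (c - a)) (sum w P) (G (c ⊔ p)) (G (a ⊔ p)) (G (b ⊔ p)))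
             (∣∣-+-≤ ≈-refl (∣∣-*-≤ (w-bound t d (≤-trans 1≤a a≤t) (≤-trans t≤c c≤B)) ∣c-a∣≤δ)
               (≤-trans (≈⇒≤ (∣-x∣≈∣x∣ _)) (≤-trans (lipschitz (⊔-∈ 1≤a a≤B p≤B) (⊔-∈ 1≤c c≤B p≤B))
                 (*-mono-≤ (0≤∣x∣ _) (0≤∣x∣ lip) (x≤∣x∣ lip) (≤-trans (⊔-increment p a≤c) mesh)))))
             (past 1≤c p≤c P) ⟩
        (μ * fromℚ δ + λ′ * fromℚ δ) + κ * fromℚ δ * (b - c)
          ≤⟨ ≤-by (*-nonNeg 0≤κδ (0≤y-x a≤c)) (solve 7 (λ m l d k a b c → (m :* d :+ l :* d) :+ k :* d :* (b :- c) :+ k :* d :* (c :- a)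
               := k :* d :* (b :- a) :+ (m :+ l) :* d) ≈-refl μ λ′ (fromℚ δ) κ a b c) ⟩
        κ * fromℚ δ * (b - a) + C * fromℚ δ ∎
      before : c ≤ p → w t d ≈ 0ℝ → _
      before c≤p w≈0 = begin
        ∣ w t d * (c - a) + sum w P - (G (b ⊔ p) - G (a ⊔ p)) ∣
          ≈⟨ ∣∣-cong (solve 5 (λ x s K A T → x :+ s :- (T :- A) := x :+ (s :- (T :- K)) :- (K :- A)) ≈-refl
               (w t d * (c - a)) (sum w P) (G (c ⊔ p)) (G (a ⊔ p)) (G (b ⊔ p))) ⟩
        ∣ w t d * (c - a) + (sum w P - (G (b ⊔ p) - G (c ⊔ p))) - (G (c ⊔ p) - G (a ⊔ p)) ∣
          ≈⟨ ∣∣-cong (+-cong (+-cong (*-cong w≈0 ≈-refl) ≈-refl) (neg-cong (G⊔-cong 1≤a a≤B 1≤c c≤B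
               (≈-trans (x≤y⇒x⊔y≈y (≤-trans a≤c c≤p)) (≈-sym (x≤y⇒x⊔y≈y c≤p)))))) ⟩
        ∣ 0ℝ * (c - a) + (sum w P - (G (b ⊔ p) - G (c ⊔ p))) - 0ℝ ∣
          ≈⟨ ∣∣-cong (solve 2 (λ e s → con 0ℚ :* e :+ s :- con 0ℚ := s) ≈-refl (c - a) _) ⟩
        ∣ sum w P - (G (b ⊔ p) - G (c ⊔ p)) ∣
          ≤⟨ go 1≤c P ⟩
        κ * fromℚ δ * (b - c) + C * fromℚ δ
          ≤⟨ ≤-by (*-nonNeg 0≤κδ (0≤y-x a≤c)) (solve 5 (λ k e a b c → k :* (b :- c) :+ e :+ k :* (c :- a) := k :* (b :- a) :+ e) ≈-refl
               (κ * fromℚ δ) (C * fromℚ δ) a b c) ⟩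
        κ * fromℚ δ * (b - a) + C * fromℚ δ ∎

-- Integer parts and the integral of {x} g(x) over a bounded interval.

/1-mono-≤ : ∀ {i j} → i ℤ.≤ j → i ℚ./ 1 ℚ.≤ j ℚ./ 1
/1-mono-≤ {i} {j} i≤j = ℚP.toℚᵘ-cancel-≤ (ℚᵘP.≤-trans (ℚᵘP.≤-reflexive (ℚP.toℚᵘ-fromℚᵘ (ℚᵘ.mkℚᵘ i 0)))
  (ℚᵘP.≤-trans {j = ℚᵘ.mkℚᵘ j 0} (ℚᵘ.*≤* (ℤP.*-monoʳ-≤-nonNeg (+ 1) i≤j))
    (ℚᵘP.≤-reflexive (ℚᵘP.≃-sym (ℚP.toℚᵘ-fromℚᵘ (ℚᵘ.mkℚᵘ j 0))))))

/1-cancel-≤ : ∀ {i j} → i ℚ./ 1 ℚ.≤ j ℚ./ 1 → i ℤ.≤ j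
/1-cancel-≤ {i} {j} i≤j = ℤP.*-cancelʳ-≤-pos i j (+ 1) (ℚᵘP.drop-*≤* (ℚᵘP.≤-trans {i = ℚᵘ.mkℚᵘ i 0}
  (ℚᵘP.≤-reflexive (ℚᵘP.≃-sym (ℚP.toℚᵘ-fromℚᵘ (ℚᵘ.mkℚᵘ i 0))))
  (ℚᵘP.≤-trans (ℚP.toℚᵘ-mono-≤ i≤j) (ℚᵘP.≤-reflexive (ℚP.toℚᵘ-fromℚᵘ (ℚᵘ.mkℚᵘ j 0))))))

fromℤ-mono-≤ : ∀ {i j} → i ℤ.≤ j → fromℤ i ≤ fromℤ j
fromℤ-mono-≤ i≤j = fromℚ-mono-≤ (/1-mono-≤ i≤j)

fromℤ-cancel-≤ : ∀ {i j} → fromℤ i ≤ fromℤ j → i ℤ.≤ j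
fromℤ-cancel-≤ h = /1-cancel-≤ (fromℚ-cancel-≤ h)

<⇒≱ : ∀ {x y} → x < y → ¬ y ≤ x
<⇒≱ {x} {y} (mk< gap 0<gap N sep) y≤x = ≤⇒¬above y≤x gap 0<gap (N , sep)

ι : ℕ → ℝ
ι n = fromℤ (+ n)

module FloorBounds {t : ℝ} (1≤t : 1ℝ ≤ t) (F : Floor t) where
  m : ℤ
  m = ⌊ F ⌋

  ≤-floor : ∀ {i} → fromℤ i ≤ t → i ℤ.≤ m
  ≤-floor {i} i≤t = ℤP.≮⇒≥ λ m<i → <⇒≱ (Floor.upper F)
    (≤-trans (fromℤ-mono-≤ (subst (ℤ._≤ i) (ℤP.+-comm (+ 1) m) (ℤP.i<j⇒suc[i]≤j m<i))) i≤t)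

  floor-≤ : ∀ {i} → i ℤ.≤ m → fromℤ i ≤ t
  floor-≤ i≤m = ≤-trans (fromℤ-mono-≤ i≤m) (Floor.lower F)

  m≡∣m∣ : + ℤ.∣ m ∣ ≡ m
  m≡∣m∣ = ℤP.0≤i⇒+∣i∣≡i (≤-floor (≤-trans 0≤1ℝ 1≤t))

  ∣m∣≤ : ∀ {M} → t ≤ ι M → ℤ.∣ m ∣ ℕ.≤ M
  ∣m∣≤ {M} t≤M = ℤP.drop‿+≤+ (subst (ℤ._≤ + M) (sym m≡∣m∣) (fromℤ-cancel-≤ (≤-trans (Floor.lower F) t≤M)))

indicator : ∀ {A : Set} → Dec A → ℝ
indicator (yes _) = 1ℝ
indicator (no _)  = 0ℝ

-- This replaces the integer part by step functions with one jump each. The induction runs on M with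
-- the value min(n,M), which agrees with n at the end.
∑-indicator : ∀ n M → n ℕ.≤ M → ∑ M (λ j → indicator (+ suc j ℤP.≤? + n)) ≈ ι n
∑-indicator n M n≤M = subst (λ k → ∑ M (λ j → indicator (+ suc j ℤP.≤? + n)) ≈ ι k) (ℕP.m≤n⇒m⊓n≡m n≤M) (go M)
  where
  next : ∀ M → (d : Dec (+ suc M ℤ.≤ + n)) → ι (n ℕ.⊓ M) + indicator d ≈ ι (n ℕ.⊓ suc M)
  next M (yes M<n) = ≈-trans (subst (λ k → ι k + 1ℝ ≈ ι (suc M)) (sym (ℕP.m≥n⇒m⊓n≡n (ℕP.<⇒≤ (ℤP.drop‿+≤+ M<n)))) (≈-sym (fromℤ-suc M)))
    (subst (λ k → ι (suc M) ≈ ι k) (sym (ℕP.m≥n⇒m⊓n≡n (ℤP.drop‿+≤+ M<n))) ≈-refl)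
  next M (no M≮n) = ≈-trans (solve 1 (λ x → x :+ con 0ℚ := x) ≈-refl _)
    (subst₂ (λ k l → ι k ≈ ι l) (sym (ℕP.m≤n⇒m⊓n≡m n≤M′)) (sym (ℕP.m≤n⇒m⊓n≡m (ℕP.m≤n⇒m≤1+n n≤M′))) ≈-refl)
    where
    n≤M′ : n ℕ.≤ M
    n≤M′ = ℕP.≮⇒≥ λ M<n → M≮n (ℤ.+≤+ M<n)
  go : ∀ M → ∑ M (λ j → indicator (+ suc j ℤP.≤? + n)) ≈ ι (n ℕ.⊓ M)
  go zero    = subst (λ k → 0ℝ ≈ ι k) (sym (ℕP.⊓-zeroʳ n)) ≈-refl
  go (suc M) = ≈-trans (+-cong (go M) ≈-refl) (next M (+ suc M ℤP.≤? + n))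

∑-error : ∀ n {s t : ℕ → ℝ} {e} → (∀ j → j ℕ.< n → ∣ s j - t j ∣ ≤ e) → ∣ ∑ n s - ∑ n t ∣ ≤ ι n * e
∑-error zero {e = e} h = ≤-trans (≈⇒≤ (≈-trans (∣∣-cong (solve 0 (con 0ℚ :- con 0ℚ := con 0ℚ) ≈-refl)) (0≤x⇒∣x∣≈x ≤-refl)))
  (≈⇒≤ (solve 1 (λ e → con 0ℚ := con 0ℚ :* e) ≈-refl e))
∑-error (suc n) {s} {t} {e} h = ≤-trans
  (∣∣-+-≤ (solve 4 (λ a b c d → (a :- b) :+ (c :- d) := a :+ c :- (b :+ d)) ≈-refl (∑ n s) (∑ n t) (s n) (t n))
    (∑-error n (λ j j<n → h j (ℕP.m<n⇒m<1+n j<n))) (h n ℕP.≤-refl))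
  (≈⇒≤ (≈-trans (solve 2 (λ m e → m :* e :+ e := (m :+ con 1ℚ) :* e) ≈-refl (ι n) e) (*-cong (≈-sym (fromℤ-suc n)) ≈-refl)))

-- Integrates {x} G′(x) = x G′(x) - Σ_j [j + 1 ≤ x] G′(x) over [1,x] for x ≤ M, when xG has the derivative x G′(x).
primitiveUpTo : (G xG : ℝ → ℝ) → ℕ → ℝ → ℝ
primitiveUpTo G xG M x = xG x - xG 1ℝ - ∑ M (λ j → G (x ⊔ ι (suc j)) - G (1ℝ ⊔ ι (suc j)))

frac-weight : (ℝ → ℝ) → Weight
frac-weight g t (_ , F) = frac t F * g t

frac-integral : ∀ {G xG g} M → Derivative (ι M) G g → Derivative (ι M) xG (λ x → x * g x) →
  ∀ b → 1ℝ ≤ b → b ≤ ι M → HasIntegral (fn (frac-weight g)) 1ℝ b (primitiveUpTo G xG M b)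
frac-integral {G} {xG} {g} M 𝒢 x𝒢 b 1≤b b≤M ε 0<ε = δ , 0<δ , λ P → begin
  ∣ riemannSum P - primitiveUpTo G xG M b ∣
    ≈⟨ ∣∣-cong (+-cong (decompose P) ≈-refl) ⟩
  ∣ S₀ P - ∑ M (S P) - primitiveUpTo G xG M b ∣
    ≤⟨ ∣∣-+-≤ (solve 5 (λ s t x y u → (s :- (x :- y)) :+ :- (t :- u) := s :- t :- (x :- y :- u)) ≈-refl
         (S₀ P) (∑ M (S P)) (xG b) (xG 1ℝ) (∑ M (λ j → G (b ⊔ ι (suc j)) - G (1ℝ ⊔ ι (suc j)))))
       (x𝒢-error P)
       (≤-trans (≈⇒≤ (∣-x∣≈∣x∣ _)) (∑-error M (𝒢-error P))) ⟩
  κ₀ * fromℚ δ * (b - 1ℝ) + ι M * (κ * fromℚ δ * (b - 1ℝ) + C * fromℚ δ)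
    ≈⟨ solve 6 (λ k d e m l c → k :* d :* e :+ m :* (l :* d :* e :+ c :* d) := (k :* e :+ m :* (l :* e :+ c)) :* d) ≈-refl
         κ₀ (fromℚ δ) (b - 1ℝ) (ι M) κ C ⟩
  𝒦 * fromℚ δ
    ≤⟨ *-monoʳ-≤ (fromℚ-mono-≤ (ℚP.<⇒≤ 0<δ)) (proj₂ (upper 𝒦)) ⟩
  fromℚ (proj₁ (upper 𝒦)) * fromℚ δ
    ≤⟨ pointwise-≤ (λ _ → proj₂ (proj₂ (scale (proj₁ (upper 𝒦)) ε 0<ε))) ⟩
  fromℚ ε ∎
  where
  open ℝR
  open RiemannError 𝒢 using (κ; C; jump-error)
  open RiemannError x𝒢 using (smooth-error) renaming (κ to κ₀)
  -- All errors are linear in δ. This is their total coefficient: one smooth part and M jump parts.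
  𝒦 : ℝ
  𝒦 = κ₀ * (b - 1ℝ) + ι M * (κ * (b - 1ℝ) + C)
  δ : ℚ
  δ = proj₁ (scale (proj₁ (upper 𝒦)) ε 0<ε)
  0<δ : 0ℚ ℚ.< δ
  0<δ = proj₁ (proj₂ (scale (proj₁ (upper 𝒦)) ε 0<ε))
  Partition : Set
  Partition = TaggedPartition (fn (frac-weight g)) δ b 1ℝ
  -- The test compares two integers and is decidable; `FloorBounds` translates its outcome into the
  -- order between j + 1 and t.
  w : ℕ → Weight
  w j t (_ , F) = indicator (+ suc j ℤP.≤? ⌊ F ⌋) * g t
  S₀ : Partition → ℝ
  S₀ P = sum (λ t _ → t * g t) P
  S : Partition → ℕ → ℝ
  S P j = sum (w j) P

  decompose : ∀ P → riemannSum P ≈ S₀ P - ∑ M (S P)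
  decompose P = begin-equality
    riemannSum P
      ≈⟨ riemannSum≈sum P ⟩
    sum (frac-weight g) P
      ≈⟨ sum-cong split P ⟩
    sum (λ t d → 1ℝ * (t * g t) + - 1ℝ * ∑ M (λ j → w j t d)) P
      ≈⟨ sum-linear 1ℝ (- 1ℝ) (λ t _ → t * g t) (λ t d → ∑ M (λ j → w j t d)) P ⟩
    1ℝ * S₀ P + - 1ℝ * sum (λ t d → ∑ M (λ j → w j t d)) P
      ≈⟨ +-cong ≈-refl (*-cong ≈-refl (sum-∑ M w P)) ⟩
    1ℝ * S₀ P + - 1ℝ * ∑ M (S P)
      ≈⟨ solve 2 (λ a b → con 1ℚ :* a :+ :- con 1ℚ :* b := a :- b) ≈-refl (S₀ P) (∑ M (S P)) ⟩
    S₀ P - ∑ M (S P) ∎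
    where
    split : ∀ t d → t ≤ b → frac-weight g t d ≈ 1ℝ * (t * g t) + - 1ℝ * ∑ M (λ j → w j t d)
    split t (1≤t , F) t≤b = begin-equality
      (t - fromℤ m) * g t
        ≈⟨ *-cong (+-cong ≈-refl (neg-cong (subst (λ i → fromℤ i ≈ ∑ M (λ j → indicator (+ suc j ℤP.≤? i))) m≡∣m∣
             (≈-sym (∑-indicator ℤ.∣ m ∣ M (∣m∣≤ (≤-trans t≤b b≤M))))))) ≈-refl ⟩
      (t - I) * g t
        ≈⟨ solve 3 (λ t i g → (t :- i) :* g := con 1ℚ :* (t :* g) :+ :- con 1ℚ :* (g :* i)) ≈-refl t I (g t) ⟩
      1ℝ * (t * g t) + - 1ℝ * (g t * I)
        ≈⟨ +-cong ≈-refl (*-cong ≈-refl (∑-* M (g t) _)) ⟨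
      1ℝ * (t * g t) + - 1ℝ * ∑ M (λ j → g t * indicator (+ suc j ℤP.≤? m))
        ≈⟨ +-cong ≈-refl (*-cong ≈-refl (∑-cong M (λ j → *-comm (g t) _))) ⟩
      1ℝ * (t * g t) + - 1ℝ * ∑ M (λ j → w j t (1≤t , F)) ∎
      where
      open FloorBounds 1≤t F
      I : ℝ
      I = ∑ M (λ j → indicator (+ suc j ℤP.≤? m))

  x𝒢-error : ∀ P → ∣ S₀ P - (xG b - xG 1ℝ) ∣ ≤ κ₀ * fromℚ δ * (b - 1ℝ)
  x𝒢-error P = smooth-error ≤-refl b≤M (λ t d _ → ≈-refl) P

  𝒢-error : ∀ P j → j ℕ.< M → ∣ S P j - (G (b ⊔ ι (suc j)) - G (1ℝ ⊔ ι (suc j))) ∣ ≤ κ * fromℚ δ * (b - 1ℝ) + C * fromℚ δ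
  𝒢-error P j j<M = jump-error (ℚP.<⇒≤ 0<δ) ≤-refl b≤M (fromℤ-mono-≤ (ℤ.+≤+ j<M)) (λ t (1≤t , F) → side t 1≤t F (+ suc j ℤP.≤? ⌊ F ⌋)) P
    where
    side : ∀ t (1≤t : 1ℝ ≤ t) (F : Floor t) (c : Dec (+ suc j ℤ.≤ ⌊ F ⌋)) →
      (ι (suc j) ≤ t × indicator c * g t ≈ g t) ⊎ (¬ ι (suc j) ≤ t × indicator c * g t ≈ 0ℝ)
    side t 1≤t F (yes j<m) = inj₁ (FloorBounds.floor-≤ 1≤t F j<m , solve 1 (λ g → con 1ℚ :* g := g) ≈-refl (g t))
    side t 1≤t F (no j≮m)  = inj₂ ((λ j<t → j≮m (FloorBounds.≤-floor 1≤t F j<t)) , solve 1 (λ g → con 0ℚ :* g := con 0ℚ) ≈-refl (g t))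

-- Values at integers and the growth of powers of the logarithm.

V-cong : ∀ k {x y} → x ≈ y → V k x ≈ V k y
V-cong k e = *-cong (rec-cong e) (^-cong k (ln-cong e))

1≤ι : ∀ n → 1ℝ ≤ ι (suc n)
1≤ι n = 1≤suc n

ι-mono-≤ : ∀ {m n} → m ℕ.≤ n → ι m ≤ ι n
ι-mono-≤ m≤n = fromℤ-mono-≤ (ℤ.+≤+ m≤n)

ι-cancel-≤ : ∀ {m n} → ι m ≤ ι n → m ℕ.≤ n
ι-cancel-≤ h = ℤP.drop‿+≤+ (fromℤ-cancel-≤ h)

ι-nonNeg : ∀ n → 0ℝ ≤ ι n
ι-nonNeg n = ι-mono-≤ {0} {n} ℕ.z≤n

∑-const : ∀ n c → ∑ n (λ _ → c) ≈ ι n * c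
∑-const zero    c = solve 1 (λ c → con 0ℚ := con 0ℚ :* c) ≈-refl c
∑-const (suc n) c = ≈-trans (+-cong (∑-const n c) ≈-refl)
  (≈-trans (solve 2 (λ m c → m :* c :+ c := (m :+ con 1ℚ) :* c) ≈-refl (ι n) c) (*-cong (≈-sym (fromℤ-suc n)) ≈-refl))

∑-cong-< : ∀ n {s t : ℕ → ℝ} → (∀ j → j ℕ.< n → s j ≈ t j) → ∑ n s ≈ ∑ n t
∑-cong-< zero    e = ≈-refl
∑-cong-< (suc n) e = +-cong (∑-cong-< n (λ j j<n → e j (ℕP.m<n⇒m<1+n j<n))) (e n ℕP.≤-refl)

∑-truncate : ∀ n m {t : ℕ → ℝ} → (∀ j → n ℕ.≤ j → t j ≈ 0ℝ) → ∑ (m ℕ.+ n) t ≈ ∑ n t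
∑-truncate n zero    e = ≈-refl
∑-truncate n (suc m) {t} e = ≈-trans (+-cong (∑-truncate n m e) (e (m ℕ.+ n) (ℕP.m≤n+m n m)))
  (solve 1 (λ a → a :+ con 0ℚ := a) ≈-refl (∑ n t))

rec-ι : ∀ n → rec (ι (suc n)) ≈ fromℚ (+ 1 ℚ./ suc n)
rec-ι n = begin-equality
  rec x             ≈⟨ solve 1 (λ r → r := r :* con 1ℚ) ≈-refl (rec x) ⟩
  rec x * 1ℝ        ≈⟨ *-cong ≈-refl (suc*1/suc n) ⟨
  rec x * (x * q)   ≈⟨ solve 3 (λ r x q → r :* (x :* q) := x :* r :* q) ≈-refl (rec x) x q ⟩
  x * rec x * q     ≈⟨ *-cong (*-rec (1≤ι n)) ≈-refl ⟩
  1ℝ * q            ≈⟨ solve 1 (λ q → con 1ℚ :* q := q) ≈-refl q ⟩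
  q                 ∎
  where
  open ℝR
  x = ι (suc n)
  q = fromℚ (+ 1 ℚ./ suc n)

V-ι : ∀ k n → V k (ι (suc n)) ≈ logSuc n ^ k * fromℚ (+ 1 ℚ./ suc n)
V-ι k n = ≈-trans (*-cong (rec-ι n) (^-cong k (≈-sym (log≈ln (ι (suc n)) (1≤suc n))))) (*-comm _ _)

-- A mean value bound with the derivative taken at the larger point.
^-increment : ∀ {x y} k → 0ℝ ≤ x → x ≤ y → y ^ k - x ^ k ≤ dpow k y * (y - x)
^-increment {x} {y} zero 0≤x x≤y = ≈⇒≤ (solve 1 (λ d → con 1ℚ :- con 1ℚ := con 0ℚ :* d) ≈-refl (y - x))
^-increment {x} {y} (suc k) 0≤x x≤y = begin
  y * y ^ k - x * x ^ k
    ≈⟨ solve 4 (λ x y p q → y :* q :- x :* p := p :* (y :- x) :+ y :* (q :- p)) ≈-refl x y (x ^ k) (y ^ k) ⟩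
  x ^ k * (y - x) + y * (y ^ k - x ^ k)
    ≤⟨ +-mono-≤ (*-monoʳ-≤ (0≤y-x x≤y) (^-mono-≤ k 0≤x x≤y)) (*-monoˡ-≤ (≤-trans 0≤x x≤y) (^-increment k 0≤x x≤y)) ⟩
  y ^ k * (y - x) + y * (dpow k y * (y - x))
    ≈⟨ solve 4 (λ e y p d → p :* e :+ y :* (d :* e) := (p :+ y :* d) :* e) ≈-refl (y - x) y (y ^ k) (dpow k y) ⟩
  (y ^ k + y * dpow k y) * (y - x)
    ≈⟨ *-cong (dpow-suc k y) ≈-refl ⟩
  dpow (suc k) y * (y - x) ∎
  where open ℝR

^-+ : ∀ x m n → x ^ m * x ^ n ≈ x ^ (m ℕ.+ n)
^-+ x zero    n = solve 1 (λ a → con 1ℚ :* a := a) ≈-refl (x ^ n)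
^-+ x (suc m) n = ≈-trans (solve 3 (λ x a b → x :* a :* b := x :* (a :* b)) ≈-refl x (x ^ m) (x ^ n)) (*-cong ≈-refl (^-+ x m n))

-- The recursion is dictated by `ln^-growth`: k + 1 comes from differentiating the power,
-- `growth-constant k` from the bound for exponent k, and 2 from (n + 2)/(n + 1) ≤ 2.
growth-constant : ℕ → ℝ
growth-constant zero    = 1ℝ
growth-constant (suc k) = ι (suc k) * growth-constant k * fromℚ (+ 2 ℚ./ 1)

growth-constant-nonNeg : ∀ k → 0ℝ ≤ growth-constant k
growth-constant-nonNeg zero    = 0≤1ℝ
growth-constant-nonNeg (suc k) =
  *-nonNeg (*-nonNeg (ι-nonNeg (suc k)) (growth-constant-nonNeg k)) (fromℚ-mono-≤ (ℚP.nonNegative⁻¹ (+ 2 ℚ./ 1)))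

ι-suc*rec≤2 : ∀ n → ι (suc (suc n)) * rec (ι (suc n)) ≤ fromℚ (+ 2 ℚ./ 1)
ι-suc*rec≤2 n = begin
  ι (suc (suc n)) * r       ≈⟨ *-cong (fromℤ-suc (suc n)) ≈-refl ⟩
  (a + 1ℝ) * r              ≈⟨ solve 2 (λ a r → (a :+ con 1ℚ) :* r := a :* r :+ r) ≈-refl a r ⟩
  a * r + r                 ≤⟨ +-mono-≤ (≈⇒≤ (*-rec (1≤ι n))) (rec≤1 a) ⟩
  1ℝ + 1ℝ                   ≈⟨ pointwise-≈ (λ _ → refl) ⟩
  fromℚ (+ 2 ℚ./ 1)         ∎
  where
  open ℝR
  a = ι (suc n)
  r = rec a

ln-ι-step : ∀ n → ln (ι (suc (suc n))) - ln (ι (suc n)) ≤ rec (ι (suc n))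
ln-ι-step n = begin
  ln (ι (suc (suc n))) - ln a     ≤⟨ ln-diff (1≤ι n) (1≤ι (suc n)) ⟩
  (ι (suc (suc n)) - a) * rec a   ≈⟨ *-cong (+-cong (fromℤ-suc (suc n)) ≈-refl) ≈-refl ⟩
  (a + 1ℝ - a) * rec a            ≈⟨ solve 2 (λ a r → (a :+ con 1ℚ :- a) :* r := r) ≈-refl a (rec a) ⟩
  rec a                           ∎
  where
  open ℝR
  a = ι (suc n)

-- From n + 1 to n + 2 the power log^(k+1) grows by at most (k + 1) log^k(n + 2)/(n + 1). By the
-- bound for exponent k this is at most `growth-constant (suc k)`, so growth is linear. Applied to
-- the exponent 2k, it gives log^k x = o(x) after a square root.
ln^-growth : ∀ k n → ln (ι (suc n)) ^ k ≤ growth-constant k * ι (suc n)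
ln^-growth zero n = ≤-trans (1≤ι n) (≈⇒≤ (solve 1 (λ a → a := con 1ℚ :* a) ≈-refl (ι (suc n))))
ln^-growth (suc k) zero = begin
  ln 1ℝ * ln 1ℝ ^ k               ≈⟨ *-cong ln1≈0 ≈-refl ⟩
  0ℝ * ln 1ℝ ^ k                  ≈⟨ solve 1 (λ p → con 0ℚ :* p := con 0ℚ) ≈-refl (ln 1ℝ ^ k) ⟩
  0ℝ                              ≤⟨ *-nonNeg (growth-constant-nonNeg (suc k)) 0≤1ℝ ⟩
  growth-constant (suc k) * 1ℝ    ∎
  where open ℝR
ln^-growth (suc k) (suc n) = begin
  l′ ^ suc k
    ≈⟨ solve 2 (λ a b → a := b :+ (a :- b)) ≈-refl (l′ ^ suc k) (l ^ suc k) ⟩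
  l ^ suc k + (l′ ^ suc k - l ^ suc k)
    ≤⟨ +-mono-≤ (ln^-growth (suc k) n) (^-increment (suc k) (ln-nonNeg (1≤ι n)) (ln-mono-≤ (1≤ι n) (ι-mono-≤ (ℕP.n≤1+n (suc n))))) ⟩
  C * a + ι (suc k) * l′ ^ k * (l′ - l)
    ≤⟨ +-mono-≤ ≤-refl (*-mono-≤ (0≤y-x (ln-mono-≤ (1≤ι n) (ι-mono-≤ (ℕP.n≤1+n (suc n)))))
         (*-nonNeg (ι-nonNeg (suc k)) (*-nonNeg (growth-constant-nonNeg k) (ι-nonNeg (suc (suc n)))))
         (*-monoˡ-≤ (ι-nonNeg (suc k)) (ln^-growth k (suc n))) (ln-ι-step n)) ⟩
  C * a + ι (suc k) * (growth-constant k * ι (suc (suc n))) * rec a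
    ≈⟨ +-cong ≈-refl (solve 4 (λ m c b r → m :* (c :* b) :* r := m :* c :* (b :* r)) ≈-refl (ι (suc k)) (growth-constant k) (ι (suc (suc n))) (rec a)) ⟩
  C * a + ι (suc k) * growth-constant k * (ι (suc (suc n)) * rec a)
    ≤⟨ +-mono-≤ ≤-refl (*-monoˡ-≤ (*-nonNeg (ι-nonNeg (suc k)) (growth-constant-nonNeg k)) (ι-suc*rec≤2 n)) ⟩
  C * a + C
    ≈⟨ solve 2 (λ c a → c :* a :+ c := c :* (a :+ con 1ℚ)) ≈-refl C a ⟩
  C * (a + 1ℝ)
    ≈⟨ *-cong ≈-refl (fromℤ-suc (suc n)) ⟨
  C * ι (suc (suc n)) ∎
  where
  open ℝR
  a = ι (suc n)
  l = ln a
  l′ = ln (ι (suc (suc n)))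
  C = growth-constant (suc k)

rec-vanish : ∀ δ → 0ℚ ℚ.< δ → Σ[ N ∈ ℕ ] ∀ n → N ℕ.≤ n → rec (ι (suc n)) ≤ fromℚ δ
rec-vanish δ 0<δ = N , λ n N≤n → let a = ι (suc n) ; r = rec a in begin
  r                                   ≈⟨ solve 1 (λ r → r := r :* con 1ℚ) ≈-refl r ⟩
  r * 1ℝ                              ≈⟨ *-cong ≈-refl (pointwise-≈ (λ _ → sym (ℚP.*-inverseˡ δ))) ⟩
  r * (fromℚ 1/δ * fromℚ δ)           ≤⟨ *-monoˡ-≤ (rec-nonNeg a) (*-monoʳ-≤ (fromℚ-mono-≤ (ℚP.<⇒≤ 0<δ))
                                           (≤-trans (fromℚ-mono-≤ (proj₂ (ℚLemmas.archimedean 1/δ))) (ι-mono-≤ (ℕP.m≤n⇒m≤1+n N≤n)))) ⟩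
  r * (a * fromℚ δ)                   ≈⟨ solve 3 (λ r a d → r :* (a :* d) := a :* r :* d) ≈-refl r a (fromℚ δ) ⟩
  a * r * fromℚ δ                     ≈⟨ *-cong (*-rec (1≤ι n)) ≈-refl ⟩
  1ℝ * fromℚ δ                        ≈⟨ solve 1 (λ d → con 1ℚ :* d := d) ≈-refl (fromℚ δ) ⟩
  fromℚ δ                             ∎
  where
  open ℝR
  instance
    δ≢0 : ℚ.NonZero δ
    δ≢0 = ℚP.pos⇒nonZero δ {{ℚ.positive 0<δ}}
  1/δ = ℚ.1/ δ
  N = proj₁ (ℚLemmas.archimedean 1/δ)

-- In the case η ≤ x, multiplying by x gives xη ≤ x² ≤ η², from which the positive factor η is
-- cancelled.
square-cancel-≤ : ∀ {x η} → 0ℚ ℚ.< η → x * x ≤ fromℚ η * fromℚ η → x ≤ fromℚ η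
square-cancel-≤ {x} {η} 0<η h = ≤-by-cases x (fromℚ η) (λ p → p) λ η≤x → 0≤y-x⇒x≤y (begin
  0ℝ                                              ≤⟨ *-nonNeg (0≤y-x (begin
      x * fromℚ η                                     ≤⟨ *-monoˡ-≤ (≤-trans 0≤η η≤x) η≤x ⟩
      x * x                                           ≤⟨ h ⟩
      fromℚ η * fromℚ η                               ∎)) (fromℚ-mono-≤ (ℚP.<⇒≤ 0<1/η)) ⟩
  (fromℚ η * fromℚ η - x * fromℚ η) * fromℚ 1/η   ≈⟨ solve 3 (λ x h k → (h :* h :- x :* h) :* k := (h :- x) :* (h :* k)) ≈-refl x (fromℚ η) (fromℚ 1/η) ⟩
  (fromℚ η - x) * (fromℚ η * fromℚ 1/η)           ≈⟨ *-cong ≈-refl (pointwise-≈ (λ _ → ℚP.*-inverseʳ η)) ⟩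
  (fromℚ η - x) * 1ℝ                              ≈⟨ solve 1 (λ d → d :* con 1ℚ := d) ≈-refl _ ⟩
  fromℚ η - x                                     ∎)
  where
  open ℝR
  0≤η : 0ℝ ≤ fromℚ η
  0≤η = fromℚ-mono-≤ (ℚP.<⇒≤ 0<η)
  instance
    η>0 : ℚ.Positive η
    η>0 = ℚ.positive 0<η
    η≢0 : ℚ.NonZero η
    η≢0 = ℚP.pos⇒nonZero η
  1/η = ℚ.1/ η
  0<1/η : 0ℚ ℚ.< 1/η
  0<1/η = ℚP.positive⁻¹ 1/η {{ℚP.1/pos⇒pos η}}

-- (log^k (n + 2) / (n + 1))² ≤ 2 C / (n + 1), by the growth bound for the exponent 2k.
rec*ln^-vanish : ∀ k η → 0ℚ ℚ.< η → Σ[ N ∈ ℕ ] ∀ n → N ℕ.≤ n → rec (ι (suc n)) * ln (ι (suc (suc n))) ^ k ≤ fromℚ η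
rec*ln^-vanish k η 0<η = proj₁ van , λ n N≤n → let a = ι (suc n) ; b = ι (suc (suc n)) ; r = rec a ; l = ln b in
  square-cancel-≤ 0<η (begin
    r * l ^ k * (r * l ^ k)
      ≈⟨ solve 2 (λ r p → r :* p :* (r :* p) := r :* r :* (p :* p)) ≈-refl r (l ^ k) ⟩
    r * r * (l ^ k * l ^ k)
      ≈⟨ *-cong ≈-refl (^-+ l k k) ⟩
    r * r * l ^ (k ℕ.+ k)
      ≤⟨ *-monoˡ-≤ (square-nonNeg r) (ln^-growth (k ℕ.+ k) (suc n)) ⟩
    r * r * (C * b)
      ≈⟨ solve 3 (λ r c b → r :* r :* (c :* b) := c :* r :* (b :* r)) ≈-refl r C b ⟩
    C * r * (b * r)
      ≤⟨ *-monoˡ-≤ (*-nonNeg (growth-constant-nonNeg (k ℕ.+ k)) (rec-nonNeg a)) (ι-suc*rec≤2 n) ⟩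
    C * r * 2ℝ
      ≈⟨ solve 3 (λ c r t → c :* r :* t := c :* t :* r) ≈-refl C r 2ℝ ⟩
    C * 2ℝ * r
      ≤⟨ *-mono-≤ (rec-nonNeg a) (≤-trans 0≤2C 2C≤q) 2C≤q (proj₂ van n N≤n) ⟩
    fromℚ q * fromℚ δ
      ≤⟨ pointwise-≤ (λ _ → proj₂ (proj₂ (scale q (η ℚ.* η) (*-pos 0<η 0<η)))) ⟩
    fromℚ η * fromℚ η ∎)
  where
  open ℝR
  2ℝ = fromℚ (+ 2 ℚ./ 1)
  C = growth-constant (k ℕ.+ k)
  q = proj₁ (upper (C * 2ℝ))
  2C≤q : C * 2ℝ ≤ fromℚ q
  2C≤q = proj₂ (upper (C * 2ℝ))
  0≤2C : 0ℝ ≤ C * 2ℝ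
  0≤2C = *-nonNeg (growth-constant-nonNeg (k ℕ.+ k)) (fromℚ-mono-≤ (ℚP.nonNegative⁻¹ (+ 2 ℚ./ 1)))
  δ = proj₁ (scale q (η ℚ.* η) (*-pos 0<η 0<η))
  van = rec-vanish δ (proj₁ (proj₂ (scale q (η ℚ.* η) (*-pos 0<η 0<η))))

-- A descending search from an archimedean bound, comparing b with one integer at a time. Each
-- comparison is available only up to double negation, hence so is the result.
integer-part-¬¬ : ∀ {b} → 1ℝ ≤ b → ¬ ¬ (Σ[ n ∈ ℕ ] ι (suc n) ≤ b × b ≤ ι (suc (suc n)))
integer-part-¬¬ {b} 1≤b ∄n = go M (≤-trans (proj₂ (archimedean b)) (ι-mono-≤ {M} {suc (suc M)} (ℕP.m≤n⇒m≤1+n (ℕP.n≤1+n M))))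
  where
  M = proj₁ (archimedean b)
  go : ∀ m → b ≤ ι (suc (suc m)) → ⊥
  go zero    b≤ = ∄n (0 , 1≤b , b≤)
  go (suc m) b≤ = ≤-total-¬¬ b (ι (suc (suc m)))
    λ { (inj₁ h) → go m h ; (inj₂ h) → ∄n (suc m , h , b≤) }

-- The improper integral of {x} f_k′(x).

module _ (k : ℕ) where
  open ℝR

  q : ℝ
  q = fromℚ (+ 1 ℚ./ suc k)

  Ψ : ℕ → ℝ → ℝ
  Ψ = primitiveUpTo (V k) (U k)

  -- The index j stands for the integer j + 1. For j ≤ N this integer is at most b and the maximum
  -- is b; for larger j both b and 1 lie at or below it and the difference vanishes. The value
  -- therefore does not depend on M.
  primitiveUpTo-truncated : ∀ N M b → ι (suc N) ≤ b → b ≤ ι (suc (suc N)) → b ≤ ι M →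
    Ψ M b ≈ U k b - U k 1ℝ - (ι (suc N) * V k b - ∑ (suc N) (λ j → V k (ι (suc j))))
  primitiveUpTo-truncated N M b N≤b b≤N b≤M = +-cong ≈-refl (neg-cong (begin-equality
    ∑ M t
      ≈⟨ subst (λ m → ∑ m t ≈ ∑ (suc N) t) (ℕP.m∸n+n≡m (ι-cancel-≤ {suc N} {M} (≤-trans N≤b b≤M))) (∑-truncate (suc N) (M ℕ.∸ suc N) beyond) ⟩
    ∑ (suc N) t
      ≈⟨ ∑-cong-< (suc N) within ⟩
    ∑ (suc N) (λ j → V k b + - 1ℝ * V k (ι (suc j)))
      ≈⟨ ∑-+ (suc N) (λ _ → V k b) (λ j → - 1ℝ * V k (ι (suc j))) ⟩
    ∑ (suc N) (λ _ → V k b) + ∑ (suc N) (λ j → - 1ℝ * V k (ι (suc j)))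
      ≈⟨ +-cong (∑-const (suc N) (V k b)) (∑-* (suc N) (- 1ℝ) (λ j → V k (ι (suc j)))) ⟩
    ι (suc N) * V k b + - 1ℝ * ∑ (suc N) (λ j → V k (ι (suc j)))
      ≈⟨ solve 2 (λ a s → a :+ :- con 1ℚ :* s := a :- s) ≈-refl (ι (suc N) * V k b) (∑ (suc N) (λ j → V k (ι (suc j)))) ⟩
    ι (suc N) * V k b - ∑ (suc N) (λ j → V k (ι (suc j))) ∎))
    where
    t : ℕ → ℝ
    t j = V k (b ⊔ ι (suc j)) - V k (1ℝ ⊔ ι (suc j))
    beyond : ∀ j → suc N ℕ.≤ j → t j ≈ 0ℝ
    beyond j N<j = ≈-trans (+-cong (V-cong k (x≤y⇒x⊔y≈y (≤-trans b≤N (ι-mono-≤ (ℕ.s≤s N<j))))) (neg-cong (V-cong k (x≤y⇒x⊔y≈y (1≤ι j)))))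
      (solve 1 (λ a → a :- a := con 0ℚ) ≈-refl (V k (ι (suc j))))
    within : ∀ j → j ℕ.< suc N → t j ≈ V k b + - 1ℝ * V k (ι (suc j))
    within j j<N = ≈-trans (+-cong (V-cong k (y≤x⇒x⊔y≈x (≤-trans (ι-mono-≤ j<N) N≤b))) (neg-cong (V-cong k (x≤y⇒x⊔y≈y (1≤ι j)))))
      (solve 2 (λ a c → a :- c := a :+ :- con 1ℚ :* c) ≈-refl (V k b) (V k (ι (suc j))))

  -- Put a = N + 1. The sums and the value at 1 cancel, leaving the difference of (b - a) log^k b /
  -- b and (log^(k+1) b - log^(k+1) a)/(k + 1). With b - a ≤ 1 and the tangent inequality, each is
  -- at most log^k(N + 2)/(N + 1).
  primitiveUpTo-stieltjes : ∀ N M b → ι (suc N) ≤ b → b ≤ ι (suc (suc N)) → b ≤ ι M →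
    ∣ Ψ M b - (stieltjesTerm k N - U k 1ℝ) ∣ ≤
    rec (ι (suc N)) * ln (ι (suc (suc N))) ^ k + rec (ι (suc N)) * ln (ι (suc (suc N))) ^ k
  primitiveUpTo-stieltjes N M b N≤b b≤N b≤M = begin
    ∣ Ψ M b - (stieltjesTerm k N - U k 1ℝ) ∣
      ≈⟨ ∣∣-cong (+-cong (primitiveUpTo-truncated N M b N≤b b≤N b≤M) (neg-cong (+-cong stieltjes ≈-refl))) ⟩
    ∣ U k b - U k 1ℝ - (a * V k b - S) - (S - A * q - U k 1ℝ) ∣
      ≈⟨ ∣∣-cong (solve 8 (λ p w q u a r S A → (p :+ w :* :- q) :- u :- (a :* (r :* p) :- S) :- (S :- A :* q :- u)
           := con 1ℚ :* p :- a :* r :* p :+ :- (q :* (w :- A))) ≈-refl (l ^ k) (l ^ suc k) q (U k 1ℝ) a r S A) ⟩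
    ∣ 1ℝ * l ^ k - a * r * l ^ k + - (q * (l ^ suc k - A)) ∣
      ≈⟨ ∣∣-cong (+-cong (+-cong (*-cong (*-rec 1≤b) ≈-refl) ≈-refl) ≈-refl) ⟨
    ∣ b * r * l ^ k - a * r * l ^ k + - (q * (l ^ suc k - A)) ∣
      ≤⟨ ∣∣-+-≤ ≈-refl X≤ (≤-trans (≈⇒≤ (∣-x∣≈∣x∣ _)) Y≤) ⟩
    rec a * ln b′ ^ k + rec a * ln b′ ^ k ∎
    where
    a = ι (suc N)
    b′ = ι (suc (suc N))
    l = ln b
    r = rec b
    S = ∑ (suc N) (λ j → V k (ι (suc j)))
    A = ln a ^ suc k
    1≤b = ≤-trans (1≤ι N) N≤b
    stieltjes : stieltjesTerm k N ≈ S - A * q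
    stieltjes = +-cong (∑-cong (suc N) (λ j → ≈-sym (V-ι k j))) (neg-cong (*-cong (^-cong (suc k) (log≈ln a (1≤suc N))) ≈-refl))
    0≤l = ln-nonNeg 1≤b
    la≤l : ln a ≤ l
    la≤l = ln-mono-≤ (1≤ι N) N≤b
    l^≤ : l ^ k ≤ ln b′ ^ k
    l^≤ = ^-mono-≤ k 0≤l (ln-mono-≤ 1≤b b≤N)
    b-a≤1 : b - a ≤ 1ℝ
    b-a≤1 = begin
      b - a             ≤⟨ +-mono-≤ b≤N ≤-refl ⟩
      b′ - a            ≈⟨ +-cong (fromℤ-suc (suc N)) ≈-refl ⟩
      a + 1ℝ - a        ≈⟨ solve 1 (λ a → a :+ con 1ℚ :- a := con 1ℚ) ≈-refl a ⟩
      1ℝ                ∎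
    r≤ : r ≤ rec a
    r≤ = 0≤y-x⇒x≤y (≤-trans (*-nonNeg (0≤y-x N≤b) (*-nonNeg (rec-nonNeg a) (rec-nonNeg b)))
      (≈⇒≥ (rec-diff (1≤ι N) 1≤b)))
    X≤ : ∣ b * r * l ^ k - a * r * l ^ k ∣ ≤ rec a * ln b′ ^ k
    X≤ = begin
      ∣ b * r * l ^ k - a * r * l ^ k ∣
        ≈⟨ ∣∣-cong (solve 4 (λ a b r p → b :* r :* p :- a :* r :* p := (b :- a) :* (r :* p)) ≈-refl a b r (l ^ k)) ⟩
      ∣ (b - a) * (r * l ^ k) ∣
        ≈⟨ 0≤x⇒∣x∣≈x (*-nonNeg (0≤y-x N≤b) (*-nonNeg (rec-nonNeg b) (^-nonNeg k 0≤l))) ⟩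
      (b - a) * (r * l ^ k)
        ≤⟨ *-mono-≤ (*-nonNeg (rec-nonNeg b) (^-nonNeg k 0≤l)) 0≤1ℝ b-a≤1 (*-mono-≤ (^-nonNeg k 0≤l) (rec-nonNeg a) r≤ l^≤) ⟩
      1ℝ * (rec a * ln b′ ^ k)
        ≈⟨ solve 1 (λ p → con 1ℚ :* p := p) ≈-refl (rec a * ln b′ ^ k) ⟩
      rec a * ln b′ ^ k ∎
    0≤q : 0ℝ ≤ q
    0≤q = fromℚ-mono-≤ (ℚLemmas.1/-nonNeg k)
    Y≤ : ∣ q * (l ^ suc k - A) ∣ ≤ rec a * ln b′ ^ k
    Y≤ = begin
      ∣ q * (l ^ suc k - A) ∣
        ≈⟨ 0≤x⇒∣x∣≈x (*-nonNeg 0≤q (0≤y-x (^-mono-≤ (suc k) (ln-nonNeg (1≤ι N)) la≤l))) ⟩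
      q * (l ^ suc k - A)
        ≤⟨ *-monoˡ-≤ 0≤q (^-increment (suc k) (ln-nonNeg (1≤ι N)) la≤l) ⟩
      q * (ι (suc k) * l ^ k * (l - ln a))
        ≈⟨ solve 4 (λ q m p d → q :* (m :* p :* d) := m :* q :* (d :* p)) ≈-refl q (ι (suc k)) (l ^ k) (l - ln a) ⟩
      ι (suc k) * q * ((l - ln a) * l ^ k)
        ≈⟨ *-cong (suc*1/suc k) ≈-refl ⟩
      1ℝ * ((l - ln a) * l ^ k)
        ≤⟨ *-monoˡ-≤ 0≤1ℝ (*-mono-≤ (^-nonNeg k 0≤l) (rec-nonNeg a) l-la≤ l^≤) ⟩
      1ℝ * (rec a * ln b′ ^ k)
        ≈⟨ solve 1 (λ p → con 1ℚ :* p := p) ≈-refl (rec a * ln b′ ^ k) ⟩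
      rec a * ln b′ ^ k ∎
      where
      l-la≤ : l - ln a ≤ rec a
      l-la≤ = begin
        l - ln a            ≤⟨ ln-diff (1≤ι N) 1≤b ⟩
        (b - a) * rec a     ≤⟨ *-monoʳ-≤ (rec-nonNeg a) b-a≤1 ⟩
        1ℝ * rec a          ≈⟨ solve 1 (λ r → con 1ℚ :* r := r) ≈-refl (rec a) ⟩
        rec a               ∎

  v-improper : ∀ {γ} → stieltjesTerm k ⟶ γ → HasImproperIntegral (fn (frac-weight (v k))) 1ℝ (γ - U k 1ℝ)
  v-improper {γ} s⟶γ = record
    { upTo = λ b _ → Ψ (M b) b
    ; integrals = λ b 1≤b → frac-integral (M b) (D-V (ι (M b)) k) (D-U (ι (M b)) k) b 1≤b (proj₂ (archimedean b))
    -- The offset 2 lets `index` + 2 ≤ b ≤ N + 2 imply `index` ≤ N. The threshold is chosen before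
    -- b, so only the final inequality depends on the merely ¬¬-existing N.
    ; limit = λ ε 0<ε → ι (suc (suc (index ε 0<ε))) , λ b 1≤b B≤b → ≤-stable λ ¬goal →
        integer-part-¬¬ 1≤b λ (N , N≤b , b≤N) → ¬goal (bound ε 0<ε N b N≤b b≤N
          (ℕP.≤-pred (ℕP.≤-pred (ι-cancel-≤ {suc (suc (index ε 0<ε))} {suc (suc N)} (≤-trans B≤b b≤N))))) }
    where
    M : ℝ → ℕ
    M b = proj₁ (archimedean b)
    vanish : ∀ ε → 0ℚ ℚ.< ε → _
    vanish ε 0<ε = rec*ln^-vanish k (ε ℚ.* ½ ℚ.* ½) (half-pos (half-pos 0<ε))
    index : ∀ ε → 0ℚ ℚ.< ε → ℕ
    index ε 0<ε = proj₁ (s⟶γ (ε ℚ.* ½) (half-pos 0<ε)) ℕ.⊔ proj₁ (vanish ε 0<ε)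
    bound : ∀ ε 0<ε N b → ι (suc N) ≤ b → b ≤ ι (suc (suc N)) → index ε 0<ε ℕ.≤ N → ∣ Ψ (M b) b - (γ - U k 1ℝ) ∣ ≤ fromℚ ε
    bound ε 0<ε N b N≤b b≤N i≤N = begin
      ∣ Ψ (M b) b - (γ - U k 1ℝ) ∣
        ≤⟨ ∣∣-+-≤ (solve 4 (λ p s g u → (p :- (s :- u)) :+ (s :- g) := p :- (g :- u)) ≈-refl (Ψ (M b) b) (stieltjesTerm k N) γ (U k 1ℝ))
             (≤-trans (primitiveUpTo-stieltjes N (M b) b N≤b b≤N (proj₂ (archimedean b))) (+-mono-≤ small small))
             (proj₂ (s⟶γ (ε ℚ.* ½) (half-pos 0<ε)) N (ℕP.m⊔n≤o⇒m≤o (proj₁ (s⟶γ (ε ℚ.* ½) (half-pos 0<ε))) _ i≤N)) ⟩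
      fromℚ (ε ℚ.* ½ ℚ.* ½) + fromℚ (ε ℚ.* ½ ℚ.* ½) + fromℚ (ε ℚ.* ½)
        ≈⟨ pointwise-≈ (λ _ → ℚS.solve 1 (λ e → e ℚS.:* ℚS.con ½ ℚS.:* ℚS.con ½ ℚS.:+ e ℚS.:* ℚS.con ½ ℚS.:* ℚS.con ½ ℚS.:+ e ℚS.:* ℚS.con ½ ℚS.:= e) refl ε) ⟩
      fromℚ ε ∎
      where
      small = proj₂ (vanish ε 0<ε) N (ℕP.m⊔n≤o⇒n≤o (proj₁ (s⟶γ (ε ℚ.* ½) (half-pos 0<ε))) _ i≤N)

open import Data.Nat.Combinatorics using (_C_; nCk+nC[k+1]≡[n+1]C[k+1]; k>n⇒nCk≡0)

-- Linearity of improper integrals.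

retag : ∀ {f g δ δ′ b a} → δ ℚ.≤ δ′ → (∀ t → Dom f t → Dom g t) →
  TaggedPartition f δ b a → TaggedPartition g δ′ b a
retag δ≤δ′ i (done a≈b) = done a≈b
retag δ≤δ′ i (step t c a≤t t≤c mesh d P) =
  step t c a≤t t≤c (≤-trans mesh (fromℚ-mono-≤ δ≤δ′)) (i t d) (retag δ≤δ′ i P)

-- Two summands cover all uses: finite sums arise by iteration, and a rewritten or rescaled
-- integrand is the case where f and g coincide and q = 0.
record LinearCombination (p q : ℝ) (f g h : PartialFn) : Set where
  field
    into-f : ∀ t → Dom h t → Dom f t
    into-g : ∀ t → Dom h t → Dom g t
    combine : ∀ t d → apply h t d ≈ p * apply f t (into-f t d) + q * apply g t (into-g t d)

module _ {p q f g h} (L : LinearCombination p q f g h) where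
  open LinearCombination L
  open ℝR

  riemannSum-linear : ∀ {δ δ₁ δ₂ b a} (δ≤δ₁ : δ ℚ.≤ δ₁) (δ≤δ₂ : δ ℚ.≤ δ₂) (P : TaggedPartition h δ b a) →
    riemannSum P ≈ p * riemannSum (retag {g = f} δ≤δ₁ into-f P) + q * riemannSum (retag {g = g} δ≤δ₂ into-g P)
  riemannSum-linear δ≤δ₁ δ≤δ₂ (done _) = solve 2 (λ p q → con 0ℚ := p :* con 0ℚ :+ q :* con 0ℚ) ≈-refl p q
  riemannSum-linear {a = a} δ≤δ₁ δ≤δ₂ (step t c _ _ _ d P) = ≈-trans
    (+-cong (*-cong (combine t d) ≈-refl) (riemannSum-linear δ≤δ₁ δ≤δ₂ P))
    (solve 7 (λ p q x y e s u → (p :* x :+ q :* y) :* e :+ (p :* s :+ q :* u) := p :* (x :* e :+ s) :+ q :* (y :* e :+ u)) ≈-refl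
      p q (apply f t (into-f t d)) (apply g t (into-g t d)) (c - a)
      (riemannSum (retag {g = f} δ≤δ₁ into-f P)) (riemannSum (retag {g = g} δ≤δ₂ into-g P)))

  module _ (ε : ℚ) (0<ε : 0ℚ ℚ.< ε) where
    private
      c : ℝ
      c = ∣ p ∣ + ∣ q ∣
      scaled : Σ[ η ∈ ℚ ] 0ℚ ℚ.< η × proj₁ (upper c) ℚ.* η ℚ.≤ ε
      scaled = scale (proj₁ (upper c)) ε 0<ε

    tolerance : ℚ
    tolerance = proj₁ scaled

    0<tolerance : 0ℚ ℚ.< tolerance
    0<tolerance = proj₁ (proj₂ scaled)

    within-tolerance : ∀ {x y I J} → ∣ x - I ∣ ≤ fromℚ tolerance → ∣ y - J ∣ ≤ fromℚ tolerance →
      ∣ (p * x + q * y) - (p * I + q * J) ∣ ≤ fromℚ ε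
    within-tolerance {x} {y} {I} {J} x≈I y≈J = begin
      ∣ (p * x + q * y) - (p * I + q * J) ∣
        ≤⟨ ∣∣-+-≤ (solve 6 (λ p q x y i j → p :* (x :- i) :+ q :* (y :- j) := (p :* x :+ q :* y) :- (p :* i :+ q :* j)) ≈-refl p q x y I J)
             (∣∣-*-≤ ≤-refl x≈I) (∣∣-*-≤ ≤-refl y≈J) ⟩
      ∣ p ∣ * fromℚ tolerance + ∣ q ∣ * fromℚ tolerance
        ≈⟨ solve 3 (λ a b e → a :* e :+ b :* e := (a :+ b) :* e) ≈-refl ∣ p ∣ ∣ q ∣ (fromℚ tolerance) ⟩
      c * fromℚ tolerance
        ≤⟨ *-monoʳ-≤ (fromℚ-mono-≤ (ℚP.<⇒≤ 0<tolerance)) (proj₂ (upper c)) ⟩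
      fromℚ (proj₁ (upper c)) * fromℚ tolerance
        ≤⟨ pointwise-≤ (λ _ → proj₂ (proj₂ scaled)) ⟩
      fromℚ ε ∎

  integral-linear : ∀ {a b I J} → HasIntegral f a b I → HasIntegral g a b J → HasIntegral h a b (p * I + q * J)
  integral-linear {a} {b} {I} {J} hf hg ε 0<ε = δ₁ ℚ.⊓ δ₂ , 0<δ , λ P → begin
    ∣ riemannSum P - (p * I + q * J) ∣
      ≈⟨ ∣∣-cong (+-cong (riemannSum-linear (ℚP.p⊓q≤p δ₁ δ₂) (ℚP.p⊓q≤q δ₁ δ₂) P) ≈-refl) ⟩
    ∣ (p * riemannSum (retag {g = f} (ℚP.p⊓q≤p δ₁ δ₂) into-f P) + q * riemannSum (retag {g = g} (ℚP.p⊓q≤q δ₁ δ₂) into-g P)) - (p * I + q * J) ∣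
      ≤⟨ within-tolerance ε 0<ε
           (proj₂ (proj₂ hf′) (retag (ℚP.p⊓q≤p δ₁ δ₂) into-f P)) (proj₂ (proj₂ hg′) (retag (ℚP.p⊓q≤q δ₁ δ₂) into-g P)) ⟩
    fromℚ ε ∎
    where
    hf′ = hf (tolerance ε 0<ε) (0<tolerance ε 0<ε)
    hg′ = hg (tolerance ε 0<ε) (0<tolerance ε 0<ε)
    δ₁ δ₂ : ℚ
    δ₁ = proj₁ hf′
    δ₂ = proj₁ hg′
    0<δ : 0ℚ ℚ.< δ₁ ℚ.⊓ δ₂
    0<δ = [ (λ e → subst (0ℚ ℚ.<_) (sym e) (proj₁ (proj₂ hf′))) , (λ e → subst (0ℚ ℚ.<_) (sym e) (proj₁ (proj₂ hg′))) ]′ (ℚP.⊓-sel δ₁ δ₂)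

  improper-linear : ∀ {a I J} → HasImproperIntegral f a I → HasImproperIntegral g a J → HasImproperIntegral h a (p * I + q * J)
  improper-linear hf hg = record
    { upTo = λ b a≤b → p * F.upTo b a≤b + q * G.upTo b a≤b
    ; integrals = λ b a≤b → integral-linear (F.integrals b a≤b) (G.integrals b a≤b)
    ; limit = λ ε 0<ε →
        let B₁ , lim₁ = F.limit (tolerance ε 0<ε) (0<tolerance ε 0<ε)
            B₂ , lim₂ = G.limit (tolerance ε 0<ε) (0<tolerance ε 0<ε)
        in B₁ ⊔ B₂ , λ b a≤b B≤b → within-tolerance ε 0<ε
             (lim₁ b a≤b (≤-trans (x≤x⊔y B₁ B₂) B≤b)) (lim₂ b a≤b (≤-trans (y≤x⊔y B₁ B₂) B≤b)) }
    where
    module F = HasImproperIntegral hf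
    module G = HasImproperIntegral hg

improper-cong : ∀ {f a I J} → I ≈ J → HasImproperIntegral f a I → HasImproperIntegral f a J
improper-cong e hf = record
  { upTo = upTo ; integrals = integrals
  ; limit = λ ε 0<ε → let B , lim = limit ε 0<ε in
      B , λ b a≤b B≤b → ≤-trans (≈⇒≤ (∣∣-cong (+-cong ≈-refl (neg-cong (≈-sym e))))) (lim b a≤b B≤b) }
  where open HasImproperIntegral hf

improper-∑ : ∀ n (c : ℕ → ℝ) (w : ℕ → Weight) (I : ℕ → ℝ) → (∀ j → HasImproperIntegral (fn (w j)) 1ℝ (I j)) →
  HasImproperIntegral (fn (λ t d → ∑ n (λ j → c j * w j t d))) 1ℝ (∑ n (λ j → c j * I j))
-- The zero function is integrated as the combination of `w 0` with itself, both coefficients being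
-- 0.
improper-∑ zero c w I h = improper-cong (solve 1 (λ i → con 0ℚ :* i :+ con 0ℚ :* i := con 0ℚ) ≈-refl (I 0))
  (improper-linear record
    { into-f = λ _ d → d ; into-g = λ _ d → d
    ; combine = λ t d → solve 1 (λ x → con 0ℚ := con 0ℚ :* x :+ con 0ℚ :* x) ≈-refl (w 0 t d) } (h 0) (h 0))
improper-∑ (suc n) c w I h = improper-cong (solve 3 (λ s k i → con 1ℚ :* s :+ k :* i := s :+ k :* i) ≈-refl (∑ n (λ j → c j * I j)) (c n) (I n))
  (improper-linear record
    { into-f = λ _ d → d ; into-g = λ _ d → d
    ; combine = λ t d → solve 3 (λ s k i → s :+ k :* i := con 1ℚ :* s :+ k :* i) ≈-refl (∑ n (λ j → c j * w j t d)) (c n) (w n t d) }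
    (improper-∑ n c w I h) (h n))

-- Factorials, signs and Pascal's rule for the Laguerre polynomials.

/-scale : ∀ i j n .{{_ : ℕ.NonZero n}} → (i ℤ.* j) ℚ./ n ≡ (i ℚ./ 1) ℚ.* (j ℚ./ n)
/-scale i j (suc d) = ℚP.toℚᵘ-injective
  (ℚᵘP.≃-trans (ℚP.toℚᵘ-fromℚᵘ (ℚᵘ.mkℚᵘ (i ℤ.* j) d))
  (ℚᵘP.≃-trans (ℚᵘ.*≡* (cong (λ k → i ℤ.* j ℤ.* + suc k) (ℕP.+-identityʳ d)))
  (ℚᵘP.≃-sym (ℚᵘP.≃-trans (ℚP.toℚᵘ-homo-* (i ℚ./ 1) (j ℚ./ suc d))
    (ℚᵘP.*-cong (ℚP.toℚᵘ-fromℚᵘ (ℚᵘ.mkℚᵘ i 0)) (ℚP.toℚᵘ-fromℚᵘ (ℚᵘ.mkℚᵘ j d)))))))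

/-cancel : ∀ m i n .{{_ : ℕ.NonZero n}} .{{_ : ℕ.NonZero (suc m ℕ.* n)}} →
  (+ suc m ℚ./ 1) ℚ.* (i ℚ./ (suc m ℕ.* n)) ≡ i ℚ./ n
/-cancel m i (suc d) = trans (sym (/-scale (+ suc m) i (suc m ℕ.* suc d))) (ℚP.toℚᵘ-injective
  (ℚᵘP.≃-trans (ℚP.toℚᵘ-fromℚᵘ (ℚᵘ.mkℚᵘ (+ suc m ℤ.* i) (d ℕ.+ m ℕ.* suc d)))
  (ℚᵘP.≃-trans (ℚᵘ.*≡* eq) (ℚᵘP.≃-sym (ℚP.toℚᵘ-fromℚᵘ (ℚᵘ.mkℚᵘ i d))))))
  where
  eq : + suc m ℤ.* i ℤ.* + suc d ≡ i ℤ.* + (suc m ℕ.* suc d)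
  eq = trans (cong (ℤ._* + suc d) (ℤP.*-comm (+ suc m) i))
    (trans (ℤP.*-assoc i (+ suc m) (+ suc d)) (cong (i ℤ.*_) (sym (ℤP.pos-* (suc m) (suc d)))))

/!-scale : ∀ i j k → fromℚ ((i ℤ.* j) /! k) ≈ fromℤ i * fromℚ (j /! k)
/!-scale i j k = pointwise-≈ λ _ → /-scale i j (k !) {{k ℕP.!≢0}}

/!-cancel : ∀ k i → ι (suc k) * fromℚ (i /! suc k) ≈ fromℚ (i /! k)
/!-cancel k i = pointwise-≈ λ _ → /-cancel k i (k !) {{k ℕP.!≢0}} {{suc k ℕP.!≢0}}

-1^-square : ∀ n → ℤ.-1ℤ ℤ.^ n ℤ.* ℤ.-1ℤ ℤ.^ n ≡ ℤ.1ℤ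
-1^-square zero = refl
-1^-square (suc n) = trans (ℤP.*-assoc ℤ.-1ℤ u (ℤ.-1ℤ ℤ.* u)) (trans (cong (ℤ.-1ℤ ℤ.*_)
    (trans (sym (ℤP.*-assoc u ℤ.-1ℤ u)) (trans (cong (ℤ._* u) (ℤP.*-comm u ℤ.-1ℤ)) (ℤP.*-assoc ℤ.-1ℤ u u))))
  (trans (sym (ℤP.*-assoc ℤ.-1ℤ ℤ.-1ℤ (u ℤ.* u))) (trans (ℤP.*-identityˡ (u ℤ.* u)) (-1^-square n))))
  where u = ℤ.-1ℤ ℤ.^ n

-1^-⊖ : ∀ {m j} → j ℕ.≤ m → -1^ (+ suc m -ℤ + suc j) ≡ ℤ.-1ℤ ℤ.^ (m ℕ.∸ j)
-1^-⊖ {m} {j} j≤m = cong -1^_ (trans (ℤP.[1+m]⊖[1+n]≡m⊖n m j) (ℤP.⊖-≥ j≤m))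

-- With u = (-1)^(m - j) the left side is (-1)^j u u, and u squares to 1. The case j = 0 says that
-- the sign (-1)^m is its own inverse.
signs : ∀ {m j} → j ℕ.≤ m → -1^ (+ suc m -ℤ + 1) ℤ.* -1^ (+ suc m -ℤ + suc j) ≡ -1^ (+ j)
signs {m} {j} j≤m = trans (cong₂ ℤ._*_ (-1^-⊖ {m} {0} ℕ.z≤n) (-1^-⊖ j≤m))
  (trans (cong (λ k → ℤ.-1ℤ ℤ.^ k ℤ.* u) (sym (ℕP.m+[n∸m]≡n j≤m)))
  (trans (cong (ℤ._* u) (ℤP.^-distribˡ-+-* ℤ.-1ℤ j (m ℕ.∸ j)))
  (trans (ℤP.*-assoc (ℤ.-1ℤ ℤ.^ j) u u) (trans (cong (ℤ.-1ℤ ℤ.^ j ℤ.*_) (-1^-square (m ℕ.∸ j))) (ℤP.*-identityʳ _)))))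
  where u = ℤ.-1ℤ ℤ.^ (m ℕ.∸ j)

-- Each coefficient of row m contributes to two neighbours in row m + 1, so the sum regroups into
-- pairs. The shift of the index leaves the term with m over m + 1, which is 0.
pascal : ∀ m (g : ℕ → ℝ) →
  ∑ (suc (suc m)) (λ k → ι (suc m C k) * g k) ≈ ∑ (suc m) (λ j → ι (m C j) * (g j + g (suc j)))
pascal m g = begin-equality
  ∑ (suc (suc m)) (λ k → ι (suc m C k) * g k)
    ≈⟨ ∑-shift (suc m) (λ k → ι (suc m C k) * g k) ⟩
  1ℝ * g 0 + ∑ (suc m) (λ j → ι (suc m C suc j) * g (suc j))
    ≈⟨ +-cong ≈-refl (∑-cong (suc m) split) ⟩
  1ℝ * g 0 + ∑ (suc m) (λ j → ι (m C suc j) * g (suc j) + ι (m C j) * g (suc j))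
    ≈⟨ +-cong ≈-refl (∑-+ (suc m) (λ j → ι (m C suc j) * g (suc j)) (λ j → ι (m C j) * g (suc j))) ⟩
  1ℝ * g 0 + (∑ (suc m) (λ j → ι (m C suc j) * g (suc j)) + R)
    ≈⟨ solve 3 (λ a b c → a :+ (b :+ c) := a :+ b :+ c) ≈-refl (1ℝ * g 0) (∑ (suc m) (λ j → ι (m C suc j) * g (suc j))) R ⟩
  1ℝ * g 0 + ∑ (suc m) (λ j → ι (m C suc j) * g (suc j)) + R
    ≈⟨ +-cong (∑-shift (suc m) (λ k → ι (m C k) * g k)) ≈-refl ⟨
  ∑ (suc m) (λ k → ι (m C k) * g k) + ι (m C suc m) * g (suc m) + R
    ≈⟨ +-cong (+-cong ≈-refl (*-cong (subst (λ c → ι (m C suc m) ≈ ι c) (k>n⇒nCk≡0 (ℕP.n<1+n m)) ≈-refl) ≈-refl)) ≈-refl ⟩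
  ∑ (suc m) (λ k → ι (m C k) * g k) + 0ℝ * g (suc m) + R
    ≈⟨ solve 3 (λ s x r → s :+ con 0ℚ :* x :+ r := s :+ r) ≈-refl (∑ (suc m) (λ k → ι (m C k) * g k)) (g (suc m)) R ⟩
  ∑ (suc m) (λ k → ι (m C k) * g k) + R
    ≈⟨ ∑-+ (suc m) (λ k → ι (m C k) * g k) (λ j → ι (m C j) * g (suc j)) ⟨
  ∑ (suc m) (λ j → ι (m C j) * g j + ι (m C j) * g (suc j))
    ≈⟨ ∑-cong (suc m) (λ j → solve 3 (λ c a b → c :* a :+ c :* b := c :* (a :+ b)) ≈-refl (ι (m C j)) (g j) (g (suc j))) ⟩
  ∑ (suc m) (λ j → ι (m C j) * (g j + g (suc j))) ∎
  where
  open ℝR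
  R : ℝ
  R = ∑ (suc m) (λ j → ι (m C j) * g (suc j))
  ι-+ : ∀ a b → ι (a ℕ.+ b) ≈ ι a + ι b
  ι-+ zero    b = solve 1 (λ x → x := con 0ℚ :+ x) ≈-refl (ι b)
  ι-+ (suc a) b = ≈-trans (fromℤ-suc (a ℕ.+ b)) (≈-trans (+-cong (ι-+ a b) ≈-refl)
    (≈-trans (solve 2 (λ x y → x :+ y :+ con 1ℚ := x :+ con 1ℚ :+ y) ≈-refl (ι a) (ι b)) (+-cong (≈-sym (fromℤ-suc a)) ≈-refl)))
  split : ∀ j → ι (suc m C suc j) * g (suc j) ≈ ι (m C suc j) * g (suc j) + ι (m C j) * g (suc j)
  split j = ≈-trans (*-cong (≈-trans (subst (λ c → ι (suc m C suc j) ≈ ι c) (sym (nCk+nC[k+1]≡[n+1]C[k+1] m j)) ≈-refl) (ι-+ (m C j) (m C suc j))) ≈-refl)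
    (solve 3 (λ a b x → (a :+ b) :* x := b :* x :+ a :* x) ≈-refl (ι (m C j)) (ι (m C suc j)) (g (suc j)))

-- Coordinates of L_(m+1) with respect to the polynomials (j + 1) u^j - u^(j+1), not with respect to
-- the powers of u.
laguerreCoefficient : ℕ → ℕ → ℝ
laguerreCoefficient m j = ι (m C j) * fromℚ ((-1^ (+ j)) /! suc j)

-- A pair from `pascal` is (-1)^j u^j / j! + (-1)^(j+1) u^(j+1) / (j + 1)!. Taking out (-1)^j / (j +
-- 1)! leaves (j + 1) u^j - u^(j+1), which for u = log x is x² f_(j+1)′(x).
laguerre-suc : ∀ m u → laguerre (suc m) u ≈ ∑ (suc m) (λ j → laguerreCoefficient m j * (dpow (suc j) u - u ^ suc j))
laguerre-suc m u = begin-equality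
  laguerre (suc m) u
    ≈⟨ ∑-cong (suc (suc m)) (λ k → ≈-trans (*-cong (/!-scale (+ (suc m C k)) (-1^ (+ k)) k) ≈-refl)
         (solve 3 (λ a b c → a :* b :* c := a :* (b :* c)) ≈-refl (ι (suc m C k)) (fromℚ ((-1^ (+ k)) /! k)) (u ^ k))) ⟩
  ∑ (suc (suc m)) (λ k → ι (suc m C k) * g k)
    ≈⟨ pascal m g ⟩
  ∑ (suc m) (λ j → ι (m C j) * (g j + g (suc j)))
    ≈⟨ ∑-cong (suc m) pair ⟩
  ∑ (suc m) (λ j → laguerreCoefficient m j * (dpow (suc j) u - u ^ suc j)) ∎
  where
  open ℝR
  g : ℕ → ℝ
  g k = fromℚ ((-1^ (+ k)) /! k) * u ^ k
  pair : ∀ j → ι (m C j) * (g j + g (suc j)) ≈ laguerreCoefficient m j * (dpow (suc j) u - u ^ suc j)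
  pair j = begin-equality
    c * (fromℚ ((-1^ (+ j)) /! j) * u ^ j + fromℚ ((-1^ (+ suc j)) /! suc j) * u ^ suc j)
      ≈⟨ *-cong ≈-refl (+-cong (*-cong (≈-sym (/!-cancel j (-1^ (+ j)))) ≈-refl) (*-cong (/!-scale ℤ.-1ℤ (-1^ (+ j)) (suc j)) ≈-refl)) ⟩
    c * (ι (suc j) * s * u ^ j + fromℤ ℤ.-1ℤ * s * u ^ suc j)
      ≈⟨ solve 5 (λ c k s p q → c :* (k :* s :* p :+ con (ℤ.-1ℤ ℚ./ 1) :* s :* q) := c :* s :* (k :* p :- q)) ≈-refl c (ι (suc j)) s (u ^ j) (u ^ suc j) ⟩
    c * s * (dpow (suc j) u - u ^ suc j) ∎
    where
    c s : ℝ
    c = ι (m C j)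
    s = fromℚ ((-1^ (+ j)) /! suc j)

-- Boundary values at 1 and the comparison with the coefficients ℓ_n.

laguerre-cong : ∀ n {x y} → x ≈ y → laguerre n x ≈ laguerre n y
laguerre-cong n e = ∑-cong (suc n) (λ k → *-cong ≈-refl (^-cong k e))

-- The power log^0 is 1 even at x = 1, where the logarithm vanishes. This is the origin of the -1 in
-- ℓ_0 = γ_0 - 1; for positive exponents the boundary value is 0.
U0-1 : U 0 1ℝ ≈ 1ℝ
U0-1 = ≈-trans (+-cong ≈-refl (*-cong (*-cong ln1≈0 ≈-refl) ≈-refl))
  (solve 1 (λ q → con 1ℚ :+ con 0ℚ :* con 1ℚ :* :- q := con 1ℚ) ≈-refl (fromℚ (+ 1 ℚ./ 1)))

Usuc-1 : ∀ k → U (suc k) 1ℝ ≈ 0ℝ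
Usuc-1 k = ≈-trans (+-cong (*-cong ln1≈0 ≈-refl) (*-cong (*-cong ln1≈0 ≈-refl) ≈-refl))
  (solve 3 (λ a b q → con 0ℚ :* a :+ con 0ℚ :* b :* :- q := con 0ℚ) ≈-refl (ln 1ℝ ^ k) (ln 1ℝ ^ suc k) (fromℚ (+ 1 ℚ./ suc (suc k))))

integrand≈ : ∀ n t (d : Dom (integrand n) t) →
  apply (integrand n) t d ≈ frac t (proj₂ d) * rec t ^ 2 * laguerre n (ln t)
integrand≈ n t (1≤t , F) = *-cong (*-cong ≈-refl (^-cong 2 (recip≈rec t 1≤t))) (laguerre-cong n (log≈ln t 1≤t))

theorem2p1 : (γ : ℕ → ℝ) → AreStieltjesConstants γ →
    (n : ℕ) →
    Σ[ I ∈ ℝ ]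
    HasImproperIntegral (integrand n) 1ℝ I ×
    (ℓ γ n ≈ fromℤ (-1^ (+ n -ℤ + 1)) * I)
-- Pascal's rule needs a positive index. For n = 0 the polynomial is 1 and 1/x² = -f_0′(x), so the
-- integral is the negative of γ_0 - U_0(1); the sign (-1)^(-1) cancels this.
theorem2p1 γ s⟶γ zero = - 1ℝ * I + 0ℝ * I , improper-linear L h h , (begin-equality
    γ 0 - 1ℝ
      ≈⟨ +-cong ≈-refl (neg-cong (≈-sym U0-1)) ⟩
    I
      ≈⟨ solve 1 (λ i → i := con (ℤ.-1ℤ ℚ./ 1) :* (:- con 1ℚ :* i :+ con 0ℚ :* i)) ≈-refl I ⟩
    fromℤ (-1^ (+ 0 -ℤ + 1)) * (- 1ℝ * I + 0ℝ * I) ∎)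
  where
  open ℝR
  I : ℝ
  I = γ 0 - U 0 1ℝ
  h : HasImproperIntegral (fn (frac-weight (v 0))) 1ℝ I
  h = v-improper 0 (s⟶γ 0)
  L : LinearCombination (- 1ℝ) 0ℝ (fn (frac-weight (v 0))) (fn (frac-weight (v 0))) (integrand 0)
  L = record
    { into-f = λ _ d → d ; into-g = λ _ d → d
    ; combine = λ t d → ≈-trans (integrand≈ 0 t d)
        (solve 2 (λ x r → x :* (r :* (r :* con 1ℚ)) :* (con 0ℚ :+ con 1ℚ :* con 1ℚ)
           := :- con 1ℚ :* (x :* (r :* (r :* con 1ℚ) :* (con 0ℚ :- con 1ℚ))) :+ con 0ℚ :* (x :* (r :* (r :* con 1ℚ) :* (con 0ℚ :- con 1ℚ))))
           ≈-refl (frac t (proj₂ d)) (rec t)) }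
theorem2p1 γ s⟶γ (suc m) = 1ℝ * J + 0ℝ * J , improper-linear L h h , (begin-equality
    ∑ (suc m) (λ j → c j * γ (suc j))
      ≈⟨ ∑-cong-< (suc m) (λ j j<m → term j (ℕP.≤-pred j<m)) ⟩
    ∑ (suc m) (λ j → σ * (laguerreCoefficient m j * I j))
      ≈⟨ ∑-* (suc m) σ (λ j → laguerreCoefficient m j * I j) ⟩
    σ * J
      ≈⟨ solve 2 (λ s i → s :* i := s :* (con 1ℚ :* i :+ con 0ℚ :* i)) ≈-refl σ J ⟩
    σ * (1ℝ * J + 0ℝ * J) ∎)
  where
  open ℝR
  w : ℕ → Weight
  w j = frac-weight (v (suc j))
  I c : ℕ → ℝ
  I j = γ (suc j) - U (suc j) 1ℝ
  c j = fromℚ ((+ (m C j) ℤ.* -1^ (+ suc m -ℤ + suc j)) /! suc j)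
  σ J : ℝ
  σ = fromℤ (-1^ (+ suc m -ℤ + 1))
  J = ∑ (suc m) (λ j → laguerreCoefficient m j * I j)
  W : Weight
  W t d = ∑ (suc m) (λ j → laguerreCoefficient m j * w j t d)
  h : HasImproperIntegral (fn W) 1ℝ J
  h = improper-∑ (suc m) (laguerreCoefficient m) w I (λ j → v-improper (suc j) (s⟶γ (suc j)))
  L : LinearCombination 1ℝ 0ℝ (fn W) (fn W) (integrand (suc m))
  L = record
    { into-f = λ _ d → d ; into-g = λ _ d → d
    ; combine = λ t d → let x = frac t (proj₂ d) ; r = rec t ; u = ln t in begin-equality
        apply (integrand (suc m)) t d
          ≈⟨ integrand≈ (suc m) t d ⟩
        x * r ^ 2 * laguerre (suc m) u
          ≈⟨ *-cong ≈-refl (laguerre-suc m u) ⟩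
        x * r ^ 2 * ∑ (suc m) (λ j → laguerreCoefficient m j * (dpow (suc j) u - u ^ suc j))
          ≈⟨ ∑-* (suc m) (x * r ^ 2) (λ j → laguerreCoefficient m j * (dpow (suc j) u - u ^ suc j)) ⟨
        ∑ (suc m) (λ j → x * r ^ 2 * (laguerreCoefficient m j * (dpow (suc j) u - u ^ suc j)))
          ≈⟨ ∑-cong (suc m) (λ j → solve 4 (λ x r k e → x :* r :* (k :* e) := k :* (x :* (r :* e))) ≈-refl x (r ^ 2) (laguerreCoefficient m j) (dpow (suc j) u - u ^ suc j)) ⟩
        W t d
          ≈⟨ solve 1 (λ s → s := con 1ℚ :* s :+ con 0ℚ :* s) ≈-refl (W t d) ⟩
        1ℝ * W t d + 0ℝ * W t d ∎ }
  σ*σ≈1 : σ * σ ≈ 1ℝ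
  σ*σ≈1 = pointwise-≈ λ _ → trans (sym (/-scale (-1^ (+ suc m -ℤ + 1)) (-1^ (+ suc m -ℤ + 1)) 1))
    (cong (ℚ._/ 1) (signs {m} {0} ℕ.z≤n))
  coefficient : ∀ j → j ℕ.≤ m → laguerreCoefficient m j ≈ σ * c j
  coefficient j j≤m = begin-equality
    b * fromℚ ((-1^ (+ j)) /! suc j)
      ≈⟨ *-cong ≈-refl (pointwise-≈ λ _ → cong (_/! suc j) (sym (signs j≤m))) ⟩
    b * fromℚ ((-1^ (+ suc m -ℤ + 1) ℤ.* s) /! suc j)
      ≈⟨ *-cong ≈-refl (/!-scale (-1^ (+ suc m -ℤ + 1)) s (suc j)) ⟩
    b * (σ * fromℚ (s /! suc j))
      ≈⟨ solve 3 (λ b σ f → b :* (σ :* f) := σ :* (b :* f)) ≈-refl b σ (fromℚ (s /! suc j)) ⟩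
    σ * (b * fromℚ (s /! suc j))
      ≈⟨ *-cong ≈-refl (/!-scale (+ (m C j)) s (suc j)) ⟨
    σ * c j ∎
    where
    b : ℝ
    b = ι (m C j)
    s : ℤ
    s = -1^ (+ suc m -ℤ + suc j)
  term : ∀ j → j ℕ.≤ m → c j * γ (suc j) ≈ σ * (laguerreCoefficient m j * I j)
  term j j≤m = begin-equality
    c j * γ (suc j)
      -- The 1 becomes σ²: one σ stays in front of the integral, the other turns c_j into the
      -- Laguerre coefficient. The 0 becomes the boundary value, which completes γ to the integral
      -- `I j`.
      ≈⟨ solve 2 (λ c g → c :* g := con 1ℚ :* c :* (g :- con 0ℚ)) ≈-refl (c j) (γ (suc j)) ⟩
    1ℝ * c j * (γ (suc j) - 0ℝ)
      ≈⟨ *-cong (*-cong (≈-sym σ*σ≈1) ≈-refl) (+-cong ≈-refl (neg-cong (≈-sym (Usuc-1 j)))) ⟩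
    σ * σ * c j * I j
      ≈⟨ solve 3 (λ s c i → s :* s :* c :* i := s :* (s :* c :* i)) ≈-refl σ (c j) (I j) ⟩
    σ * (σ * c j * I j)
      ≈⟨ *-cong ≈-refl (*-cong (coefficient j j≤m) ≈-refl) ⟨
    σ * (laguerreCoefficient m j * I j) ∎
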